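{- Let $\lvert\operatorname{YFrieze}(w)\rvert$ denote the number of $\mathbf{Y}$-frieze patterns of width $w$. Then $$\lvert\operatorname{YFrieze}(w)\rvert=\begin{cases} C^{(2)}_{w+1}, & \text{if } w \text{ is even};\\ C^{(2)}_{w+1}-C^{(3)}_{\frac{w+1}{2}}, & \text{if } w\equiv 1 \pmod 4;\\ C^{(2)}_{w+1}-C^{(3)}_{\frac{w+1}{2}}-C^{(5)}_{\frac{w+1}{4}}, & \text{if } w\equiv 3\pmod 4,\end{cases}$$ where $C^{(q)}_p:=\frac{1}{(q-1)p+1}\binom{qp}{p}$ are the Fuss-Catalan numbers.
   Context: Let $w\in\mathbb{Z}_{\ge -1}$. A $\mathbf{Y}$-frieze pattern $B$ of width $w$ is an integer array $(b_{i,j})_{i,j\in\mathbb{Z},\,-3\le j-i\le w+2}$ such that: (1) for all $i\in\mathbb{Z}$, $b_{i,i-3}=b_{i,i-1}=b_{i,i+w}=b_{i,i+w+2}=0$ and $b_{i,i-2}=b_{i,i+w+1}=-1$; (2) $b_{i,j}$ is a positive integer for all $i,j\in\mathbb{Z}$ with $0\le j-i\le w-1$; (3) ($\mathbf{Y}$-diamond rule) $b_{i,j}b_{i+1,j+1}=(1+b_{i,j+1})(1+b_{i+1,j})$ for all $i,j\in\mathbb{Z}$ with $-2\le j-i\le w+1$. The set of all $\mathbf{Y}$-frieze patterns of width $w$ is denoted by $\operatorname{YFrieze}(w)$.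
   Formalization: The width w = −1, which the definition of Y-frieze patterns allows, is excluded (the theorem is for w ≥ 0): there the formula would give 1 − 1 − 1 = −1, although exactly one pattern exists. -}

module Defs where

open import Data.Fin using (Fin)
open import Data.Integer as Int using (ℤ; 0ℤ; 1ℤ; -1ℤ; +_; -_; _≤_; _<_)
open import Data.Nat as Nat using (ℕ; zero; suc)
open import Data.Nat.Combinatorics using (_C_; nCk+nC[k+1]≡[n+1]C[k+1]; nC1≡n)
open import Data.Nat.Divisibility using (_∣_; divides; ∣m+n∣m⇒∣n; ∣n⇒∣m*n; 1∣_)
open import Data.Nat.DivMod using (_/_; m*[n/m]≡n)
open import Data.Nat.Properties
  using (+-identityʳ; +-cancelʳ-≡; *-zeroʳ; *-identityʳ)
open import Data.Nat.Solver using (module +-*-Solver)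
open import Function.Bundles using (Inverse)
open import Level using (0ℓ)
open import Relation.Binary.Bundles using (Setoid)
open import Relation.Binary.PropositionalEquality
open +-*-Solver using (solve; _:+_; _:*_; _:=_; con)

-- The width w is meant to be ≥ -1.  Only the values of `b` on the strip
-- -3 ≤ j - i ≤ w + 2 are constrained, and patterns are compared there only
-- (see `_≈_`), so a pattern up to `_≈_` is an array indexed by the strip.
record YFriezePattern (w : ℤ) : Set where
  open Int using (_+_; _-_; _*_)
  field
    b            : ℤ → ℤ → ℤ
    b[i,i-3]     : ∀ i → b i (i - + 3) ≡ 0ℤ
    b[i,i-2]     : ∀ i → b i (i - + 2) ≡ -1ℤ
    b[i,i-1]     : ∀ i → b i (i - + 1) ≡ 0ℤ
    b[i,i+w]     : ∀ i → b i (i + w) ≡ 0ℤ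
    b[i,i+w+1]   : ∀ i → b i (i + w + + 1) ≡ -1ℤ
    b[i,i+w+2]   : ∀ i → b i (i + w + + 2) ≡ 0ℤ
    positive     : ∀ i j → 0ℤ ≤ j - i → j - i ≤ w - + 1 → 0ℤ < b i j
    diamond-rule : ∀ i j → - + 2 ≤ j - i → j - i ≤ w + + 1 →
                   b i j * b (i + + 1) (j + + 1) ≡
                   (1ℤ + b i (j + + 1)) * (1ℤ + b (i + + 1) j)

_≈_ : ∀ {w} → YFriezePattern w → YFriezePattern w → Set
_≈_ {w} B B′ = ∀ i j → - + 3 ≤ j Int.- i → j Int.- i ≤ w Int.+ + 2 → b B i j ≡ b B′ i j
  where open YFriezePattern

YFrieze : ℤ → Setoid 0ℓ 0ℓ
YFrieze w = record
  { Carrier       = YFriezePattern w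
  ; _≈_           = _≈_
  ; isEquivalence = record
    { refl  = λ i j _ _ → refl
    ; sym   = λ p i j l u → sym (p i j l u)
    ; trans = λ p q i j l u → trans (p i j l u) (q i j l u)
    }
  }

HasCardinality : ∀ {a ℓ} → Setoid a ℓ → ℕ → Set _
HasCardinality S n = Inverse S (setoid (Fin n))

open Nat using (_+_; _*_; _∸_)

-- Meant for q ≥ 1, where the division is exact: see `fussCatalan-exact`.
fussCatalan : ℕ → ℕ → ℕ
fussCatalan q p = ((q * p) C p) / suc ((q ∸ 1) * p)

private
  C-step : ∀ n k → suc k * (n C suc k) + k * (n C k) ≡ n * (n C k)
  C-step zero zero = refl
  C-step zero (suc k) = cong₂ _+_ (*-zeroʳ k) (*-zeroʳ k)
  C-step (suc n) zero = trans (+-identityʳ _)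
    (trans (+-identityʳ _) (trans (nC1≡n (suc n)) (sym (*-identityʳ (suc n)))))
  C-step (suc n) (suc k)
    rewrite sym (nCk+nC[k+1]≡[n+1]C[k+1] n k)
          | sym (nCk+nC[k+1]≡[n+1]C[k+1] n (suc k)) = begin
      suc (suc k) * (y + z) + suc k * (x + y)
        ≡⟨ solve 4 (λ k x y z →
             (con 2 :+ k) :* (y :+ z) :+ (con 1 :+ k) :* (x :+ y) :=
             ((con 2 :+ k) :* z :+ (con 1 :+ k) :* y) :+
             (((con 1 :+ k) :* y :+ k :* x) :+ (x :+ y))) refl k x y z ⟩
      (suc (suc k) * z + suc k * y) + ((suc k * y + k * x) + (x + y))
        ≡⟨ cong₂ (λ s t → s + (t + (x + y))) (C-step n (suc k)) (C-step n k) ⟩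
      n * y + (n * x + (x + y))
        ≡⟨ solve 3 (λ n x y → n :* y :+ (n :* x :+ (x :+ y)) :=
             (con 1 :+ n) :* (x :+ y)) refl n x y ⟩
      suc n * (x + y) ∎
    where
    open ≡-Reasoning
    x = n C k
    y = n C suc k
    z = n C suc (suc k)

  fussCatalan-∣ : ∀ r p → suc (r * p) ∣ (suc r * p) C p
  fussCatalan-∣ r zero rewrite *-zeroʳ r = 1∣ _
  fussCatalan-∣ r (suc k) = ∣m+n∣m⇒∣n total (subst (d ∣_) (eq₂ r) (∣n⇒∣m*n r d∣pX))
    where
    p = suc k
    d = suc (r * p)
    X = (suc r * p) C p
    Y = (suc r * p) C k
    absorb : p * X ≡ Y * d
    absorb = +-cancelʳ-≡ (k * Y) (p * X) (Y * d) (trans (C-step (suc r * p) k)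
      (solve 3 (λ r k Y →
        ((con 1 :+ r) :* (con 1 :+ k)) :* Y :=
        Y :* (con 1 :+ r :* (con 1 :+ k)) :+ k :* Y) refl r k Y))
    d∣pX : d ∣ p * X
    d∣pX = divides Y absorb
    eq₂ : ∀ r → r * (p * X) ≡ (r * p) * X
    eq₂ r = solve 3 (λ r p X → r :* (p :* X) := (r :* p) :* X) refl r p X
    total : d ∣ (r * p) * X + X
    total = divides X (solve 2 (λ m X → m :* X :+ X := X :* (con 1 :+ m)) refl (r * p) X)

fussCatalan-exact : ∀ r p → suc (r * p) * fussCatalan (suc r) p ≡ (suc r * p) C p
fussCatalan-exact r p = m*[n/m]≡n (fussCatalan-∣ r p)

{-# OPTIONS --safe #-}

-- A Y-frieze pattern has entries b i j = d i (j+3) · d (i+1) (j+2), where d i j = det (v i) (v j) for vectors v i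
-- with d i (i+1) = 1 that are unique up to rescaling them by λ for even i and by λ⁻¹ for odd i.  Writing
-- c i = d (i-1) (i+1), the integrality of all entries forces c i · c j ∈ ℤ for i, j of opposite parity, so that for a
-- suitable λ all c i are integers; if the number n = w + 3 of vertices is even, λ can be chosen uniquely such that the
-- c i with i even are coprime.  Integral vectors v i are those of a triangulation of the n-gon, every vector of a
-- triangle being the sum of the vectors at its base, and c i is the number of triangles at i.  Hence the patterns
-- correspond to the triangulations, except those (n even) where some d ≥ 2 divides all c i with i even.  Considering
-- c modulo d, one finds that d = 2 or d = 3, and that such triangulations are obtained from a dissection into
-- quadrangles (d = 2) or hexagons (d = 3) by joining in each piece the vertices of even index.
module Submission where

open import Data.Bool using (Bool; true; false; not; T)
open import Data.Empty using (⊥; ⊥-elim)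
open import Data.Fin using (Fin)
open import Data.Integer as ℤ using (ℤ; +_; 0ℤ; 1ℤ; ∣_∣; +<+; +≤+; -[1+_]; -1ℤ; _-_)
import Data.Integer.Properties as ℤₚ
open import Data.Integer.Solver using (module +-*-Solver)
import Data.Integer.Tactic.RingSolver as ℤ-Ring
open import Data.List using (List; []; _∷_; map; _++_; length; filter; lookup)
import Data.List.Membership.DecPropositional as DecMembership
open import Data.List.Membership.Propositional using (_∈_; _∉_)
import Data.List.Membership.Propositional.Properties as ∈ₚ
open import Data.List.Membership.Propositional.Properties.WithK using (unique∧set⇒bag)
import Data.List.Properties as Listₚ
open import Data.List.Relation.Binary.BagAndSetEquality using (∼bag⇒↭)
open import Data.List.Relation.Binary.Permutation.Propositional.Properties using (↭-length)
open import Data.List.Relation.Unary.All as All using (All; []; _∷_)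
import Data.List.Relation.Unary.All.Properties as Allₚ
open import Data.List.Relation.Unary.AllPairs using ([]; _∷_)
open import Data.List.Relation.Unary.Any as Any using (here)
open import Data.List.Relation.Unary.Any.Properties using (lookup-index)
open import Data.List.Relation.Unary.Unique.Propositional using (Unique)
import Data.List.Relation.Unary.Unique.Propositional.Properties as Uniqueₚ
open import Data.Nat using (ℕ; zero; suc; _+_; _*_; _∸_; _≤_; _<_; s≤s; z≤n; _≤?_; >-nonZero; _<?_)
open import Data.Nat.Combinatorics using (_C_; nCk+nC[k+1]≡[n+1]C[k+1]; nC1≡n)
open import Data.Nat.DivMod using (_/_; _%_; m≡m%n+[m/n]*n; m*n/n≡m)
open import Data.Nat.Divisibility as ∣ₚ using (_∣_; divides; ∣m+n∣m⇒∣n; ∣m∣n⇒∣m+n; _∣0; ∣-refl; ∣1⇒≡1; _∣?_; ∣-trans; quotient; n∣m*n)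
open import Data.Nat.GCD using (gcd; gcd-GCD; module Bézout; gcd[m,n]∣m; gcd[m,n]∣n; gcd-greatest; c*gcd[m,n]≡gcd[cm,cn])
open import Data.Nat.Primality using (prime[2]; Prime; prime?; prime⇒irreducible)
import Data.Nat.Properties as ℕₚ
import Data.Nat.Tactic.RingSolver as ℕ-Ring
open import Data.Product using (∃; ∃-syntax; _×_; _,_; proj₁; proj₂)
open import Data.Rational as ℚ using (ℚ; 0ℚ; 1ℚ; toℚᵘ)
import Data.Rational.Properties as ℚₚ
open import Data.Rational.Unnormalised as ℚᵘ using (mkℚᵘ; *≡*; *<*)
import Data.Rational.Unnormalised.Properties as ℚᵘₚ
open import Data.Sum using (_⊎_; inj₁; inj₂)
open import Data.Unit using (⊤; tt)
open import Data.Vec as Vec using (Vec; []; _∷_)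
import Data.Vec.Properties as Vecₚ
open import Defs
open import Function.Bundles using (mk⇔)
open import Level using (0ℓ)
open import Relation.Binary.Definitions using (DecidableEquality; tri<; tri≈; tri>)
open import Relation.Binary.PropositionalEquality
open import Relation.Nullary using (yes; no; ¬_; contradiction; ¬?)
open import Relation.Nullary.Decidable using (from-yes; from-no; dec⇒maybe)
import Tactic.RingSolver as RingSolver
open import Tactic.RingSolver.Core.AlmostCommutativeRing using (AlmostCommutativeRing; fromCommutativeRing)

-- Enumeration of q-ary trees

-- A pattern contains only products in which λ cancels, so integrality is proved inside ℚ for the
-- invariants of rescaling: determinants of two vertices of opposite parity and products of two
-- labels of opposite parity. A gcd then provides an integral choice of the labels. For even n a
-- triangulation whose even labels share a factor d ≥ 2 yields no new pattern: dividing the even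
-- labels by d and multiplying the odd ones by d changes no product of neighbours and gives another
-- integral chain, hence another triangulation. The values 2 and 3 come from the parts cut off by a
-- diagonal between two even vertices: modulo d their root labels are both 1 or both 2. Where parts
-- meet at an even vertex the root triangle adds 1, so d divides 1 + 1, 1 + 2 or 1 + 1 + 1, while
-- sums 4 and 5 contradict d = 3. A quadrangle has two triangles and a hexagon four; with p = w + 1
-- triangles the dissections are ternary trees with p / 2 nodes and 5-ary trees with p / 4 nodes,
-- whence the last two families of Fuss-Catalan numbers.

data Tree (q : ℕ) : Set where
  leaf : Tree q
  node : Vec (Tree q) q → Tree q

size  : ∀ {q} → Tree q → ℕ
sizes : ∀ {q r} → Vec (Tree q) r → ℕ
size leaf      = 0
size (node ts) = suc (sizes ts)
sizes []       = 0
sizes (t ∷ ts) = size t + sizes ts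

_≟ᵗ_ : ∀ {q} → DecidableEquality (Tree q)
_≟ᶠ_ : ∀ {q r} → DecidableEquality (Vec (Tree q) r)
leaf    ≟ᵗ leaf    = yes refl
leaf    ≟ᵗ node _  = no λ ()
node _  ≟ᵗ leaf    = no λ ()
node ts ≟ᵗ node us with ts ≟ᶠ us
... | yes refl = yes refl
... | no ts≢us = no λ { refl → ts≢us refl }
[]       ≟ᶠ []       = yes refl
(t ∷ ts) ≟ᶠ (u ∷ us) with t ≟ᵗ u | ts ≟ᶠ us
... | yes refl | yes refl = yes refl
... | no t≢u   | _        = no λ { refl → t≢u refl }
... | _        | no ts≢us = no λ { refl → ts≢us refl }

-- A forest of suc r trees with a node at the root of its first tree is a
-- forest of q + r trees: this drives the recurrence of the Fuss-Catalan numbers.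
graft : ∀ {q r} → Vec (Tree q) (q + r) → Vec (Tree q) (suc r)
graft {q} ts = node (Vec.take q ts) ∷ Vec.drop q ts

forests : (q r p : ℕ) → List (Vec (Tree q) r)
forests q zero    zero    = [] ∷ []
forests q zero    (suc p) = []
forests q (suc r) zero    = map (leaf ∷_) (forests q r zero)
forests q (suc r) (suc p) = map (leaf ∷_) (forests q r (suc p)) ++ map graft (forests q (q + r) p)

sizes-++ : ∀ {q r s} (ts : Vec (Tree q) r) (us : Vec (Tree q) s) → sizes (ts Vec.++ us) ≡ sizes ts + sizes us
sizes-++ []       us = refl
sizes-++ (t ∷ ts) us = trans (cong (λ n → size t + n) (sizes-++ ts us)) (sym (ℕₚ.+-assoc (size t) _ _))

graft-++ : ∀ {q r} (ts : Vec (Tree q) q) (us : Vec (Tree q) r) → graft (ts Vec.++ us) ≡ node ts ∷ us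
graft-++ {q} ts us = cong₂ _∷_ (cong node (proj₁ eqs)) (proj₂ eqs)
  where
  eqs = Vecₚ.++-injective (Vec.take q (ts Vec.++ us)) ts (Vecₚ.take++drop≡id q (ts Vec.++ us))

graft-injective : ∀ {q r} {ts us : Vec (Tree q) (q + r)} → graft ts ≡ graft us → ts ≡ us
graft-injective {q} {r} {ts} {us} eq = trans (sym (Vecₚ.take++drop≡id q ts))
  (trans (cong₂ Vec._++_ (children (cong Vec.head eq)) (cong Vec.tail eq)) (Vecₚ.take++drop≡id q us))
  where
  children : ∀ {ts us : Vec (Tree q) q} → node ts ≡ node us → ts ≡ us
  children refl = refl

∈-forests : ∀ {q} r (p : ℕ) (ts : Vec (Tree q) r) → sizes ts ≡ p → ts ∈ forests q r p
∈-forests zero    zero    []       eq = here refl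
∈-forests (suc r) zero    (leaf ∷ ts)    eq = ∈ₚ.∈-map⁺ _ (∈-forests r zero ts eq)
∈-forests (suc r) (suc p) (leaf ∷ ts)    eq = ∈ₚ.∈-++⁺ˡ (∈ₚ.∈-map⁺ _ (∈-forests r (suc p) ts eq))
∈-forests {q} (suc r) (suc p) (node us ∷ ts) eq = ∈ₚ.∈-++⁺ʳ _ (subst (_∈ map graft (forests q (q + r) p)) (graft-++ us ts)
  (∈ₚ.∈-map⁺ graft (∈-forests (q + r) p (us Vec.++ ts) (trans (sizes-++ us ts) (ℕₚ.suc-injective eq)))))

graft-sizes : ∀ {q r p} (ts : Vec (Tree q) (q + r)) → sizes ts ≡ p → sizes (graft ts) ≡ suc p
graft-sizes {q} ts eq = cong suc (trans (sym (sizes-++ (Vec.take q ts) _)) (trans (cong sizes (Vecₚ.take++drop≡id q ts)) eq))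

forests-sizes : (q r p : ℕ) → All (λ ts → sizes ts ≡ p) (forests q r p)
forests-sizes q zero    zero    = refl ∷ []
forests-sizes q zero    (suc p) = []
forests-sizes q (suc r) zero    = Allₚ.map⁺ (forests-sizes q r zero)
forests-sizes q (suc r) (suc p) = Allₚ.++⁺ (Allₚ.map⁺ (forests-sizes q r (suc p)))
  (Allₚ.map⁺ (All.map (λ {ts} → graft-sizes ts) (forests-sizes q (q + r) p)))

forests-unique : (q r p : ℕ) → Unique (forests q r p)
forests-unique q zero    zero    = [] ∷ []
forests-unique q zero    (suc p) = []
forests-unique q (suc r) zero    = Uniqueₚ.map⁺ Vecₚ.∷-injectiveʳ (forests-unique q r zero)
forests-unique q (suc r) (suc p) = Uniqueₚ.++⁺
  (Uniqueₚ.map⁺ Vecₚ.∷-injectiveʳ (forests-unique q r (suc p)))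
  (Uniqueₚ.map⁺ graft-injective (forests-unique q (q + r) p))
  λ (x , y) → disjoint (∈ₚ.∈-map⁻ _ x) (∈ₚ.∈-map⁻ _ y)
  where
  disjoint : ∀ {ts : Vec (Tree q) (suc r)} {xs ys} →
    (∃ λ us → us ∈ xs × ts ≡ leaf ∷ us) → (∃ λ us → us ∈ ys × ts ≡ graft us) → _
  disjoint (_ , _ , refl) (_ , _ , ())

trees : ∀ q p → List (Tree q)
trees q p = map Vec.head (forests q 1 p)

private
  head-injective : ∀ {q} {ts us : Vec (Tree q) 1} → Vec.head ts ≡ Vec.head us → ts ≡ us
  head-injective {ts = _ ∷ []} {_ ∷ []} refl = refl

trees-unique : ∀ q p → Unique (trees q p)
trees-unique q p = Uniqueₚ.map⁺ head-injective (forests-unique q 1 p)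

∈-trees : ∀ {q} (t : Tree q) → t ∈ trees q (size t)
∈-trees t = ∈ₚ.∈-map⁺ Vec.head (∈-forests 1 (size t) (t ∷ []) (ℕₚ.+-identityʳ _))

trees-size : ∀ {q} p → All (λ t → size t ≡ p) (trees q p)
trees-size {q} p = Allₚ.map⁺ (All.map (λ { {_ ∷ []} eq → trans (sym (ℕₚ.+-identityʳ _)) eq }) (forests-sizes q 1 p))

-- Raney's formula for forests and the Fuss-Catalan numbers

[1+k]nC[1+k]+knCk≡nnCk : ∀ n k → suc k * (n C suc k) + k * (n C k) ≡ n * (n C k)
[1+k]nC[1+k]+knCk≡nnCk zero    zero    = refl
[1+k]nC[1+k]+knCk≡nnCk zero    (suc k) = cong₂ _+_ (ℕₚ.*-zeroʳ k) (ℕₚ.*-zeroʳ k)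
[1+k]nC[1+k]+knCk≡nnCk (suc n) zero    = trans (ℕₚ.+-identityʳ _)
  (trans (ℕₚ.+-identityʳ _) (trans (nC1≡n (suc n)) (sym (ℕₚ.*-identityʳ (suc n)))))
[1+k]nC[1+k]+knCk≡nnCk (suc n) (suc k)
  rewrite sym (nCk+nC[k+1]≡[n+1]C[k+1] n k) | sym (nCk+nC[k+1]≡[n+1]C[k+1] n (suc k)) =
  trans (regroup k x y z) (trans
    (cong₂ (λ s t → s + (t + (x + y))) ([1+k]nC[1+k]+knCk≡nnCk n (suc k)) ([1+k]nC[1+k]+knCk≡nnCk n k))
    (collect n x y))
  where
  x = n C k
  y = n C suc k
  z = n C suc (suc k)
  regroup : ∀ k x y z → suc (suc k) * (y + z) + suc k * (x + y) ≡
                        (suc (suc k) * z + suc k * y) + ((suc k * y + k * x) + (x + y))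
  regroup = ℕ-Ring.solve-∀
  collect : ∀ n x y → n * y + (n * x + (x + y)) ≡ suc n * (x + y)
  collect = ℕ-Ring.solve-∀

-- Grafting changes the number of trees, so the induction has to treat all `r` at once. The result
-- is Raney's formula r / (qp + r) · C(qp + r, p) for q-ary trees, cleared of its denominator.
forests-length : ∀ q r p → (suc q * p + r) * length (forests (suc q) r p) ≡ r * ((suc q * p + r) C p)
forests-length q zero    zero    = cong (_* 1) (trans (ℕₚ.+-identityʳ _) (ℕₚ.*-zeroʳ q))
forests-length q zero    (suc p) = ℕₚ.*-zeroʳ (suc q * suc p + 0)
forests-length q (suc r) zero    = cong₂ _*_ (cong (_+ suc r) (ℕₚ.*-zeroʳ q)) (one (suc r))
  where
  one : ∀ r → length (forests (suc q) r zero) ≡ 1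
  one zero    = refl
  one (suc r) = trans (Listₚ.length-map _ (forests (suc q) r zero)) (one r)
forests-length q (suc r) (suc p) = subst₂ _≡_
  (cong₂ _*_ (sym (ℕₚ.+-suc (suc q * suc p) r)) (sym forests-suc))
  (cong (suc r *_) (trans (nCk+nC[k+1]≡[n+1]C[k+1] M p) (cong (_C suc p) (sym (ℕₚ.+-suc (suc q * suc p) r)))))
  -- The factor `M` produces the terms `M * A` and `M * B` of the two induction hypotheses; the
  -- summand `suc q * (M * X)` lets the relation between `X` and `Y` enter without a subtraction.
  (ℕₚ.*-cancelˡ-≡ (suc M * (A + B)) (suc r * (X + Y)) M (ℕₚ.+-cancelʳ-≡ (suc q * (M * X)) _ _ (begin
    M * (suc M * (A + B)) + suc q * (M * X)
      ≡⟨ distribute M A B _ ⟩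
    suc M * (M * A) + suc M * (M * B) + suc q * (M * X)
      ≡⟨ cong₂ (λ a b → suc M * a + suc M * b + suc q * (M * X)) (forests-length q r (suc p)) MB ⟩
    suc M * (r * Y) + suc M * ((suc q + r) * X) + suc q * (M * X)
      ≡⟨ cong (λ a → suc M * (r * Y) + suc M * ((suc q + r) * X) + suc q * a) ([1+k]nC[1+k]+knCk≡nnCk M p) ⟨
    suc M * (r * Y) + suc M * ((suc q + r) * X) + suc q * (suc p * Y + p * X)
      ≡⟨ expand (suc q) r p X Y ⟩
    M * (suc r * (X + Y)) + suc q * (M * X) ∎)))
  where
  open ≡-Reasoning
  M = suc q * suc p + r
  A = length (forests (suc q) r (suc p))
  B = length (forests (suc q) (suc q + r) p)
  X = M C p
  Y = M C suc p
  forests-suc : length (forests (suc q) (suc r) (suc p)) ≡ A + B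
  forests-suc = trans (Listₚ.length-++ (map (leaf ∷_) (forests (suc q) r (suc p))))
    (cong₂ _+_ (Listₚ.length-map _ (forests (suc q) r (suc p))) (Listₚ.length-map graft (forests (suc q) (suc q + r) p)))
  distribute : ∀ M A B Z → M * (suc M * (A + B)) + Z ≡ suc M * (M * A) + suc M * (M * B) + Z
  distribute = ℕ-Ring.solve-∀
  MB : M * B ≡ (suc q + r) * X
  MB = subst (λ m → m * B ≡ (suc q + r) * (m C p)) (shift (suc q) r p) (forests-length q (suc q + r) p)
    where
    shift : ∀ q r p → q * p + (q + r) ≡ q * suc p + r
    shift = ℕ-Ring.solve-∀
  expand : ∀ q r p X Y → suc (q * suc p + r) * (r * Y) + suc (q * suc p + r) * ((q + r) * X) + q * (suc p * Y + p * X)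
                       ≡ (q * suc p + r) * (suc r * (X + Y)) + q * ((q * suc p + r) * X)
  expand = ℕ-Ring.solve-∀

-- For p > 0 and M = (q + 1) p, one tree in `forests-length` gives C(M + 1, p) / (M + 1), whereas
-- the Fuss-Catalan number is C(M, p) / (qp + 1). Pascal's rule and `absorb` compare the two once
-- both denominators are cleared.
trees-length : ∀ q p → length (trees (suc q) p) ≡ fussCatalan (suc q) p
trees-length q zero rewrite ℕₚ.*-zeroʳ q = refl
trees-length q (suc k) = ℕₚ.*-cancelˡ-≡ _ _ (suc (q * suc k)) (trans
  (ℕₚ.*-cancelˡ-≡ _ _ (suc M) (begin
    suc M * (suc (q * suc k) * L)   ≡⟨ swap (suc M) (suc (q * suc k)) L ⟩
    suc (q * suc k) * (suc M * L)   ≡⟨ cong (suc (q * suc k) *_) formula ⟩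
    suc (q * suc k) * (X + Y)       ≡⟨ ℕₚ.*-distribˡ-+ (suc (q * suc k)) X Y ⟩
    suc (q * suc k) * X + suc (q * suc k) * Y
      ≡⟨ cong (_+ suc (q * suc k) * Y) absorb ⟩
    suc k * Y + suc (q * suc k) * Y ≡⟨ collect q k Y ⟩
    suc M * Y                       ∎))
  (sym (fussCatalan-exact q (suc k))))
  where
  open ≡-Reasoning
  M = suc q * suc k
  L = length (trees (suc q) (suc k))
  X = M C k
  Y = M C suc k
  swap : ∀ a b c → a * (b * c) ≡ b * (a * c)
  swap = ℕ-Ring.solve-∀
  formula : suc M * L ≡ X + Y
  formula = trans (subst₂ _≡_
      (cong₂ _*_ (ℕₚ.+-comm M 1) (sym (Listₚ.length-map Vec.head (forests (suc q) 1 (suc k)))))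
      (trans (ℕₚ.*-identityˡ _) (cong (_C suc k) (ℕₚ.+-comm M 1)))
      (forests-length q 1 (suc k)))
    (sym (nCk+nC[k+1]≡[n+1]C[k+1] M k))
  absorb : suc (q * suc k) * X ≡ suc k * Y
  absorb = ℕₚ.+-cancelʳ-≡ (k * X) _ _ (trans (split q k X) (sym ([1+k]nC[1+k]+knCk≡nnCk M k)))
    where
    split : ∀ q k X → suc (q * suc k) * X + k * X ≡ (suc q * suc k) * X
    split = ℕ-Ring.solve-∀
  collect : ∀ q k Y → suc k * Y + suc (q * suc k) * Y ≡ suc (suc q * suc k) * Y
  collect = ℕ-Ring.solve-∀

-- Differences of lists without repetitions

module _ {a} {A : Set a} (_≟_ : DecidableEquality A) where
  open DecMembership _≟_ using (_∈?_)

  infixl 5 _∖_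
  _∖_ : List A → List A → List A
  xs ∖ ys = filter (λ x → ¬? (x ∈? ys)) xs

  ∖-unique : ∀ {xs} ys → Unique xs → Unique (xs ∖ ys)
  ∖-unique ys = Uniqueₚ.filter⁺ (λ x → ¬? (x ∈? ys))

  ∈-∖⁺ : ∀ {x xs ys} → x ∈ xs → x ∉ ys → x ∈ xs ∖ ys
  ∈-∖⁺ {ys = ys} = ∈ₚ.∈-filter⁺ (λ x → ¬? (x ∈? ys))

  ∈-∖⁻ : ∀ {x} xs ys → x ∈ xs ∖ ys → x ∈ xs × x ∉ ys
  ∈-∖⁻ xs ys = ∈ₚ.∈-filter⁻ (λ x → ¬? (x ∈? ys)) {xs = xs}

  -- Lists without repetitions and with the same members are permutations of each other; this
  -- applies to `(xs ∖ ys) ++ ys` and `xs`.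
  ∖-length : ∀ {xs ys} → Unique xs → Unique ys → (∀ {x} → x ∈ ys → x ∈ xs) →
             length (xs ∖ ys) + length ys ≡ length xs
  ∖-length {xs} {ys} xs! ys! ys⊆xs = trans (sym (Listₚ.length-++ (xs ∖ ys)))
    (↭-length (∼bag⇒↭ (unique∧set⇒bag
      (Uniqueₚ.++⁺ (∖-unique ys xs!) ys! λ (x∈ , x∈ys) → proj₂ (∈-∖⁻ xs ys x∈) x∈ys) xs!
      (mk⇔ to from))))
    where
    to : ∀ {x} → x ∈ (xs ∖ ys) ++ ys → x ∈ xs
    to x∈ with ∈ₚ.∈-++⁻ (xs ∖ ys) x∈
    ... | inj₁ x∈∖ = proj₁ (∈-∖⁻ xs ys x∈∖)
    ... | inj₂ x∈ys = ys⊆xs x∈ys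
    from : ∀ {x} → x ∈ xs → x ∈ (xs ∖ ys) ++ ys
    from {x} x∈ with x ∈? ys
    ... | yes x∈ys = ∈ₚ.∈-++⁺ʳ (xs ∖ ys) x∈ys
    ... | no x∉ys = ∈ₚ.∈-++⁺ˡ (∈-∖⁺ x∈ x∉ys)

-- Triangulations glued from quadrangles or hexagons

pattern fork t u = node (t ∷ u ∷ [])

-- A binary tree with p nodes is a triangulation of a polygon with vertices
-- 0, …, p+1 and root edge {0, p+1}; a vertex is labelled by the number of
-- triangles at it, and `first` and `last` are the labels of 0 and p+1.
first last : Tree 2 → ℕ
first leaf       = 0
first (fork t u) = suc (first t)
last leaf        = 0
last (fork t u)  = suc (last u)

-- Vertices are coloured alternately; `end c t` is the colour of the vertex p+1 if c is that of 0.
end : Bool → Tree 2 → Bool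
end c leaf       = not c
end c (fork t u) = end (end c t) u

-- d divides the label of every vertex of colour `true` strictly between 0 and p+1
Div : ℕ → Bool → Tree 2 → Set
Div d c leaf       = ⊤
Div d c (fork t u) = Div d c t × (T (end c t) → d ∣ suc (last t + first u)) × Div d (end c t) u

-- A quadrangulation, each quadrangle being cut by the diagonal joining its two vertices of colour `true`.
quad : Bool → Tree 3 → Tree 2
quad c     leaf                      = leaf
quad true  (node (s ∷ t ∷ u ∷ []))   = fork (fork (quad true s) (quad false t)) (quad true u)
quad false (node (s ∷ t ∷ u ∷ []))   = fork (quad false s) (fork (quad true t) (quad false u))

-- A hexangulation, each hexagon being cut by the triangle of its three vertices of colour `true`.
hex : Bool → Tree 5 → Tree 2
hex c     leaf = leaf
hex true  (node (s ∷ t ∷ u ∷ v ∷ w ∷ [])) =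
  fork (fork (fork (hex true s) (hex false t)) (fork (hex true u) (hex false v))) (hex true w)
hex false (node (s ∷ t ∷ u ∷ v ∷ w ∷ [])) =
  fork (hex false s) (fork (fork (hex true t) (hex false u)) (fork (hex true v) (hex false w)))

quad-size : ∀ c s → size (quad c s) ≡ 2 * size s
quad-size c     leaf = refl
quad-size true  (node (s ∷ t ∷ u ∷ [])) rewrite quad-size true s | quad-size false t | quad-size true u =
  eq (size s) (size t) (size u)
  where
  eq : ∀ a b c → suc (suc (2 * a + (2 * b + 0)) + (2 * c + 0)) ≡ 2 * suc (a + (b + (c + 0)))
  eq = ℕ-Ring.solve-∀
quad-size false (node (s ∷ t ∷ u ∷ [])) rewrite quad-size false s | quad-size true t | quad-size false u =
  eq (size s) (size t) (size u)
  where
  eq : ∀ a b c → suc (2 * a + (suc (2 * b + (2 * c + 0)) + 0)) ≡ 2 * suc (a + (b + (c + 0)))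
  eq = ℕ-Ring.solve-∀

hex-size : ∀ c s → size (hex c s) ≡ 4 * size s
hex-size c     leaf = refl
hex-size true  (node (s ∷ t ∷ u ∷ v ∷ w ∷ []))
  rewrite hex-size true s | hex-size false t | hex-size true u | hex-size false v | hex-size true w =
  eq (size s) (size t) (size u) (size v) (size w)
  where
  eq : ∀ a b c d e → suc (suc (suc (4 * a + (4 * b + 0)) + (suc (4 * c + (4 * d + 0)) + 0)) + (4 * e + 0))
                   ≡ 4 * suc (a + (b + (c + (d + (e + 0)))))
  eq = ℕ-Ring.solve-∀
hex-size false (node (s ∷ t ∷ u ∷ v ∷ w ∷ []))
  rewrite hex-size false s | hex-size true t | hex-size false u | hex-size true v | hex-size false w =
  eq (size s) (size t) (size u) (size v) (size w)
  where
  eq : ∀ a b c d e → suc (4 * a + (suc (suc (4 * b + (4 * c + 0)) + (suc (4 * d + (4 * e + 0)) + 0)) + 0))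
                   ≡ 4 * suc (a + (b + (c + (d + (e + 0)))))
  eq = ℕ-Ring.solve-∀

fork-injective : ∀ {t u t′ u′ : Tree 2} → fork t u ≡ fork t′ u′ → t ≡ t′ × u ≡ u′
fork-injective refl = refl , refl

quad-injective : ∀ c s s′ → quad c s ≡ quad c s′ → s ≡ s′
quad-injective c leaf leaf eq = refl
quad-injective true  leaf (node (_ ∷ _ ∷ _ ∷ [])) ()
quad-injective false leaf (node (_ ∷ _ ∷ _ ∷ [])) ()
quad-injective true  (node (_ ∷ _ ∷ _ ∷ [])) leaf ()
quad-injective false (node (_ ∷ _ ∷ _ ∷ [])) leaf ()
quad-injective true (node (s ∷ t ∷ u ∷ [])) (node (s′ ∷ t′ ∷ u′ ∷ [])) eq
  with eq′ , e₃ ← fork-injective eq with e₁ , e₂ ← fork-injective eq′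
  with refl ← quad-injective true s s′ e₁ | refl ← quad-injective false t t′ e₂ | refl ← quad-injective true u u′ e₃ = refl
quad-injective false (node (s ∷ t ∷ u ∷ [])) (node (s′ ∷ t′ ∷ u′ ∷ [])) eq
  with e₁ , eq′ ← fork-injective eq with e₂ , e₃ ← fork-injective eq′
  with refl ← quad-injective false s s′ e₁ | refl ← quad-injective true t t′ e₂ | refl ← quad-injective false u u′ e₃ = refl

hex-injective : ∀ c s s′ → hex c s ≡ hex c s′ → s ≡ s′
hex-injective c leaf leaf eq = refl
hex-injective true  leaf (node (_ ∷ _ ∷ _ ∷ _ ∷ _ ∷ [])) ()
hex-injective false leaf (node (_ ∷ _ ∷ _ ∷ _ ∷ _ ∷ [])) ()
hex-injective true  (node (_ ∷ _ ∷ _ ∷ _ ∷ _ ∷ [])) leaf ()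
hex-injective false (node (_ ∷ _ ∷ _ ∷ _ ∷ _ ∷ [])) leaf ()
hex-injective true (node (s ∷ t ∷ u ∷ v ∷ w ∷ [])) (node (s′ ∷ t′ ∷ u′ ∷ v′ ∷ w′ ∷ [])) eq
  with eq′ , e₅ ← fork-injective eq with eq₁ , eq₂ ← fork-injective eq′
  with e₁ , e₂ ← fork-injective eq₁ | e₃ , e₄ ← fork-injective eq₂
  with refl ← hex-injective true s s′ e₁ | refl ← hex-injective false t t′ e₂ | refl ← hex-injective true u u′ e₃
     | refl ← hex-injective false v v′ e₄ | refl ← hex-injective true w w′ e₅ = refl
hex-injective false (node (s ∷ t ∷ u ∷ v ∷ w ∷ [])) (node (s′ ∷ t′ ∷ u′ ∷ v′ ∷ w′ ∷ [])) eq
  with e₁ , eq′ ← fork-injective eq with eq₁ , eq₂ ← fork-injective eq′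
  with e₂ , e₃ ← fork-injective eq₁ | e₄ , e₅ ← fork-injective eq₂
  with refl ← hex-injective false s s′ e₁ | refl ← hex-injective true t t′ e₂ | refl ← hex-injective false u u′ e₃
     | refl ← hex-injective true v v′ e₄ | refl ← hex-injective false w w′ e₅ = refl

quad-end : ∀ c s → end c (quad c s) ≡ not c
quad-end c     leaf = refl
quad-end true  (node (s ∷ t ∷ u ∷ [])) rewrite quad-end true s | quad-end false t = quad-end true u
quad-end false (node (s ∷ t ∷ u ∷ [])) rewrite quad-end false s | quad-end true t = quad-end false u

hex-end : ∀ c s → end c (hex c s) ≡ not c
hex-end c     leaf = refl
hex-end true  (node (s ∷ t ∷ u ∷ v ∷ w ∷ []))
  rewrite hex-end true s | hex-end false t | hex-end true u | hex-end false v = hex-end true w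
hex-end false (node (s ∷ t ∷ u ∷ v ∷ w ∷ []))
  rewrite hex-end false s | hex-end true t | hex-end false u | hex-end true v = hex-end false w

-- The left subtree of the left subtree ends in a vertex of colour `false` in a
-- quadrangulation, but of colour `true` in a hexangulation.
quad≢hex : ∀ s s′ → 0 < size (quad true s) → quad true s ≢ hex true s′
quad≢hex (node (s ∷ _ ∷ _ ∷ [])) (node (s′ ∷ t′ ∷ _ ∷ _ ∷ _ ∷ [])) _ eq
  with () ← trans (sym (quad-end true s)) (trans (cong (end true) (proj₁ (fork-injective (proj₁ (fork-injective eq)))))
              (trans (cong (λ c → end c (hex false t′)) (hex-end true s′)) (hex-end false t′)))

-- the label of the root vertex of colour `true` of a tree whose other root vertex has colour `false`
rootLabel : Bool → Tree 2 → ℕ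
rootLabel true  = first
rootLabel false = last

quad-rootLabel : ∀ c s → 2 ∣ rootLabel c (quad c s)
quad-rootLabel true  leaf = 2 ∣0
quad-rootLabel false leaf = 2 ∣0
quad-rootLabel true  (node (s ∷ t ∷ u ∷ [])) = ∣m∣n⇒∣m+n (∣-refl {2}) (quad-rootLabel true s)
quad-rootLabel false (node (s ∷ t ∷ u ∷ [])) = ∣m∣n⇒∣m+n (∣-refl {2}) (quad-rootLabel false u)

hex-rootLabel : ∀ c s → 3 ∣ rootLabel c (hex c s)
hex-rootLabel true  leaf = 3 ∣0
hex-rootLabel false leaf = 3 ∣0
hex-rootLabel true  (node (s ∷ t ∷ u ∷ v ∷ w ∷ [])) = ∣m∣n⇒∣m+n (∣-refl {3}) (hex-rootLabel true s)
hex-rootLabel false (node (s ∷ t ∷ u ∷ v ∷ w ∷ [])) = ∣m∣n⇒∣m+n (∣-refl {3}) (hex-rootLabel false w)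

private
  -- At a vertex where two subtrees meet, `k` and `l` count the triangles of the piece under
  -- consideration in the left and in the right subtree, besides the root triangle; `m` and `n` come
  -- from the pieces glued on.
  ∣-sum : ∀ {d m n} k l → d ∣ m → d ∣ n → d ∣ suc (k + l) → d ∣ suc ((k + m) + (l + n))
  ∣-sum {d} {m} {n} k l d∣m d∣n d∣ = subst (d ∣_) (eq k l m n) (∣m∣n⇒∣m+n d∣ (∣m∣n⇒∣m+n d∣m d∣n))
    where
    eq : ∀ k l m n → suc (k + l) + (m + n) ≡ suc ((k + m) + (l + n))
    eq = ℕ-Ring.solve-∀

  ∣-sum⁻¹ : ∀ {d m n} k l → d ∣ m → d ∣ n → d ∣ suc ((k + m) + (l + n)) → d ∣ suc (k + l)
  ∣-sum⁻¹ {d} {m} {n} k l d∣m d∣n d∣ = ∣m+n∣m⇒∣n (subst (d ∣_) (eq k l m n) d∣) (∣m∣n⇒∣m+n d∣m d∣n)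
    where
    eq : ∀ k l m n → suc ((k + m) + (l + n)) ≡ (m + n) + suc (k + l)
    eq = ℕ-Ring.solve-∀

-- Each quadrangle has two triangles at either end of its diagonal, that is, at both of its vertices
-- of colour `true`.
quad-Div : ∀ c s → Div 2 c (quad c s)
quad-Div c     leaf = tt
quad-Div true  (node (s ∷ t ∷ u ∷ [])) rewrite quad-end true s | quad-end false t =
  (quad-Div true s , (λ ()) , quad-Div false t) ,
  (λ _ → ∣-sum 1 0 (quad-rootLabel false t) (quad-rootLabel true u) ∣-refl) , quad-Div true u
quad-Div false (node (s ∷ t ∷ u ∷ [])) rewrite quad-end false s | quad-end true t =
  quad-Div false s , (λ _ → ∣-sum 0 1 (quad-rootLabel false s) (quad-rootLabel true t) ∣-refl) ,
  quad-Div true t , (λ ()) , quad-Div false u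

-- At a vertex of colour `true` each hexagon has three triangles: the inner one and the two corners
-- next to it.
hex-Div : ∀ c s → Div 3 c (hex c s)
hex-Div c     leaf = tt
hex-Div true  (node (s ∷ t ∷ u ∷ v ∷ w ∷ []))
  rewrite hex-end true s | hex-end false t | hex-end true u | hex-end false v =
  ((hex-Div true s , (λ ()) , hex-Div false t) ,
   (λ _ → ∣-sum 1 1 (hex-rootLabel false t) (hex-rootLabel true u) ∣-refl) ,
   hex-Div true u , (λ ()) , hex-Div false v) ,
  (λ _ → ∣-sum 2 0 (hex-rootLabel false v) (hex-rootLabel true w) ∣-refl) , hex-Div true w
hex-Div false (node (s ∷ t ∷ u ∷ v ∷ w ∷ []))
  rewrite hex-end false s | hex-end true t | hex-end false u | hex-end true v =
  hex-Div false s , (λ _ → ∣-sum 0 2 (hex-rootLabel false s) (hex-rootLabel true t) ∣-refl) ,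
  (hex-Div true t , (λ ()) , hex-Div false u) ,
  (λ _ → ∣-sum 1 1 (hex-rootLabel false u) (hex-rootLabel true v) ∣-refl) ,
  hex-Div true v , (λ ()) , hex-Div false w

-- Divisibility of labels forces quadrangles or hexagons

Good : ℕ → Bool → Tree 2 → Set
Good d c t = t ≡ leaf ⊎ (d ≡ 2 × ∃ λ s → quad c s ≡ t) ⊎ (d ≡ 3 × ∃ λ s → hex c s ≡ t)

private
  good₂ : ∀ {c t} → Good 2 c t → ∃ λ s → quad c s ≡ t
  good₂ (inj₁ refl)                    = leaf , refl
  good₂ (inj₂ (inj₁ (_ , s , quad≡t))) = s , quad≡t
  good₂ (inj₂ (inj₂ (() , _)))

  good₃ : ∀ {c t} → Good 3 c t → ∃ λ s → hex c s ≡ t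
  good₃ (inj₁ refl)                    = leaf , refl
  good₃ (inj₂ (inj₂ (_ , s , hex≡t))) = s , hex≡t
  good₃ (inj₂ (inj₁ (() , _)))

-- These are incomplete pieces whose root edge is a diagonal. `one` is half a quadrangle or a corner
-- of a hexagon, with root labels 1 modulo d; `two` is a hexagon without one corner, with root
-- labels 2. In `two` three triangles of the hexagon meet at the apex, which makes d = 3.
data TrueTrue (d : ℕ) : Tree 2 → Set where
  one : ∀ {t u} → Good d true t → Good d false u → d ∣ first t → d ∣ last u → TrueTrue d (fork t u)
  two : ∀ {t u v w} → d ≡ 3 → Good d true t → Good d false u → Good d true v → Good d false w →
        d ∣ first t → d ∣ last w → TrueTrue d (fork (fork t u) (fork v w))

-- `Div d` determines the labels of the vertices 0 and p+1 modulo d, depending on their colours.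
Forced : (d : ℕ) → Bool → Bool → Tree 2 → Set
Forced d true  true  t = TrueTrue d t
Forced d true  false t = Good d true t × d ∣ first t
Forced d false true  t = Good d false t × d ∣ last t
Forced d false false t = ⊥

private
  prime-∣ : ∀ {d p} → 2 ≤ d → Prime p → d ∣ p → d ≡ p
  prime-∣ 2≤d p-prime d∣p with prime⇒irreducible p-prime d∣p
  ... | inj₂ d≡p = d≡p
  prime-∣ (s≤s ()) p-prime d∣p | inj₁ refl

  prime[3] : Prime 3
  prime[3] = from-yes (prime? 3)

  3∤4 : ¬ 3 ∣ 4
  3∤4 = from-no (3 ∣? 4)

  3∤5 : ¬ 3 ∣ 5
  3∤5 = from-no (3 ∣? 5)

module _ {d : ℕ} (2≤d : 2 ≤ d) where
  private
    d∤1 : ¬ d ∣ 1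
    d∤1 d∣1 = ℕₚ.<⇒≢ 2≤d (sym (∣1⇒≡1 d∣1))

    -- The root triangle completes the piece behind its diagonal. Modulo d the apex has label 1 + 1
    -- for `one`, which leaves d = 2 and a quadrangle, and 1 + 2 for `two`, which closes a hexagon.
    true-false : ∀ {t u} → TrueTrue d t → Good d true u → d ∣ first u → d ∣ suc (last t + first u) →
                 Good d true (fork t u) × d ∣ suc (first t)
    true-false (one gs gt ds dt) gu du d∣ with prime-∣ 2≤d prime[2] (∣-sum⁻¹ 1 0 dt du d∣)
    ... | refl with s , refl ← good₂ gs | t , refl ← good₂ gt | u , refl ← good₂ gu =
      inj₂ (inj₁ (refl , node (s ∷ t ∷ u ∷ []) , refl)) , ∣m∣n⇒∣m+n (∣-refl {2}) ds
    true-false (two refl gs gt gu gv ds dv) gw dw d∣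
      with s , refl ← good₃ gs | t , refl ← good₃ gt | u , refl ← good₃ gu | v , refl ← good₃ gv | w , refl ← good₃ gw =
      inj₂ (inj₂ (refl , node (s ∷ t ∷ u ∷ v ∷ w ∷ []) , refl)) , ∣m∣n⇒∣m+n (∣-refl {3}) ds

    false-true : ∀ {t u} → Good d false t → d ∣ last t → TrueTrue d u → d ∣ suc (last t + first u) →
                 Good d false (fork t u) × d ∣ suc (last u)
    false-true gs ds (one gt gu dt du) d∣ with prime-∣ 2≤d prime[2] (∣-sum⁻¹ 0 1 ds dt d∣)
    ... | refl with s , refl ← good₂ gs | t , refl ← good₂ gt | u , refl ← good₂ gu =
      inj₂ (inj₁ (refl , node (s ∷ t ∷ u ∷ []) , refl)) , ∣m∣n⇒∣m+n (∣-refl {2}) du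
    false-true gs ds (two refl gt gu gv gw dt dw) d∣
      with s , refl ← good₃ gs | t , refl ← good₃ gt | u , refl ← good₃ gu | v , refl ← good₃ gv | w , refl ← good₃ gw =
      inj₂ (inj₂ (refl , node (s ∷ t ∷ u ∷ v ∷ w ∷ []) , refl)) , ∣m∣n⇒∣m+n (∣-refl {3}) dw

    -- Modulo d the apex has label 1 + 1 + 1, 1 + 1 + 2 or 1 + 2 + 2, and a constructor `two`
    -- already fixes d = 3; so only two corners can meet.
    true-true : ∀ {t u} → TrueTrue d t → TrueTrue d u → d ∣ suc (last t + first u) → TrueTrue d (fork t u)
    true-true (one gs gt ds dt) (one gu gv du dv) d∣ =
      two (prime-∣ 2≤d prime[3] (∣-sum⁻¹ 1 1 dt du d∣)) gs gt gu gv ds dv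
    true-true (one _ _ _ dt) (two refl _ _ _ _ du _) d∣ = contradiction (∣-sum⁻¹ 1 2 dt du d∣) 3∤4
    true-true (two refl _ _ _ _ _ dt) (one _ _ du _) d∣ = contradiction (∣-sum⁻¹ 2 1 dt du d∣) 3∤4
    true-true (two refl _ _ _ _ _ dt) (two _ _ _ _ _ du _) d∣ = contradiction (∣-sum⁻¹ 2 2 dt du d∣) 3∤5

    forced-fork : ∀ c m e {t u} → Forced d c m t → Forced d m e u → (T m → d ∣ suc (last t + first u)) →
                  Forced d c e (fork t u)
    forced-fork true  true  true  ft        fu        d∣ = true-true ft fu (d∣ tt)
    forced-fork true  true  false ft        (gu , du) d∣ = true-false ft gu du (d∣ tt)
    forced-fork true  false true  (gt , dt) (gu , du) d∣ = one gt gu dt du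
    forced-fork true  false false _         ()
    forced-fork false true  true  (gt , dt) fu        d∣ = false-true gt dt fu (d∣ tt)
    forced-fork false true  false (_ , dt)  (_ , du)  d∣ = d∤1 (∣-sum⁻¹ 0 0 dt du (d∣ tt))
    forced-fork false false _     ()

  -- The colour of the apex decides which pieces are joined. Two root vertices of colour `false` are
  -- impossible: an apex of colour `true` would have label 1 modulo d, and one of colour `false`
  -- would leave a smaller tree of the same kind.
  forced : ∀ c t → Div d c t → Forced d c (end c t) t
  forced true  leaf       _ = inj₁ refl , d ∣0
  forced false leaf       _ = inj₁ refl , d ∣0
  forced c     (fork t u) (dt , d∣ , du) =
    forced-fork c (end c t) (end (end c t) u) (forced c t dt) (forced (end c t) u du) d∣

-- Determinants in the plane

V : Set
V = ℤ × ℤ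

infixl 6 _⊕_
infixl 7 _⊛_

opaque
  _⊕_ : V → V → V
  (a , b) ⊕ (c , d) = a ℤ.+ c , b ℤ.+ d

  _⊛_ : ℤ → V → V
  k ⊛ (a , b) = k ℤ.* a , k ℤ.* b

  ⊖_ : V → V
  ⊖ (a , b) = ℤ.- a , ℤ.- b

  det : V → V → ℤ
  det (a , b) (c , d) = a ℤ.* d ℤ.- b ℤ.* c

private
  open +-*-Solver using (Polynomial; solve; _:=_; _:+_; _:*_; _:-_; :-_; con)

  Vᴾ : ℕ → Set
  Vᴾ n = Polynomial n × Polynomial n

  detᴾ : ∀ {n} → Vᴾ n → Vᴾ n → Polynomial n
  detᴾ (a , b) (c , d) = a :* d :- b :* c

  _⊕ᴾ_ : ∀ {n} → Vᴾ n → Vᴾ n → Vᴾ n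
  (a , b) ⊕ᴾ (c , d) = a :+ c , b :+ d

opaque
  unfolding _⊕_ _⊛_ ⊖_ det

  det-self : ∀ x → det x x ≡ 0ℤ
  det-self (a , b) = solve 2 (λ a b → a :* b :- b :* a := con 0ℤ) refl a b

  det-⊕ʳ : ∀ x y z → det x (y ⊕ z) ≡ det x y ℤ.+ det x z
  det-⊕ʳ (a , b) (c , d) (e , f) = solve 6 (λ a b c d e f →
    detᴾ (a , b) ((c , d) ⊕ᴾ (e , f)) := detᴾ (a , b) (c , d) :+ detᴾ (a , b) (e , f)) refl a b c d e f

  det-⊕ˡ : ∀ x y z → det (x ⊕ y) z ≡ det x z ℤ.+ det y z
  det-⊕ˡ (a , b) (c , d) (e , f) = solve 6 (λ a b c d e f →
    detᴾ ((a , b) ⊕ᴾ (c , d)) (e , f) := detᴾ (a , b) (e , f) :+ detᴾ (c , d) (e , f)) refl a b c d e f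

  det-⊛ʳ : ∀ k x y → det x (k ⊛ y) ≡ k ℤ.* det x y
  det-⊛ʳ k (a , b) (c , d) = solve 5 (λ k a b c d →
    detᴾ (a , b) (k :* c , k :* d) := k :* detᴾ (a , b) (c , d)) refl k a b c d

  det-⊖ʳ : ∀ x y → det x (⊖ y) ≡ ℤ.- det x y
  det-⊖ʳ (a , b) (c , d) = solve 4 (λ a b c d →
    detᴾ (a , b) (:- c , :- d) := :- detᴾ (a , b) (c , d)) refl a b c d

  det-⊖ˡ : ∀ x y → det (⊖ x) y ≡ ℤ.- det x y
  det-⊖ˡ (a , b) (c , d) = solve 4 (λ a b c d →
    detᴾ (:- a , :- b) (c , d) := :- detᴾ (a , b) (c , d)) refl a b c d

  det-swap : ∀ x y → det y x ≡ ℤ.- det x y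
  det-swap (a , b) (c , d) = solve 4 (λ a b c d →
    detᴾ (c , d) (a , b) := :- detᴾ (a , b) (c , d)) refl a b c d

  -- In this arrangement all six determinants are nonnegative for vectors in the order x, y, z, w
  -- along a chain, so no minus sign occurs: it is Ptolemy's relation for the polygon.
  plücker : ∀ x y z w → det x z ℤ.* det y w ≡ det x y ℤ.* det z w ℤ.+ det x w ℤ.* det y z
  plücker (a , b) (c , d) (e , f) (g , h) = solve 8 (λ a b c d e f g h →
    let x = a , b ; y = c , d ; z = e , f ; w = g , h in
    detᴾ x z :* detᴾ y w := detᴾ x y :* detᴾ z w :+ detᴾ x w :* detᴾ y z) refl a b c d e f g h

  scale : ∀ {u v} x → det u v ≡ 1ℤ → det u v ⊛ x ≡ x
  scale (a , b) eq = cong₂ _,_ (trans (cong (ℤ._* a) eq) (ℤₚ.*-identityˡ a)) (trans (cong (ℤ._* b) eq) (ℤₚ.*-identityˡ b))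

  expand : ∀ {u v} x → det u v ≡ 1ℤ → x ≡ det x v ⊛ u ⊕ det u x ⊛ v
  expand {u@(a , b)} {v@(c , d)} x@(e , f) eq = trans (sym (scale {u} {v} x eq)) (cong₂ _,_
    (solve 6 (λ a b c d e f → let u = a , b ; v = c , d ; x = e , f in
       detᴾ u v :* e := detᴾ x v :* a :+ detᴾ u x :* c) refl a b c d e f)
    (solve 6 (λ a b c d e f → let u = a , b ; v = c , d ; x = e , f in
       detᴾ u v :* f := detᴾ x v :* b :+ detᴾ u x :* d) refl a b c d e f))

  combine : V → V → V → V
  combine u v (x , y) = x ⊛ u ⊕ y ⊛ v

  combine-e₁ : ∀ u v → combine u v (1ℤ , 0ℤ) ≡ u
  combine-e₁ (a , b) (c , d) = cong₂ _,_
    (trans (ℤₚ.+-identityʳ (1ℤ ℤ.* a)) (ℤₚ.*-identityˡ a)) (trans (ℤₚ.+-identityʳ (1ℤ ℤ.* b)) (ℤₚ.*-identityˡ b))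

  combine-e₂ : ∀ u v → combine u v (0ℤ , 1ℤ) ≡ v
  combine-e₂ (a , b) (c , d) = cong₂ _,_
    (trans (ℤₚ.+-identityˡ (1ℤ ℤ.* c)) (ℤₚ.*-identityˡ c)) (trans (ℤₚ.+-identityˡ (1ℤ ℤ.* d)) (ℤₚ.*-identityˡ d))

  combine-⊕ : ∀ u v x y → combine u v (x ⊕ y) ≡ combine u v x ⊕ combine u v y
  combine-⊕ (a , b) (c , d) (e , f) (g , h) = cong₂ _,_ (eq a c e f g h) (eq b d e f g h)
    where
    eq : ∀ a c e f g h → (e ℤ.+ g) ℤ.* a ℤ.+ (f ℤ.+ h) ℤ.* c ≡ e ℤ.* a ℤ.+ f ℤ.* c ℤ.+ (g ℤ.* a ℤ.+ h ℤ.* c)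
    eq = solve 6 (λ a c e f g h → (e :+ g) :* a :+ (f :+ h) :* c := e :* a :+ f :* c :+ (g :* a :+ h :* c)) refl

  det-combine : ∀ u v x y → det (combine u v x) (combine u v y) ≡ det x y ℤ.* det u v
  det-combine (a , b) (c , d) (e , f) (g , h) = solve 8 (λ a b c d e f g h →
    let combineᴾ = λ (x , y) → x :* a :+ y :* c , x :* b :+ y :* d in
    detᴾ (combineᴾ (e , f)) (combineᴾ (g , h)) := detᴾ (e , f) (g , h) :* detᴾ (a , b) (c , d)) refl a b c d e f g h

  det-basis : det (1ℤ , 0ℤ) (0ℤ , 1ℤ) ≡ 1ℤ
  det-basis = refl

  ⊖-involutive : ∀ x → ⊖ (⊖ x) ≡ x
  ⊖-involutive (a , b) = cong₂ _,_ (ℤₚ.neg-involutive a) (ℤₚ.neg-involutive b)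

det-injective : ∀ {u v x y} → det u v ≡ 1ℤ → det x v ≡ det y v → det u x ≡ det u y → x ≡ y
det-injective {u} {v} {x = x} {y} uv eq₁ eq₂ = trans (expand x uv) (trans (cong₂ (λ k l → k ⊛ u ⊕ l ⊛ v) eq₁ eq₂) (sym (expand y uv)))

-- Triangulations as chains of vectors

edges : Tree 2 → ℕ
edges leaf       = 1
edges (fork s t) = edges s + edges t

edges≡1+size : ∀ t → edges t ≡ suc (size t)
edges≡1+size leaf = refl
edges≡1+size (fork s t) rewrite edges≡1+size s | edges≡1+size t =
  cong suc (trans (ℕₚ.+-suc (size s) (size t)) (cong (λ n → suc (size s + n)) (sym (ℕₚ.+-identityʳ (size t)))))

0<edges : ∀ t → 0 < edges t
0<edges t = subst (0 <_) (sym (edges≡1+size t)) (s≤s z≤n)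

-- f 0, …, f (edges t) are the vectors at the vertices of the triangulation t,
-- the vector at the apex of a triangle being the sum of those at its base.
Reps : Tree 2 → (ℕ → V) → Set
Reps leaf       f = ⊤
Reps (fork s t) f = f (edges s) ≡ f 0 ⊕ f (edges s + edges t) × Reps s f × Reps t (λ i → f (edges s + i))

vertex : Tree 2 → V → V → ℕ → V
vertex leaf       u v zero    = u
vertex leaf       u v (suc _) = v
vertex (fork s t) u v i with i ≤? edges s
... | yes _ = vertex s u (u ⊕ v) i
... | no  _ = vertex t (u ⊕ v) v (i ∸ edges s)

vertex-left : ∀ s t u v {i} → i ≤ edges s → vertex (fork s t) u v i ≡ vertex s u (u ⊕ v) i
vertex-left s t u v {i} i≤ with i ≤? edges s
... | yes _  = refl
... | no  i≰ = contradiction i≤ i≰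

vertex-0 : ∀ t u v → vertex t u v 0 ≡ u
vertex-0 leaf       u v = refl
vertex-0 (fork s t) u v = trans (vertex-left s t u v z≤n) (vertex-0 s u (u ⊕ v))

vertex-edges : ∀ t u v → vertex t u v (edges t) ≡ v
vertex-edges leaf       u v = refl
vertex-edges (fork s t) u v with edges s + edges t ≤? edges s
... | yes m+n≤m = contradiction m+n≤m (ℕₚ.<⇒≱ (ℕₚ.m<m+n (edges s) (0<edges t)))
... | no  _     = trans (cong (vertex t (u ⊕ v) v) (ℕₚ.m+n∸m≡n (edges s) (edges t))) (vertex-edges t (u ⊕ v) v)

vertex-right : ∀ s t u v i → vertex (fork s t) u v (edges s + i) ≡ vertex t (u ⊕ v) v i
vertex-right s t u v zero rewrite ℕₚ.+-identityʳ (edges s) =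
  trans (vertex-left s t u v ℕₚ.≤-refl) (trans (vertex-edges s u (u ⊕ v)) (sym (vertex-0 t (u ⊕ v) v)))
vertex-right s t u v (suc i) with edges s + suc i ≤? edges s
... | yes m+n≤m = contradiction m+n≤m (ℕₚ.<⇒≱ (ℕₚ.m<m+n (edges s) (s≤s z≤n)))
... | no  _     = cong (vertex t (u ⊕ v) v) (ℕₚ.m+n∸m≡n (edges s) (suc i))

Reps-cong : ∀ t {f g} → (∀ i → i ≤ edges t → f i ≡ g i) → Reps t f → Reps t g
Reps-cong leaf       f≗g _ = tt
Reps-cong (fork s t) f≗g (mid , rs , rt) =
  trans (sym (f≗g _ (ℕₚ.m≤m+n _ _))) (trans mid (cong₂ _⊕_ (f≗g 0 z≤n) (f≗g _ ℕₚ.≤-refl))) ,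
  Reps-cong s (λ i i≤ → f≗g i (ℕₚ.≤-trans i≤ (ℕₚ.m≤m+n _ _))) rs ,
  Reps-cong t (λ i i≤ → f≗g _ (ℕₚ.+-monoʳ-≤ (edges s) i≤)) rt

Reps-vertex : ∀ t u v → Reps t (vertex t u v)
Reps-vertex leaf       u v = tt
Reps-vertex (fork s t) u v =
  trans (vertex-left s t u v ℕₚ.≤-refl) (trans (vertex-edges s u (u ⊕ v))
    (sym (cong₂ _⊕_ (vertex-0 (fork s t) u v) (vertex-edges (fork s t) u v)))) ,
  Reps-cong s (λ i i≤ → sym (vertex-left s t u v i≤)) (Reps-vertex s u (u ⊕ v)) ,
  Reps-cong t (λ i _ → sym (vertex-right s t u v i)) (Reps-vertex t (u ⊕ v) v)

-- `n` counts the edges apart from the root edge, so the polygon has n + 1 vertices. Neighbouring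
-- vectors, and the first and last one, form oriented bases of ℤ²; positivity expresses that the
-- vectors are in order within a half-plane.
record Chain (n : ℕ) (f : ℕ → V) : Set where
  field
    unimodular : ∀ i → i < n → det (f i) (f (suc i)) ≡ 1ℤ
    positive   : ∀ i j → i < j → j ≤ n → 0ℤ ℤ.< det (f i) (f j)
    closed     : det (f 0) (f n) ≡ 1ℤ

  nonNegative : ∀ i j → i ≤ j → j ≤ n → 0ℤ ℤ.≤ det (f i) (f j)
  nonNegative i j i≤j j≤n with ℕₚ.m≤n⇒m<n∨m≡n i≤j
  ... | inj₁ i<j  = ℤₚ.<⇒≤ (positive i j i<j j≤n)
  ... | inj₂ refl = ℤₚ.≤-reflexive (sym (det-self (f i)))

0<1 : 0ℤ ℤ.< 1ℤ
0<1 = +<+ (s≤s z≤n)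

det-mid : ∀ {u v w} → w ≡ u ⊕ v → det u v ≡ 1ℤ → det u w ≡ 1ℤ × det w v ≡ 1ℤ
det-mid {u} {v} refl uv =
  trans (det-⊕ʳ u u v) (trans (cong₂ ℤ._+_ (det-self u) uv) refl) ,
  trans (det-⊕ˡ u v v) (trans (cong₂ ℤ._+_ uv (det-self v)) refl)

split-at : ∀ m i → m ≤ i → ∃ λ k → i ≡ m + k
split-at m i m≤i = i ∸ m , sym (ℕₚ.m+[n∸m]≡n m≤i)

0<* : ∀ {x y} → 0ℤ ℤ.< x → 0ℤ ℤ.< y → 0ℤ ℤ.< x ℤ.* y
0<* {+ suc _} {+ suc _} _ _ = +<+ (s≤s z≤n)
0<* {_} {+ 0} _ (+<+ ())
0<* {+ 0} {_} (+<+ ()) _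

0≤* : ∀ {x y} → 0ℤ ℤ.≤ x → 0ℤ ℤ.≤ y → 0ℤ ℤ.≤ x ℤ.* y
0≤* {+ m} {+ n} _ _ = subst (0ℤ ℤ.≤_) (ℤₚ.pos-* m n) (+≤+ z≤n)

-- If i and j lie on different sides of the apex m of the root triangle, Plücker's relations
-- express det (f i) (f j) by the determinants on each side, since f m is the sum of f 0 and the last vector.
Reps⇒Chain : ∀ t {f} → Reps t f → det (f 0) (f (edges t)) ≡ 1ℤ → Chain (edges t) f
Reps⇒Chain leaf {f} _ c = record
  { unimodular = λ { zero _ → c ; (suc _) (s≤s ()) }
  ; positive   = λ { zero (suc zero) _ _ → subst (0ℤ ℤ.<_) (sym c) 0<1 ; zero (suc (suc _)) _ (s≤s ()) ; (suc _) (suc _) (s≤s (s≤s _)) (s≤s ()) }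
  ; closed     = c }
Reps⇒Chain (fork s t) {f} (mid , rs , rt) c = record
  { unimodular = unimodular ; positive = positive ; closed = c }
  where
  m = edges s
  n = edges t
  f′ : ℕ → V
  f′ i = f (m + i)
  f′0 : f′ 0 ≡ f m
  f′0 = cong f (ℕₚ.+-identityʳ m)
  0m : det (f 0) (f m) ≡ 1ℤ
  0m = proj₁ (det-mid mid c)
  mn : det (f m) (f (m + n)) ≡ 1ℤ
  mn = proj₂ (det-mid mid c)
  module L = Chain (Reps⇒Chain s rs 0m)
  module R = Chain (Reps⇒Chain t rt (trans (cong (λ x → det x (f (m + n))) f′0) mn))
  unimodular : ∀ i → i < m + n → det (f i) (f (suc i)) ≡ 1ℤ
  unimodular i i<m+n with ℕₚ.<-≤-connex i m
  ... | inj₁ i<m = L.unimodular i i<m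
  ... | inj₂ m≤i with k , refl ← split-at m i m≤i =
    trans (cong (λ j → det (f (m + k)) (f j)) (sym (ℕₚ.+-suc m k))) (R.unimodular k (ℕₚ.+-cancelˡ-< m k n i<m+n))
  positive : ∀ i j → i < j → j ≤ m + n → 0ℤ ℤ.< det (f i) (f j)
  positive i j i<j j≤m+n with ℕₚ.≤-<-connex j m | ℕₚ.<-≤-connex i m
  ... | inj₁ j≤m | _ = L.positive i j i<j j≤m
  ... | inj₂ m<j | inj₂ m≤i with k , refl ← split-at m i m≤i | l , refl ← split-at m j (ℕₚ.<⇒≤ m<j) =
    R.positive k l (ℕₚ.+-cancelˡ-< m k l i<j) (ℕₚ.+-cancelˡ-≤ m l n j≤m+n)
  ... | inj₂ m<j | inj₁ i<m with l , refl ← split-at m j (ℕₚ.<⇒≤ m<j) = subst (0ℤ ℤ.<_) (sym ij)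
      (ℤₚ.+-mono-≤-< (0≤* (L.nonNegative 0 i z≤n (ℕₚ.<⇒≤ i<m)) (ℤₚ.<⇒≤ 0<mj)) (0<* 0<0j (L.positive i m i<m ℕₚ.≤-refl)))
    where
    l≤n = ℕₚ.+-cancelˡ-≤ m l n j≤m+n
    0<mj : 0ℤ ℤ.< det (f m) (f (m + l))
    0<mj = subst (λ x → 0ℤ ℤ.< det x (f (m + l))) f′0
      (R.positive 0 l (ℕₚ.+-cancelˡ-< m 0 l (subst (_< m + l) (sym (ℕₚ.+-identityʳ m)) m<j)) l≤n)
    0j : det (f 0) (f (m + l)) ≡ det (f (m + l)) (f (m + n)) ℤ.+ det (f m) (f (m + l))
    0j = begin
      det (f 0) (f (m + l))                             ≡⟨ ℤₚ.*-identityʳ _ ⟨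
      det (f 0) (f (m + l)) ℤ.* 1ℤ                      ≡⟨ cong (det (f 0) (f (m + l)) ℤ.*_) mn ⟨
      det (f 0) (f (m + l)) ℤ.* det (f m) (f (m + n))   ≡⟨ plücker (f 0) (f m) (f (m + l)) (f (m + n)) ⟩
      _ ≡⟨ cong₂ (λ x y → x ℤ.* det (f (m + l)) (f (m + n)) ℤ.+ y ℤ.* det (f m) (f (m + l))) 0m c ⟩
      _ ≡⟨ cong₂ ℤ._+_ (ℤₚ.*-identityˡ (det (f (m + l)) (f (m + n)))) (ℤₚ.*-identityˡ (det (f m) (f (m + l)))) ⟩
      det (f (m + l)) (f (m + n)) ℤ.+ det (f m) (f (m + l)) ∎
      where open ≡-Reasoning
    0<0j : 0ℤ ℤ.< det (f 0) (f (m + l))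
    0<0j = subst (0ℤ ℤ.<_) (sym 0j) (ℤₚ.+-mono-≤-< (R.nonNegative l n l≤n ℕₚ.≤-refl) 0<mj)
    ij : det (f i) (f (m + l)) ≡ det (f 0) (f i) ℤ.* det (f m) (f (m + l)) ℤ.+ det (f 0) (f (m + l)) ℤ.* det (f i) (f m)
    ij = begin
      det (f i) (f (m + l))                      ≡⟨ ℤₚ.*-identityˡ _ ⟨
      1ℤ ℤ.* det (f i) (f (m + l))               ≡⟨ cong (ℤ._* det (f i) (f (m + l))) 0m ⟨
      det (f 0) (f m) ℤ.* det (f i) (f (m + l))  ≡⟨ plücker (f 0) (f i) (f m) (f (m + l)) ⟩
      _                                          ∎
      where open ≡-Reasoning

Chain-prefix : ∀ {m n f} → m ≤ n → det (f 0) (f m) ≡ 1ℤ → Chain n f → Chain m f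
Chain-prefix m≤n c ch = record
  { unimodular = λ i i<m → unimodular i (ℕₚ.<-≤-trans i<m m≤n)
  ; positive   = λ i j i<j j≤m → positive i j i<j (ℕₚ.≤-trans j≤m m≤n)
  ; closed     = c }
  where open Chain ch

Chain-suffix : ∀ m {n f} → det (f m) (f (m + n)) ≡ 1ℤ → Chain (m + n) f → Chain n (λ i → f (m + i))
Chain-suffix m {n} {f} c ch = record
  { unimodular = λ i i<n → trans (cong (λ j → det (f (m + i)) (f j)) (ℕₚ.+-suc m i)) (unimodular (m + i) (ℕₚ.+-monoʳ-< m i<n))
  ; positive   = λ i j i<j j≤n → positive (m + i) (m + j) (ℕₚ.+-monoʳ-< m i<j) (ℕₚ.+-monoʳ-≤ m j≤n)
  ; closed     = trans (cong (λ i → det (f i) (f (m + n))) (ℕₚ.+-identityʳ m)) c }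
  where open Chain ch

-- In the basis `f 0`, `f n` the vector `f i` has the coordinates `A i` and `B i`. These are 1, 0 at
-- the start and 0, 1 at the end, and by `cross` neighbouring pairs have determinant 1. For n ≥ 2
-- this prevents `A` and `B` from changing order without being equal in between, and where they are
-- equal both are 1.
module FindApex {n f} (2≤n : 2 ≤ n) (ch : Chain n f) where
  open Chain ch
  private
    A B : ℕ → ℕ
    A i = ∣ det (f i) (f n) ∣
    B i = ∣ det (f 0) (f i) ∣

    A≡ : ∀ {i} → i ≤ n → det (f i) (f n) ≡ + A i
    A≡ i≤n = sym (ℤₚ.0≤i⇒+∣i∣≡i (nonNegative _ _ i≤n ℕₚ.≤-refl))

    B≡ : ∀ {i} → i ≤ n → det (f 0) (f i) ≡ + B i
    B≡ i≤n = sym (ℤₚ.0≤i⇒+∣i∣≡i (nonNegative _ _ z≤n i≤n))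

    An : A n ≡ 0
    An = cong ∣_∣ (det-self (f n))

    cross : ∀ {i} → i < n → B (suc i) * A i ≡ B i * A (suc i) + 1
    cross {i} i<n = ℤₚ.+-injective (begin
      + (B (suc i) * A i)                ≡⟨ ℤₚ.pos-* (B (suc i)) (A i) ⟩
      + B (suc i) ℤ.* + A i              ≡⟨ cong₂ ℤ._*_ (B≡ i<n) (A≡ (ℕₚ.<⇒≤ i<n)) ⟨
      det (f 0) (f (suc i)) ℤ.* det (f i) (f n) ≡⟨ plücker (f 0) (f i) (f (suc i)) (f n) ⟩
      det (f 0) (f i) ℤ.* det (f (suc i)) (f n) ℤ.+ det (f 0) (f n) ℤ.* det (f i) (f (suc i))
        ≡⟨ cong₂ ℤ._+_ (cong₂ ℤ._*_ (B≡ (ℕₚ.<⇒≤ i<n)) (A≡ i<n)) (cong₂ ℤ._*_ closed (unimodular i i<n)) ⟩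
      + B i ℤ.* + A (suc i) ℤ.+ 1ℤ       ≡⟨ cong (ℤ._+ 1ℤ) (ℤₚ.pos-* (B i) (A (suc i))) ⟨
      + (B i * A (suc i) + 1) ∎)
      where open ≡-Reasoning

    Apex : Set
    Apex = ∃ λ m → 0 < m × m < n × f m ≡ f 0 ⊕ f n

    apex : ∀ i → i < n → A (suc i) ≡ B (suc i) → Apex
    apex i i<n A≡B = suc i , s≤s z≤n , ℕₚ.≤∧≢⇒< i<n (λ i+1≡n → ℕₚ.0≢1+n (trans (sym An) (trans (cong A (sym i+1≡n)) (trans A≡B b≡1)))) ,
      det-injective closed
        (trans (A≡ i<n) (trans (cong +_ (trans A≡B b≡1)) (sym (proj₂ (det-mid refl closed)))))
        (trans (B≡ i<n) (trans (cong +_ b≡1) (sym (proj₁ (det-mid refl closed)))))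
      where
      b≡1 : B (suc i) ≡ 1
      -- With `A≡B` the relation `cross` exhibits 1 as a difference of two multiples of the common
      -- value.
      b≡1 = ∣1⇒≡1 (∣m+n∣m⇒∣n (divides (A i) (trans (sym (cross i<n)) (ℕₚ.*-comm (B (suc i)) (A i))))
        (divides (B i) (cong (B i *_) A≡B)))

    -- If B i < A i and A (i+1) < B (i+1) then `cross` forces B i = 0 = A (i+1).
    no-crossing : ∀ i → i < n → B i < A i → A (suc i) < B (suc i) → ⊥
    no-crossing i i<n b<a a′<b′ = ℕₚ.<-irrefl (trans (sym i≡0) i+1≡n) 2≤n
      where
      B+A≡0 : B i + A (suc i) ≡ 0
      B+A≡0 = ℕₚ.n≤0⇒n≡0 (ℕₚ.+-cancelˡ-≤ (B i * A (suc i) + 1) _ _ (begin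
        B i * A (suc i) + 1 + (B i + A (suc i))  ≡⟨ eq (B i) (A (suc i)) ⟩
        suc (A (suc i)) * suc (B i)              ≤⟨ ℕₚ.*-mono-≤ a′<b′ b<a ⟩
        B (suc i) * A i                          ≡⟨ cross i<n ⟩
        B i * A (suc i) + 1                      ≡⟨ ℕₚ.+-identityʳ _ ⟨
        B i * A (suc i) + 1 + 0                  ∎))
        where
        open ℕₚ.≤-Reasoning
        eq : ∀ b a → b * a + 1 + (b + a) ≡ suc a * suc b
        eq = ℕ-Ring.solve-∀
      i≡0 : suc i ≡ 1
      i≡0 with ℕₚ.m≤n⇒m<n∨m≡n (z≤n {i})
      ... | inj₂ refl = refl
      ... | inj₁ 0<i  = contradiction (subst (0ℤ ℤ.<_) (trans (B≡ (ℕₚ.<⇒≤ i<n)) (cong +_ (ℕₚ.m+n≡0⇒m≡0 (B i) B+A≡0))) (positive 0 i 0<i (ℕₚ.<⇒≤ i<n))) (ℤₚ.<-irrefl refl)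
      i+1≡n : suc i ≡ n
      i+1≡n with ℕₚ.m≤n⇒m<n∨m≡n i<n
      ... | inj₂ i+1≡n = i+1≡n
      ... | inj₁ i+1<n = contradiction (subst (0ℤ ℤ.<_) (trans (A≡ i<n) (cong +_ (ℕₚ.m+n≡0⇒n≡0 (B i) B+A≡0))) (positive (suc i) n i+1<n ℕₚ.≤-refl)) (ℤₚ.<-irrefl refl)

    search : ∀ d i → suc d + i ≡ n → B i < A i → Apex
    search d i eq b<a with ℕₚ.<-cmp (B (suc i)) (A (suc i))
    ... | tri≈ _ b≡a _ = apex i (subst (suc i ≤_) eq (s≤s (ℕₚ.m≤n+m i d))) (sym b≡a)
    ... | tri> _ _ a<b = ⊥-elim (no-crossing i (subst (suc i ≤_) eq (s≤s (ℕₚ.m≤n+m i d))) b<a a<b)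
    search zero    i refl b<a | tri< b′<a′ _ _ = contradiction (subst (B (suc i) <_) An b′<a′) λ ()
    search (suc d) i eq   b<a | tri< b′<a′ _ _ = search d (suc i) (trans (cong suc (ℕₚ.+-suc d i)) eq) b′<a′

  chain-apex : ∃ λ m → 0 < m × m < n × f m ≡ f 0 ⊕ f n
  chain-apex = search (n ∸ 1) 0 (trans (ℕₚ.+-identityʳ _) (ℕₚ.m+[n∸m]≡n (ℕₚ.≤-trans (s≤s z≤n) 2≤n)))
    (subst₂ _<_ (sym (cong ∣_∣ (det-self (f 0)))) (sym (cong ∣_∣ closed)) (s≤s z≤n))

open FindApex using (chain-apex)

-- The apex has determinant 1 with both ends, so cutting there leaves two shorter chains; `k` in
-- `go` bounds their length for the recursion.
Chain⇒Reps : ∀ {n f} → 0 < n → Chain n f → ∃ λ t → edges t ≡ n × Reps t f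
Chain⇒Reps {n} 0<n ch = go n 0<n ℕₚ.≤-refl ch
  where
  go : ∀ k {n f} → 0 < n → n ≤ k → Chain n f → ∃ λ t → edges t ≡ n × Reps t f
  go zero    0<n n≤0 ch = contradiction n≤0 (ℕₚ.<⇒≱ 0<n)
  go (suc k) {n} 0<n n≤1+k ch with ℕₚ.m≤n⇒m<n∨m≡n 0<n
  ... | inj₂ refl = leaf , refl , tt
  ... | inj₁ 2≤n with m , 0<m , m<n , mid ← chain-apex 2≤n ch
    with l , refl ← split-at m n (ℕₚ.<⇒≤ m<n)
    with um , mv ← det-mid mid (Chain.closed ch)
    with s , refl , rs ← go k 0<m (ℕₚ.≤-pred (ℕₚ.≤-trans m<n n≤1+k)) (Chain-prefix (ℕₚ.<⇒≤ m<n) um ch)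
    with t , refl , rt ← go k (ℕₚ.+-cancelˡ-< m 0 l (subst (_< m + l) (sym (ℕₚ.+-identityʳ m)) m<n))
                           (ℕₚ.≤-pred (ℕₚ.≤-trans (ℕₚ.m<n+m l 0<m) n≤1+k)) (Chain-suffix m mv ch)
    = fork s t , refl , mid , rs , rt

-- Both apexes are the sum of the two end vectors, whereas vectors at different places of a chain
-- have a nonzero determinant; so the root triangles agree.
Reps-unique : ∀ s t {f} → Reps s f → Reps t f → edges s ≡ edges t → Chain (edges s) f → s ≡ t
Reps-unique leaf       leaf       _ _ _  _ = refl
Reps-unique leaf       (fork s t) _ _ eq _ = contradiction eq (ℕₚ.<⇒≢ (ℕₚ.+-mono-≤ (0<edges s) (0<edges t)))
Reps-unique (fork s t) leaf       _ _ eq _ = contradiction (sym eq) (ℕₚ.<⇒≢ (ℕₚ.+-mono-≤ (0<edges s) (0<edges t)))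
Reps-unique (fork s t) (fork s′ t′) {f} (mid , rs , rt) (mid′ , rs′ , rt′) eq ch with ℕₚ.<-cmp (edges s) (edges s′)
... | tri< m<m′ _ _ = contradiction
  (subst (λ x → 0ℤ ℤ.< det (f (edges s)) x) (trans mid′ (trans (cong (λ i → f 0 ⊕ f i) (sym eq)) (sym mid)))
    (Chain.positive ch _ _ m<m′ (subst (edges s′ ≤_) (sym eq) (ℕₚ.m≤m+n _ _))))
  (ℤₚ.<-irrefl (sym (det-self (f (edges s)))))
... | tri> _ _ m′<m = contradiction
  (subst (λ x → 0ℤ ℤ.< det (f (edges s′)) x) (trans mid (trans (cong (λ i → f 0 ⊕ f i) eq) (sym mid′)))
    (Chain.positive ch _ _ m′<m (ℕₚ.m≤m+n _ _)))
  (ℤₚ.<-irrefl (sym (det-self (f (edges s′)))))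
... | tri≈ _ m≡m′ _ with um , mv ← det-mid mid (Chain.closed ch) = cong₂ (λ s t → fork s t)
  (Reps-unique s s′ rs rs′ m≡m′ (Chain-prefix (ℕₚ.m≤m+n _ _) um ch))
  (Reps-unique t t′ rt (subst (λ m → Reps t′ (λ i → f (m + i))) (sym m≡m′) rt′)
    (ℕₚ.+-cancelˡ-≡ (edges s) _ _ (trans eq (cong (_+ edges t′) (sym m≡m′)))) (Chain-suffix (edges s) mv ch))

-- Labels of a triangulation as determinants

private
  +-neg-cancel : ∀ {x y z} → x ≡ ℤ.- y ℤ.+ z → z ≡ y ℤ.+ x
  +-neg-cancel {x} {y} {z} refl = eq y z
    where
    eq : ∀ y z → z ≡ y ℤ.+ (ℤ.- y ℤ.+ z)
    eq = ℤ-Ring.solve-∀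

Reps-first : ∀ t {f} → Reps t f → det (f 0) (f (edges t)) ≡ 1ℤ → det (f 1) (f (edges t)) ≡ + first t
Reps-first leaf       {f} _ c = det-self (f 1)
Reps-first (fork s t) {f} r@(mid , rs , rt) c = begin
  det (f 1) (f n)                        ≡⟨ +-neg-cancel {y = det (f 0) (f 1)} (trans (cong (det (f 1)) mid)
                                              (trans (det-⊕ʳ (f 1) (f 0) (f n)) (cong (ℤ._+ det (f 1) (f n)) (det-swap (f 0) (f 1))))) ⟩
  det (f 0) (f 1) ℤ.+ det (f 1) (f (edges s))
    ≡⟨ cong₂ ℤ._+_ (Chain.unimodular (Reps⇒Chain (fork s t) r c) 0 (0<edges (fork s t))) (Reps-first s rs (proj₁ (det-mid mid c))) ⟩
  + suc (first s)                        ∎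
  where
  open ≡-Reasoning
  n = edges s + edges t

Reps-last : ∀ t {f} → Reps t f → det (f 0) (f (edges t)) ≡ 1ℤ → ∀ k → suc k ≡ edges t → det (f 0) (f k) ≡ + last t
Reps-last leaf       {f} _ c zero refl = det-self (f 0)
Reps-last (fork s t) {f} r@(mid , rs , rt) c k eq
  with l , refl ← split-at (edges s) k (ℕₚ.≤-pred (subst (edges s <_) (sym eq) (ℕₚ.m<m+n (edges s) (0<edges t)))) = begin
  det (f 0) (f k′)                       ≡⟨ +-neg-cancel {y = det (f k′) (f n)} (trans (cong (λ x → det x (f k′)) mid)
                                              (trans (det-⊕ˡ (f 0) (f n) (f k′)) (trans (ℤₚ.+-comm _ (det (f n) (f k′)))
                                                (cong (ℤ._+ det (f 0) (f k′)) (det-swap (f k′) (f n)))))) ⟩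
  det (f k′) (f n) ℤ.+ det (f (edges s)) (f k′)
    ≡⟨ cong₂ ℤ._+_ (trans (cong (λ i → det (f k′) (f i)) (sym eq)) (Chain.unimodular (Reps⇒Chain (fork s t) r c) k′ (ℕₚ.≤-reflexive eq)))
         (trans (cong (λ i → det (f i) (f k′)) (sym (ℕₚ.+-identityʳ (edges s))))
           (Reps-last t rt (trans (cong (λ i → det (f i) (f n)) (ℕₚ.+-identityʳ (edges s))) (proj₂ (det-mid mid c))) l
             (ℕₚ.+-cancelˡ-≡ (edges s) _ _ (trans (ℕₚ.+-suc (edges s) l) eq)))) ⟩
  + suc (last t)                         ∎
  where
  open ≡-Reasoning
  k′ = edges s + l
  n = edges s + edges t

-- This belongs to the vertex k + 1: the index is shifted so that the vertices off the root edge are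
-- counted from 0. Within a chain the determinant is positive and the absolute value only changes
-- its type.
label : (ℕ → V) → ℕ → ℕ
label f k = ∣ det (f k) (f (suc (suc k))) ∣

-- In the basis `u`, `v` of the root edge the two neighbours of the apex have the coordinates (l +
-- 1, l) and (r, r + 1), and their determinant is (l + 1)(r + 1) - lr.
Reps-label : ∀ s t {f} → Reps (fork s t) f → det (f 0) (f (edges s + edges t)) ≡ 1ℤ →
             ∀ k → suc k ≡ edges s → label f k ≡ suc (last s + first t)
Reps-label s t {f} (mid , rs , rt) c k eq = ℤₚ.+-injective {∣ det p q ∣} (trans (ℤₚ.0≤i⇒+∣i∣≡i (subst (0ℤ ℤ.≤_) (sym pq) (+≤+ z≤n))) pq)
  where
  open ≡-Reasoning
  n = edges s + edges t
  u = f 0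
  v = f n
  w = f (edges s)
  p = f k
  q = f (suc (suc k))
  l = + last s
  r = + first t
  1+m≤n : suc (edges s) ≤ n
  1+m≤n = ℕₚ.m<m+n (edges s) (0<edges t)
  open Chain (Reps⇒Chain (fork s t) {f} (mid , rs , rt) c) using (unimodular)
  q≡ : q ≡ f (edges s + 1)
  q≡ = cong f (trans (cong suc eq) (ℕₚ.+-comm 1 (edges s)))
  up : det u p ≡ l
  up = Reps-last s rs (proj₁ (det-mid mid c)) k eq
  qv : det q v ≡ r
  qv = trans (cong (λ x → det x v) q≡)
    (Reps-first t rt (trans (cong (λ i → det (f i) v) (ℕₚ.+-identityʳ (edges s))) (proj₂ (det-mid mid c))))
  pw : det p w ≡ 1ℤ
  pw = trans (cong (λ i → det p (f i)) (sym eq)) (unimodular k (ℕₚ.<-trans (ℕₚ.≤-reflexive eq) 1+m≤n))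
  wq : det w q ≡ 1ℤ
  wq = trans (cong (λ i → det w (f (suc i))) eq) (unimodular (edges s) 1+m≤n)
  pv : det p v ≡ l ℤ.+ 1ℤ
  pv = trans (+-neg-cancel {y = det u p} (trans (cong (det p) mid) (trans (det-⊕ʳ p u v) (cong (ℤ._+ det p v) (det-swap u p)))))
    (cong₂ ℤ._+_ up pw)
  uq : det u q ≡ r ℤ.+ 1ℤ
  uq = trans (+-neg-cancel {y = det q v} (trans (cong (λ x → det x q) mid) (trans (det-⊕ˡ u v q) (trans (ℤₚ.+-comm (det u q) _)
      (cong (ℤ._+ det u q) (det-swap q v))))))
    (cong₂ ℤ._+_ qv wq)
  pq : det p q ≡ + suc (last s + first t)
  pq = begin
    det p q                                            ≡⟨ ℤₚ.*-identityʳ _ ⟨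
    det p q ℤ.* 1ℤ                                     ≡⟨ cong (det p q ℤ.*_) c ⟨
    det p q ℤ.* det u v                                ≡⟨ plücker p u q v ⟩
    det p u ℤ.* det q v ℤ.+ det p v ℤ.* det u q        ≡⟨ cong₂ ℤ._+_ (cong₂ ℤ._*_ (trans (det-swap u p) (cong ℤ.-_ up)) qv) (cong₂ ℤ._*_ pv uq) ⟩
    (ℤ.- l) ℤ.* r ℤ.+ (l ℤ.+ 1ℤ) ℤ.* (r ℤ.+ 1ℤ)        ≡⟨ eq′ l r ⟩
    1ℤ ℤ.+ (l ℤ.+ r)                                   ∎
    where
    eq′ : ∀ l r → (ℤ.- l) ℤ.* r ℤ.+ (l ℤ.+ 1ℤ) ℤ.* (r ℤ.+ 1ℤ) ≡ 1ℤ ℤ.+ (l ℤ.+ r)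
    eq′ = ℤ-Ring.solve-∀

colour : Bool → ℕ → Bool
colour c zero    = c
colour c (suc i) = colour (not c) i

colour-+ : ∀ c m n → colour (colour c m) n ≡ colour c (m + n)
colour-+ c zero    n = refl
colour-+ c (suc m) n = colour-+ (not c) m n

colour-edges : ∀ c t → colour c (edges t) ≡ end c t
colour-edges c leaf       = refl
colour-edges c (fork s t) = trans (sym (colour-+ c (edges s) (edges t)))
  (trans (cong (λ b → colour b (edges t)) (colour-edges c s)) (colour-edges (end c s) t))

LabelDiv : ℕ → Bool → ℕ → (ℕ → V) → Set
LabelDiv d c n f = ∀ k → suc k < n → T (colour c (suc k)) → d ∣ label f k

private
  suffix-label : ∀ m f k → label (λ i → f (m + i)) k ≡ label f (m + k)
  suffix-label m f k = cong (λ i → ∣ det (f (m + k)) (f i) ∣) (trans (ℕₚ.+-suc m (suc k)) (cong suc (ℕₚ.+-suc m k)))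

-- Every vertex off the root edge is the apex of exactly one subtree, and there `Reps-label`
-- identifies the two notions of label.
LabelDiv⇒Div : ∀ {d} c t {f} → Reps t f → det (f 0) (f (edges t)) ≡ 1ℤ → LabelDiv d c (edges t) f → Div d c t
LabelDiv⇒Div c leaf       _ _ _ = tt
LabelDiv⇒Div {d} c (fork s t) {f} r@(mid , rs , rt) uv ld =
  LabelDiv⇒Div c s rs (proj₁ (det-mid mid uv)) (λ k k<m → ld k (ℕₚ.<-≤-trans k<m (ℕₚ.m≤m+n _ _))) ,
  middle (edges s) refl ,
  LabelDiv⇒Div (end c s) t rt (trans (cong (λ i → det (f i) (f (edges s + edges t))) (ℕₚ.+-identityʳ (edges s))) (proj₂ (det-mid mid uv)))
    λ k k<n T′ → subst (d ∣_) (sym (suffix-label (edges s) f k)) (ld (edges s + k)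
      (subst (_< edges s + edges t) (ℕₚ.+-suc (edges s) k) (ℕₚ.+-monoʳ-< (edges s) k<n))
      (subst T (trans (cong (λ b → colour b (suc k)) (sym (colour-edges c s)))
        (trans (colour-+ c (edges s) (suc k)) (cong (colour c) (ℕₚ.+-suc (edges s) k)))) T′))
  where
  middle : ∀ m → m ≡ edges s → T (end c s) → d ∣ suc (last s + first t)
  middle zero    eq = contradiction eq (ℕₚ.<⇒≢ (0<edges s))
  middle (suc k) eq T′ = subst (d ∣_) (Reps-label s t r uv k eq)
    (ld k (subst (_< edges s + edges t) (sym eq) (ℕₚ.m<m+n (edges s) (0<edges t)))
      (subst T (trans (sym (colour-edges c s)) (cong (colour c) (sym eq))) T′))

Div⇒LabelDiv : ∀ {d} c t {f} → Reps t f → det (f 0) (f (edges t)) ≡ 1ℤ → Div d c t → LabelDiv d c (edges t) f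
Div⇒LabelDiv c leaf _ _ _ k (s≤s ())
Div⇒LabelDiv {d} c (fork s t) {f} r@(mid , rs , rt) uv (ds , dm , dt) k k<n T′ with ℕₚ.<-cmp (suc k) (edges s)
... | tri< k<m _ _ = Div⇒LabelDiv c s rs (proj₁ (det-mid mid uv)) ds k k<m T′
... | tri≈ _ k≡m _ = subst (d ∣_) (sym (Reps-label s t r uv k k≡m))
  (dm (subst T (trans (cong (colour c) k≡m) (colour-edges c s)) T′))
... | tri> _ _ m<k with l , refl ← split-at (edges s) k (ℕₚ.≤-pred m<k) = subst (d ∣_) (suffix-label (edges s) f l)
  (Div⇒LabelDiv (end c s) t rt (trans (cong (λ i → det (f i) (f (edges s + edges t))) (ℕₚ.+-identityʳ (edges s))) (proj₂ (det-mid mid uv))) dt l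
    (ℕₚ.+-cancelˡ-< (edges s) (suc l) (edges t) (subst (_< edges s + edges t) (sym (ℕₚ.+-suc (edges s) l)) k<n))
    (subst T (sym (trans (cong (λ b → colour b (suc l)) (sym (colour-edges c s)))
        (trans (colour-+ c (edges s) (suc l)) (cong (colour c) (ℕₚ.+-suc (edges s) l))))) T′))

-- Integers in ℚ

ℚ-ring : AlmostCommutativeRing 0ℓ 0ℓ
ℚ-ring = fromCommutativeRing ℚₚ.+-*-commutativeRing (λ x → dec⇒maybe (0ℚ ℚₚ.≟ x))

opaque
  ι : ℤ → ℚ
  ι z = ℚ.fromℚᵘ (mkℚᵘ z 0)

  private
    toℚᵘ-ι : ∀ z → toℚᵘ (ι z) ℚᵘ.≃ mkℚᵘ z 0
    toℚᵘ-ι z = ℚₚ.toℚᵘ-fromℚᵘ (mkℚᵘ z 0)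

  ι-+ : ∀ x y → ι (x ℤ.+ y) ≡ ι x ℚ.+ ι y
  ι-+ x y = ℚₚ.toℚᵘ-injective (ℚᵘₚ.≃-trans (toℚᵘ-ι (x ℤ.+ y)) (ℚᵘₚ.≃-trans
    (*≡* (cong (ℤ._* 1ℤ) (sym (cong₂ ℤ._+_ (ℤₚ.*-identityʳ x) (ℤₚ.*-identityʳ y)))))
    (ℚᵘₚ.≃-sym (ℚᵘₚ.≃-trans (ℚₚ.toℚᵘ-homo-+ (ι x) (ι y)) (ℚᵘₚ.+-cong (toℚᵘ-ι x) (toℚᵘ-ι y))))))

  ι-* : ∀ x y → ι (x ℤ.* y) ≡ ι x ℚ.* ι y
  ι-* x y = ℚₚ.toℚᵘ-injective (ℚᵘₚ.≃-trans (toℚᵘ-ι (x ℤ.* y))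
    (ℚᵘₚ.≃-sym (ℚᵘₚ.≃-trans (ℚₚ.toℚᵘ-homo-* (ι x) (ι y)) (ℚᵘₚ.*-cong (toℚᵘ-ι x) (toℚᵘ-ι y)))))

  ι-0 : ι 0ℤ ≡ 0ℚ
  ι-0 = refl

  ι-1 : ι 1ℤ ≡ 1ℚ
  ι-1 = refl

  ι-injective : ∀ {x y} → ι x ≡ ι y → x ≡ y
  ι-injective {x} {y} eq with *≡* eq′ ← ℚₚ.fromℚᵘ-injective {mkℚᵘ x 0} {mkℚᵘ y 0} eq =
    trans (sym (ℤₚ.*-identityʳ x)) (trans eq′ (ℤₚ.*-identityʳ y))

  ι-pos : ∀ {x} → 0ℤ ℤ.< x → 0ℚ ℚ.< ι x
  ι-pos {x} 0<x = ℚₚ.toℚᵘ-cancel-< (ℚᵘₚ.<-respʳ-≃ (ℚᵘₚ.≃-sym (toℚᵘ-ι x)) (*<* (subst (0ℤ ℤ.<_) (sym (ℤₚ.*-identityʳ x)) 0<x)))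

  ι-pos⁻¹ : ∀ {x} → 0ℚ ℚ.< ι x → 0ℤ ℤ.< x
  ι-pos⁻¹ {x} 0<x with *<* lt ← ℚᵘₚ.<-respʳ-≃ (toℚᵘ-ι x) (ℚₚ.toℚᵘ-mono-< 0<x) = subst (0ℤ ℤ.<_) (ℤₚ.*-identityʳ x) lt

ι-neg : ∀ x → ι (ℤ.- x) ≡ ℚ.- ι x
ι-neg x = trans (sym (eq (ι x) (ι (ℤ.- x)))) (trans (cong (ℚ.- ι x ℚ.+_) (trans (sym (ι-+ x (ℤ.- x)))
  (trans (cong ι (ℤₚ.+-inverseʳ x)) ι-0))) (ℚₚ.+-identityʳ _))
  where
  eq : ∀ p q → ℚ.- p ℚ.+ (p ℚ.+ q) ≡ q
  eq = RingSolver.solve-∀ ℚ-ring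

ι-- : ∀ x y → ι (x ℤ.- y) ≡ ι x ℚ.- ι y
ι-- x y = trans (ι-+ x (ℤ.- y)) (cong (ι x ℚ.+_) (ι-neg y))

*-pos : ∀ {p q} → 0ℚ ℚ.< p → 0ℚ ℚ.< q → 0ℚ ℚ.< p ℚ.* q
*-pos {p} {q} 0<p 0<q = ℚₚ.positive⁻¹ _ {{ℚₚ.pos*pos⇒pos p {{ℚ.positive 0<p}} q {{ℚ.positive 0<q}}}}

*-pos⁻¹ : ∀ {p q} → 0ℚ ℚ.< q → 0ℚ ℚ.< p ℚ.* q → 0ℚ ℚ.< p
*-pos⁻¹ {p} {q} 0<q 0<pq = ℚₚ.*-cancelʳ-<-nonNeg q {{ℚₚ.pos⇒nonNeg q {{ℚ.positive 0<q}}}} (subst (ℚ._< p ℚ.* q) (sym (ℚₚ.*-zeroˡ q)) 0<pq)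

*-cancelʳ : ∀ {p q r} → 0ℚ ℚ.< r → p ℚ.* r ≡ q ℚ.* r → p ≡ q
*-cancelʳ {p} {q} {r} 0<r eq = ℚₚ.≤-antisym
  (ℚₚ.*-cancelʳ-≤-pos r {{ℚ.positive 0<r}} (ℚₚ.≤-reflexive eq))
  (ℚₚ.*-cancelʳ-≤-pos r {{ℚ.positive 0<r}} (ℚₚ.≤-reflexive (sym eq)))

opaque
  reciprocal : ∀ p → 0ℚ ℚ.< p → ∃ λ q → 0ℚ ℚ.< q × p ℚ.* q ≡ 1ℚ
  reciprocal p 0<p = (ℚ.1/ p) {{nz}} , ℚₚ.positive⁻¹ _ {{ℚₚ.1/pos⇒pos p {{ℚ.positive 0<p}}}} , ℚₚ.*-inverseʳ p {{nz}}
    where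
    nz : ℚ.NonZero p
    nz = ℚ.>-nonZero 0<p

IsInt : ℚ → Set
IsInt p = ∃ λ z → p ≡ ι z

Int-ι : ∀ z → IsInt (ι z)
Int-ι z = z , refl

Int-0 : IsInt 0ℚ
Int-0 = 0ℤ , sym ι-0

Int-1 : IsInt 1ℚ
Int-1 = 1ℤ , sym ι-1

Int-+ : ∀ {p q} → IsInt p → IsInt q → IsInt (p ℚ.+ q)
Int-+ (x , refl) (y , refl) = x ℤ.+ y , sym (ι-+ x y)

Int-* : ∀ {p q} → IsInt p → IsInt q → IsInt (p ℚ.* q)
Int-* (x , refl) (y , refl) = x ℤ.* y , sym (ι-* x y)

Int-neg : ∀ {p} → IsInt p → IsInt (ℚ.- p)
Int-neg (x , refl) = ℤ.- x , sym (ι-neg x)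

Int-- : ∀ {p q} → IsInt p → IsInt q → IsInt (p ℚ.- q)
Int-- p q = Int-+ p (Int-neg q)

Int⇒ℕ : ∀ {p} → 0ℚ ℚ.< p → IsInt p → ∃ λ n → p ≡ ι (+ suc n)
Int⇒ℕ 0<p (z , refl) with z | ι-pos⁻¹ 0<p
... | + suc n | _ = n , refl
... | + 0     | +<+ ()

private
  bézout-Int : ∀ {q d} x m y n → IsInt (ι (+ m) ℚ.* q) → IsInt (ι (+ n) ℚ.* q) → d + y * n ≡ x * m → IsInt (ι (+ d) ℚ.* q)
  bézout-Int {q} {d} x m y n im in′ eq = subst IsInt (sym (trans (cong (ℚ._* q)
      (trans (add (ι (+ d)) (ι (+ y) ℚ.* ι (+ n))) (cong (ℚ._- ι (+ y) ℚ.* ι (+ n)) eq′)))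
      (reassoc (ι (+ x)) (ι (+ m)) (ι (+ y)) (ι (+ n)) q)))
    (Int-- (Int-* (Int-ι (+ x)) im) (Int-* (Int-ι (+ y)) in′))
    where
    add : ∀ d z → d ≡ (d ℚ.+ z) ℚ.- z
    add = RingSolver.solve-∀ ℚ-ring
    reassoc : ∀ x m y n q → (x ℚ.* m ℚ.- y ℚ.* n) ℚ.* q ≡ x ℚ.* (m ℚ.* q) ℚ.- y ℚ.* (n ℚ.* q)
    reassoc = RingSolver.solve-∀ ℚ-ring
    eq′ : ι (+ d) ℚ.+ ι (+ y) ℚ.* ι (+ n) ≡ ι (+ x) ℚ.* ι (+ m)
    eq′ = trans (cong (ι (+ d) ℚ.+_) (trans (sym (ι-* (+ y) (+ n))) (cong ι (sym (ℤₚ.pos-* y n)))))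
      (trans (sym (ι-+ (+ d) (+ (y * n)))) (trans (cong ι (trans (cong +_ eq) (ℤₚ.pos-* x m))) (ι-* (+ x) (+ m))))

-- The integers k with k q ∈ ℤ form an ideal, and Bézout's identity exhibits the gcd as a member.
Int-gcd : ∀ {q} m n → IsInt (ι (+ m) ℚ.* q) → IsInt (ι (+ n) ℚ.* q) → IsInt (ι (+ gcd m n) ℚ.* q)
Int-gcd {q} m n im in′ with Bézout.identity (gcd-GCD m n)
... | Bézout.+- x y eq = bézout-Int x m y n im in′ eq
... | Bézout.-+ x y eq = bézout-Int y n x m in′ im eq

-- Continuants and the rows of a Y-frieze pattern

-- `h i k` stands for the entry b i (i + k - 1); `top` and `bottom` are the zeros on both sides of
-- the positive entries. Rows with i ≥ 0 are enough because a single row determines all others.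
record Rows (w : ℕ) : Set where
  field
    h       : ℕ → ℕ → ℤ
    top     : ∀ i → h i 0 ≡ 0ℤ
    bottom  : ∀ i → h i (suc w) ≡ 0ℤ
    inside  : ∀ i k → k < w → 0ℤ ℤ.< h i (suc k)
    diamond : ∀ i k → k < w → h i (suc k) ℤ.* h (suc i) (suc k) ≡ (1ℤ ℤ.+ h i (suc (suc k))) ℤ.* (1ℤ ℤ.+ h (suc i) k)

  0<1+h : ∀ i k → k ≤ suc w → 0ℤ ℤ.< 1ℤ ℤ.+ h i k
  0<1+h i zero    _ rewrite top i = +<+ (s≤s z≤n)
  0<1+h i (suc k) (s≤s k≤w) with ℕₚ.m≤n⇒m<n∨m≡n k≤w
  ... | inj₁ k<w  = ℤₚ.+-mono-< (+<+ (s≤s (z≤n {0}))) (inside i k k<w)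
  ... | inj₂ refl rewrite bottom i = +<+ (s≤s z≤n)

0<1ℚ : 0ℚ ℚ.< 1ℚ
0<1ℚ = ℚₚ.positive⁻¹ 1ℚ

module Continuant (a : ℕ → ℚ) where
  -- D i k is the continuant of a i, …, a (i+k-2)
  D : ℕ → ℕ → ℚ
  D i zero          = 0ℚ
  D i (suc zero)    = 1ℚ
  D i (suc (suc k)) = a (i + k) ℚ.* D i (suc k) ℚ.- D i k

  D-2 : ∀ i → D i 2 ≡ a i
  D-2 i = trans (eq (a (i + 0))) (cong a (ℕₚ.+-identityʳ i))
    where
    eq : ∀ x → x ℚ.* 1ℚ ℚ.- 0ℚ ≡ x
    eq = RingSolver.solve-∀ ℚ-ring

  -- A continuant is a tridiagonal determinant: this is the expansion along its first row, the
  -- definition being the one along its last.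
  D-left : ∀ i k → D i (suc (suc k)) ≡ a i ℚ.* D (suc i) (suc k) ℚ.- D (suc (suc i)) k
  D-left i zero       = cong (λ x → x ℚ.* 1ℚ ℚ.- 0ℚ) (cong a (ℕₚ.+-identityʳ i))
  D-left i (suc zero) rewrite ℕₚ.+-identityʳ i | ℕₚ.+-comm i 1 = eq (a i) (a (suc i))
    where
    eq : ∀ x y → y ℚ.* (x ℚ.* 1ℚ ℚ.- 0ℚ) ℚ.- 1ℚ ≡ x ℚ.* (y ℚ.* 1ℚ ℚ.- 0ℚ) ℚ.- 1ℚ
    eq = RingSolver.solve-∀ ℚ-ring
  D-left i (suc (suc k)) rewrite D-left i (suc k) | D-left i k | ℕₚ.+-suc i (suc k) | ℕₚ.+-suc i k =
    eq (a i) (a (suc (suc (i + k)))) (D (suc i) (suc (suc k))) (D (suc (suc i)) (suc k)) (D (suc i) (suc k)) (D (suc (suc i)) k)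
    where
    eq : ∀ x y p q r s → y ℚ.* (x ℚ.* p ℚ.- q) ℚ.- (x ℚ.* r ℚ.- s) ≡ x ℚ.* (y ℚ.* p ℚ.- r) ℚ.- (y ℚ.* q ℚ.- s)
    eq = RingSolver.solve-∀ ℚ-ring

  -- For vectors with v (i+2) = a i · v (i+1) - v i and det (v i) (v (i+1)) = 1 one has D i k = det
  -- (v i) (v (i+k)); this is Plücker's relation for the indices i, i+1, i+k+1, i+k+2.
  euler : ∀ i k → D i (suc k) ℚ.* D (suc i) (suc k) ≡ 1ℚ ℚ.+ D i (suc (suc k)) ℚ.* D (suc i) k
  euler i zero    = eq (D i 2)
    where
    eq : ∀ x → 1ℚ ℚ.* 1ℚ ≡ 1ℚ ℚ.+ x ℚ.* 0ℚ
    eq = RingSolver.solve-∀ ℚ-ring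
  euler i (suc k) rewrite ℕₚ.+-suc i k =
    trans (left x (D i (suc (suc k))) (D (suc i) (suc k)) (D (suc i) k))
      (trans (cong (λ e → 1ℚ ℚ.+ (x ℚ.* D i (suc (suc k)) ℚ.* D (suc i) (suc k) ℚ.- e)) (sym (euler i k)))
        (right x (D i (suc (suc k))) (D (suc i) (suc k)) (D i (suc k))))
    where
    x = a (suc (i + k))
    left : ∀ x p q r → p ℚ.* (x ℚ.* q ℚ.- r) ≡ 1ℚ ℚ.+ (x ℚ.* p ℚ.* q ℚ.- (1ℚ ℚ.+ p ℚ.* r))
    left = RingSolver.solve-∀ ℚ-ring
    right : ∀ x p q s → 1ℚ ℚ.+ (x ℚ.* p ℚ.* q ℚ.- s ℚ.* q) ≡ 1ℚ ℚ.+ (x ℚ.* p ℚ.- s) ℚ.* q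
    right = RingSolver.solve-∀ ℚ-ring

-- The bound `M` allows two uses: rational labels satisfy the product rule at all indices, the
-- integral ones in a finite window.
module Quiddity {w} (R : Rows w) (a : ℕ → ℚ) (a-pos : ∀ i → 0ℚ ℚ.< a i) (M : ℕ)
                (a-prod : ∀ i → i < M → a i ℚ.* a (suc i) ≡ ι (1ℤ ℤ.+ Rows.h R i 1)) where
  open Rows R
  open Continuant a

  private
    ι-1+ : ∀ {z} p → ι (1ℤ ℤ.+ z) ≡ 1ℚ ℚ.+ p → ι z ≡ p
    ι-1+ {z} p eq = trans (cancel (ι z)) (trans (cong (ℚ._- 1ℚ) (trans (cong (ℚ._+ ι z) (sym ι-1)) (trans (sym (ι-+ 1ℤ z)) eq))) (sym (cancel p)))
      where
      cancel : ∀ p → p ≡ 1ℚ ℚ.+ p ℚ.- 1ℚ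
      cancel = RingSolver.solve-∀ ℚ-ring

  -- The diamond rule determines the entries at k + 2 from those at k and k + 1 by a division by a
  -- positive number, and `euler` shows that the products of continuants obey the same rule.
  1+h≡DD : ∀ k i → k ≤ suc w → i + k ≤ M → ι (1ℤ ℤ.+ h i k) ≡ D i (suc k) ℚ.* D (suc i) (suc k)
  1+h≡DD zero          i _ _ rewrite top i = trans ι-1 (sym (ℚₚ.*-identityˡ 1ℚ))
  1+h≡DD (suc zero)    i _ i+1≤M = trans (sym (a-prod i (subst (_≤ M) (ℕₚ.+-comm i 1) i+1≤M)))
    (sym (cong₂ ℚ._*_ (D-2 i) (D-2 (suc i))))
  1+h≡DD (suc (suc k)) i (s≤s k<w) i+k+2≤M = *-cancelʳ 0<DD (begin
    ι (1ℤ ℤ.+ h i (suc (suc k))) ℚ.* (D (suc i) (suc k) ℚ.* D (suc (suc i)) (suc k))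
      ≡⟨ cong (ι (1ℤ ℤ.+ h i (suc (suc k))) ℚ.*_) DD ⟨
    ι (1ℤ ℤ.+ h i (suc (suc k))) ℚ.* ι (1ℤ ℤ.+ h (suc i) k)
      ≡⟨ trans (cong ι (diamond i k k<w)) (ι-* _ _) ⟨
    ι (h i (suc k) ℤ.* h (suc i) (suc k))
      ≡⟨ ι-* _ _ ⟩
    ι (h i (suc k)) ℚ.* ι (h (suc i) (suc k))
      ≡⟨ cong₂ ℚ._*_ (ι-1+ (D i (suc (suc (suc k))) ℚ.* D (suc i) (suc k)) (trans (1+h≡DD (suc k) i 1+k≤1+w (ℕₚ.≤-trans (ℕₚ.+-monoʳ-≤ i (ℕₚ.n≤1+n (suc k))) i+k+2≤M)) (euler i (suc k))))
                     (ι-1+ (D (suc i) (suc (suc (suc k))) ℚ.* D (suc (suc i)) (suc k)) (trans (1+h≡DD (suc k) (suc i) 1+k≤1+w (subst (_≤ M) (ℕₚ.+-suc i (suc k)) i+k+2≤M)) (euler (suc i) (suc k)))) ⟩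
    (D i (suc (suc (suc k))) ℚ.* D (suc i) (suc k)) ℚ.* (D (suc i) (suc (suc (suc k))) ℚ.* D (suc (suc i)) (suc k))
      ≡⟨ interchange (D i (suc (suc (suc k)))) (D (suc i) (suc k)) (D (suc i) (suc (suc (suc k)))) (D (suc (suc i)) (suc k)) ⟩
    (D i (suc (suc (suc k))) ℚ.* D (suc i) (suc (suc (suc k)))) ℚ.* (D (suc i) (suc k) ℚ.* D (suc (suc i)) (suc k)) ∎)
    where
    open ≡-Reasoning
    1+k≤1+w : suc k ≤ suc w
    1+k≤1+w = ℕₚ.<⇒≤ (s≤s k<w)
    interchange : ∀ p q r s → (p ℚ.* q) ℚ.* (r ℚ.* s) ≡ (p ℚ.* r) ℚ.* (q ℚ.* s)
    interchange = RingSolver.solve-∀ ℚ-ring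
    k≤1+w : k ≤ suc w
    k≤1+w = ℕₚ.<⇒≤ 1+k≤1+w
    DD : ι (1ℤ ℤ.+ h (suc i) k) ≡ D (suc i) (suc k) ℚ.* D (suc (suc i)) (suc k)
    DD = 1+h≡DD k (suc i) k≤1+w (ℕₚ.≤-trans (ℕₚ.n≤1+n _) (subst (_≤ M) (trans (ℕₚ.+-suc i (suc k)) (cong suc (ℕₚ.+-suc i k))) i+k+2≤M))
    0<DD : 0ℚ ℚ.< D (suc i) (suc k) ℚ.* D (suc (suc i)) (suc k)
    0<DD = subst (0ℚ ℚ.<_) DD (ι-pos (0<1+h (suc i) k k≤1+w))

  h≡DD : ∀ k i → k ≤ suc w → i + k ≤ M → ι (h i k) ≡ D i (suc (suc k)) ℚ.* D (suc i) k
  h≡DD k i k≤ i+k≤ = ι-1+ (D i (suc (suc k)) ℚ.* D (suc i) k) (trans (1+h≡DD k i k≤ i+k≤) (euler i k))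

  D-pos : ∀ k i → k ≤ suc w → i + k ≤ suc M → 0ℚ ℚ.< D i (suc k)
  D-pos zero          i _ _ = 0<1ℚ
  D-pos (suc zero)    i _ _ = subst (0ℚ ℚ.<_) (sym (D-2 i)) (a-pos i)
  D-pos (suc (suc k)) i (s≤s k<w) i+k+2≤1+M = *-pos⁻¹ (D-pos k (suc i) (ℕₚ.≤-trans (ℕₚ.<⇒≤ k<w) (ℕₚ.n≤1+n w)) (ℕₚ.<⇒≤ i+k+2≤))
    (subst (0ℚ ℚ.<_) (h≡DD (suc k) i (ℕₚ.<⇒≤ (s≤s k<w)) (subst (_≤ M) (sym (ℕₚ.+-suc i k)) (ℕₚ.≤-pred i+k+2≤)))
      (ι-pos (inside i k k<w)))
    where
    i+k+2≤ : suc (suc (i + k)) ≤ suc M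
    i+k+2≤ = subst (_≤ suc M) (trans (ℕₚ.+-suc i (suc k)) (cong suc (ℕₚ.+-suc i k))) i+k+2≤1+M

-- Integrality of the invariants under rescaling

dbl : ℕ → ℕ
dbl zero    = zero
dbl (suc m) = suc (suc (dbl m))

dbl-+ : ∀ s q → dbl (s + q) ≡ dbl s + dbl q
dbl-+ zero    q = refl
dbl-+ (suc s) q = cong (λ n → suc (suc n)) (dbl-+ s q)

dbl-mono-≤ : ∀ {m n} → m ≤ n → dbl m ≤ dbl n
dbl-mono-≤ z≤n       = z≤n
dbl-mono-≤ (s≤s m≤n) = s≤s (s≤s (dbl-mono-≤ m≤n))

module Integrality {w} (R : Rows w) (a : ℕ → ℚ) (a-pos : ∀ i → 0ℚ ℚ.< a i)
                   (a-prod : ∀ i → a i ℚ.* a (suc i) ≡ ι (1ℤ ℤ.+ Rows.h R i 1)) where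
  open Rows R
  open Continuant a

  h≡DD : ∀ k i → k ≤ suc w → ι (h i k) ≡ D i (suc (suc k)) ℚ.* D (suc i) k
  h≡DD k i k≤ = Quiddity.h≡DD R a a-pos (i + k) (λ i _ → a-prod i) k i k≤ ℕₚ.≤-refl

  1+h≡DD : ∀ k i → k ≤ suc w → ι (1ℤ ℤ.+ h i k) ≡ D i (suc k) ℚ.* D (suc i) (suc k)
  1+h≡DD k i k≤ = Quiddity.1+h≡DD R a a-pos (i + k) (λ i _ → a-prod i) k i k≤ ℕₚ.≤-refl

  D-pos : ∀ k i → k ≤ suc w → 0ℚ ℚ.< D i (suc k)
  D-pos k i k≤ = Quiddity.D-pos R a a-pos (i + k) (λ i _ → a-prod i) k i k≤ (ℕₚ.n≤1+n _)

  -- Both quantities pair indices of opposite parity, so the factors λ and λ⁻¹ cancel: D i (2l+1) is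
  -- the determinant of the vertices i and i + 2l + 1. For equal parity integrality depends on the
  -- choice of λ.
  IntegralD IntegralP : ℕ → Set
  IntegralD l = ∀ i → IsInt (D i (suc (dbl l)))
  IntegralP l = ∀ i → IsInt (a i ℚ.* a (suc i + dbl l))

  private
    right-product : ∀ {l} → IntegralD l → IntegralD (suc l) → ∀ i → IsInt (a (i + suc (dbl l)) ℚ.* D i (suc (suc (dbl l))))
    right-product {l} dl dsl i = subst IsInt (eq (a (i + suc (dbl l)) ℚ.* D i (suc (suc (dbl l)))) (D i (suc (dbl l)))) (Int-+ (dsl i) (dl i))
      where
      eq : ∀ x y → (x ℚ.- y) ℚ.+ y ≡ x
      eq = RingSolver.solve-∀ ℚ-ring

    X : ℕ → ℕ → ℚ
    X m i = a i ℚ.* a (suc i + dbl m)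

    -- The continuant is expanded at its last entry and then at its first; the two remaining terms
    -- are integral by the recurrence for shorter continuants.
    D-split : ∀ m → (∀ l → l ≤ m → IntegralD l) → ∀ i →
              IsInt (D i (suc (suc (suc (dbl m)))) ℚ.- X m i ℚ.* D (suc i) (suc (dbl m)))
    D-split m dm i = subst IsInt (sym eq) (Int-neg (Int-+ (tail m dm) (dm m ℕₚ.≤-refl i)))
      where
      n = dbl m
      tail : ∀ m → (∀ l → l ≤ m → IntegralD l) → IsInt (a (i + suc (dbl m)) ℚ.* D (suc (suc i)) (dbl m))
      tail zero    _  = subst IsInt (sym (ℚₚ.*-zeroʳ (a (i + 1)))) Int-0
      tail (suc m) dm = subst (λ j → IsInt (a j ℚ.* D (suc (suc i)) (dbl (suc m))))
        (sym (trans (ℕₚ.+-suc i _) (cong suc (ℕₚ.+-suc i _))))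
        (right-product {m} (dm m (ℕₚ.n≤1+n m)) (dm (suc m) ℕₚ.≤-refl) (suc (suc i)))
      ring : ∀ x y p q r → (x ℚ.* (y ℚ.* p ℚ.- q) ℚ.- r) ℚ.- (y ℚ.* x) ℚ.* p ≡ ℚ.- (x ℚ.* q ℚ.+ r)
      ring = RingSolver.solve-∀ ℚ-ring
      eq : D i (suc (suc (suc n))) ℚ.- X m i ℚ.* D (suc i) (suc n) ≡
           ℚ.- (a (i + suc n) ℚ.* D (suc (suc i)) n ℚ.+ D i (suc n))
      eq = trans (cong₂ (λ d x → (a (i + suc n) ℚ.* d ℚ.- D i (suc n)) ℚ.- (a i ℚ.* x) ℚ.* D (suc i) (suc n))
                   (D-left i n) (cong a (sym (ℕₚ.+-suc i n))))
        (ring (a (i + suc n)) (a i) (D (suc i) (suc n)) (D (suc (suc i)) n) (D i (suc n)))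

    -- Expanding the continuant at its first entry `a b` and multiplying by X, the leading term
    -- becomes the integer a i · a b times an integer from `right-product`. So modulo ℤ the
    -- continuant may be shortened by two at the price of a sign, until it is 1.
    reduce : ∀ m → (∀ l → l ≤ m → IntegralD l) → (∀ l → l < m → IntegralP l) → ∀ i q s → s + q ≡ m →
             ∃ λ σ → σ ℤ.* σ ≡ 1ℤ × IsInt (X m i ℚ.* D (suc i + dbl s) (suc (dbl q)) ℚ.- ι σ ℚ.* X m i)
    reduce m dm pm i zero    s eq = 1ℤ , refl , subst IsInt
      (trans (zero-diff (X m i)) (cong (λ e → X m i ℚ.* 1ℚ ℚ.- e ℚ.* X m i) (sym ι-1))) Int-0
      where
      zero-diff : ∀ x → 0ℚ ≡ x ℚ.* 1ℚ ℚ.- 1ℚ ℚ.* x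
      zero-diff = RingSolver.solve-∀ ℚ-ring
    reduce m dm pm i (suc q) s eq with σ , σσ , int ← reduce m dm pm i q (suc s) (trans (sym (ℕₚ.+-suc s q)) eq) =
      ℤ.- σ , trans (neg² σ) σσ ,
      subst IsInt (sym ident) (Int-- (Int-* (pm s s<m i) last-int) int)
      where
      neg² : ∀ σ → (ℤ.- σ) ℤ.* (ℤ.- σ) ≡ σ ℤ.* σ
      neg² = ℤ-Ring.solve-∀
      b = suc i + dbl s
      s<m : s < m
      s<m = subst (suc s ≤_) (trans (sym (ℕₚ.+-suc s q)) eq) (ℕₚ.m≤m+n (suc s) q)
      1+q≤m : suc q ≤ m
      1+q≤m = subst (suc q ≤_) eq (ℕₚ.m≤n+m (suc q) s)
      index : suc b + suc (dbl q) ≡ suc i + dbl m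
      index = trans (shift i (dbl s) (dbl q)) (cong (λ n → suc i + n) (trans (sym (dbl-+ s (suc q))) (cong dbl eq)))
        where
        shift : ∀ i s q → suc (suc i + s) + suc q ≡ suc i + (s + suc (suc q))
        shift = ℕ-Ring.solve-∀
      last-int : IsInt (a (suc i + dbl m) ℚ.* D (suc b) (suc (suc (dbl q))))
      last-int = subst (λ j → IsInt (a j ℚ.* D (suc b) (suc (suc (dbl q))))) index
        (right-product {q} (dm q (ℕₚ.<⇒≤ 1+q≤m)) (dm (suc q) 1+q≤m) (suc b))
      ring : ∀ x y z d e σ → (x ℚ.* y) ℚ.* (z ℚ.* d ℚ.- e) ℚ.- (ℚ.- σ) ℚ.* (x ℚ.* y)
                         ≡ (x ℚ.* z) ℚ.* (y ℚ.* d) ℚ.- ((x ℚ.* y) ℚ.* e ℚ.- σ ℚ.* (x ℚ.* y))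
      ring = RingSolver.solve-∀ ℚ-ring
      ident : X m i ℚ.* D b (suc (dbl (suc q))) ℚ.- ι (ℤ.- σ) ℚ.* X m i ≡
              (a i ℚ.* a b) ℚ.* (a (suc i + dbl m) ℚ.* D (suc b) (suc (suc (dbl q)))) ℚ.-
              (X m i ℚ.* D (suc i + dbl (suc s)) (suc (dbl q)) ℚ.- ι σ ℚ.* X m i)
      ident = trans (cong₂ (λ d e → X m i ℚ.* d ℚ.- e ℚ.* X m i) (D-left b (suc (dbl q))) (ι-neg σ))
        (trans (ring (a i) (a (suc i + dbl m)) (a b) (D (suc b) (suc (suc (dbl q)))) (D (suc (suc b)) (suc (dbl q))) (ι σ))
          (cong (λ j → (a i ℚ.* a b) ℚ.* (a (suc i + dbl m) ℚ.* D (suc b) (suc (suc (dbl q)))) ℚ.-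
                         (X m i ℚ.* D j (suc (dbl q)) ℚ.- ι σ ℚ.* X m i))
            (sym (trans (ℕₚ.+-suc (suc i) (suc (dbl s))) (cong suc (ℕₚ.+-suc (suc i) (dbl s)))))))

    -- With X = a i · a (i+2m+1) and E = D (i+1) (2m+1), both X E² ∈ ℤ (from h) and
    -- X E ∈ ± X + ℤ (from the expansion of E), so that X ∈ ℤ since E ∈ ℤ.
    P-step : ∀ m → dbl (suc m) ≤ suc w → (∀ l → l ≤ m → IntegralD l) → (∀ l → l < m → IntegralP l) → IntegralP m
    P-step m m≤ dm pm i with σ , σσ , int ← reduce m dm pm i m 0 refl =
      subst IsInt (sym ident) (Int-- (Int-- xee (Int-* (Int-ι σ) int′)) (Int-* int′ e))
      where
      E = D (suc i) (suc (dbl m))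
      e : IsInt E
      e = dm m ℕₚ.≤-refl (suc i)
      x = X m i
      N = D i (suc (suc (suc (dbl m))))
      int′ : IsInt (x ℚ.* E ℚ.- ι σ ℚ.* x)
      int′ = subst (λ j → IsInt (x ℚ.* D j (suc (dbl m)) ℚ.- ι σ ℚ.* x)) (ℕₚ.+-identityʳ (suc i)) int
      -- `N ℚ.* E` is an entry of the pattern, and `D-split` replaces `N` by `x ℚ.* E` modulo ℤ.
      xee : IsInt (x ℚ.* E ℚ.* E)
      xee = subst IsInt (ring N x E) (Int-- (subst IsInt (h≡DD (suc (dbl m)) i (ℕₚ.<⇒≤ m≤)) (Int-ι _)) (Int-* (D-split m dm i) e))
        where
        ring : ∀ n x e → n ℚ.* e ℚ.- (n ℚ.- x ℚ.* e) ℚ.* e ≡ x ℚ.* e ℚ.* e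
        ring = RingSolver.solve-∀ ℚ-ring
      ident : x ≡ x ℚ.* E ℚ.* E ℚ.- ι σ ℚ.* (x ℚ.* E ℚ.- ι σ ℚ.* x) ℚ.- (x ℚ.* E ℚ.- ι σ ℚ.* x) ℚ.* E
      ident = trans (sym (trans (cong (ℚ._* x) (trans (sym (ι-* σ σ)) (trans (cong ι σσ) ι-1))) (ℚₚ.*-identityˡ x))) (ring x E (ι σ))
        where
        ring : ∀ x e s → s ℚ.* s ℚ.* x ≡ x ℚ.* e ℚ.* e ℚ.- s ℚ.* (x ℚ.* e ℚ.- s ℚ.* x) ℚ.- (x ℚ.* e ℚ.- s ℚ.* x) ℚ.* e
        ring = RingSolver.solve-∀ ℚ-ring

    D-step : ∀ m → (∀ l → l ≤ m → IntegralD l) → IntegralP m → IntegralD (suc m)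
    D-step m dm p i = subst IsInt (ring (D i (suc (suc (suc (dbl m))))) (X m i ℚ.* D (suc i) (suc (dbl m))))
      (Int-+ (D-split m dm i) (Int-* (p i) (dm m ℕₚ.≤-refl (suc i))))
      where
      ring : ∀ n x → (n ℚ.- x) ℚ.+ x ≡ n
      ring = RingSolver.solve-∀ ℚ-ring

    extend : ∀ {P : ℕ → Set} {m} → (∀ l → l ≤ m → P l) → P (suc m) → ∀ l → l ≤ suc m → P l
    extend ps p l l≤1+m with ℕₚ.m≤n⇒m<n∨m≡n l≤1+m
    ... | inj₁ l<1+m = ps l (ℕₚ.≤-pred l<1+m)
    ... | inj₂ refl  = p

  integral : ∀ m → dbl m ≤ suc w → (∀ l → l ≤ m → IntegralD l) × (∀ l → l < m → IntegralP l)
  integral zero    _ = (λ { zero _ i → Int-1 }) , λ _ ()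
  integral (suc m) m≤ with dm , pm ← integral m (ℕₚ.≤-trans (ℕₚ.≤-trans (ℕₚ.n≤1+n _) (ℕₚ.n≤1+n _)) m≤) =
    extend dm (D-step m dm p) , λ l l<1+m → P-extend l (ℕₚ.≤-pred l<1+m)
    where
    p = P-step m m≤ dm pm
    P-extend : ∀ l → l ≤ m → IntegralP l
    P-extend l l≤m with ℕₚ.m≤n⇒m<n∨m≡n l≤m
    ... | inj₁ l<m  = pm l l<m
    ... | inj₂ refl = p

parity : ∀ n → ∃ λ m → n ≡ dbl m ⊎ n ≡ suc (dbl m)
parity zero = 0 , inj₁ refl
parity (suc n) with parity n
... | m , inj₁ refl = m , inj₂ refl
... | m , inj₂ refl = suc m , inj₁ refl

dbl≢1+dbl : ∀ m n → dbl m ≢ suc (dbl n)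
dbl≢1+dbl (suc m) (suc n) eq = dbl≢1+dbl m n (ℕₚ.suc-injective (ℕₚ.suc-injective eq))

dbl-injective : ∀ m n → dbl m ≡ dbl n → m ≡ n
dbl-injective zero    zero    _  = refl
dbl-injective (suc m) (suc n) eq = cong suc (dbl-injective m n (ℕₚ.suc-injective (ℕₚ.suc-injective eq)))

dbl-cancel-≤ : ∀ m n → dbl m ≤ dbl n → m ≤ n
dbl-cancel-≤ zero    n       _             = z≤n
dbl-cancel-≤ (suc m) (suc n) (s≤s (s≤s p)) = s≤s (dbl-cancel-≤ m n p)

-- Integral rescalings of the labels

gcdUpTo : (ℕ → ℕ) → ℕ → ℕ
gcdUpTo N zero    = 0
gcdUpTo N (suc m) = gcd (N m) (gcdUpTo N m)

gcdUpTo-∣ : ∀ N m {s} → s < m → gcdUpTo N m ∣ N s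
gcdUpTo-∣ N (suc m) (s≤s s≤m) with ℕₚ.m≤n⇒m<n∨m≡n s≤m
... | inj₁ s<m  = ∣-trans (gcd[m,n]∣n (N m) _) (gcdUpTo-∣ N m s<m)
... | inj₂ refl = gcd[m,n]∣m (N m) _

gcdUpTo-greatest : ∀ N m {d} → (∀ s → s < m → d ∣ N s) → d ∣ gcdUpTo N m
gcdUpTo-greatest N zero    d∣ = _ ∣0
gcdUpTo-greatest N (suc m) d∣ = gcd-greatest (d∣ m ℕₚ.≤-refl) (gcdUpTo-greatest N m λ s s<m → d∣ s (ℕₚ.m≤n⇒m≤1+n s<m))

Int-gcdUpTo : ∀ N m {q} → (∀ s → s < m → IsInt (ι (+ N s) ℚ.* q)) → IsInt (ι (+ gcdUpTo N m) ℚ.* q)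
Int-gcdUpTo N zero    {q} _   = subst IsInt (sym (trans (cong (ℚ._* q) ι-0) (ℚₚ.*-zeroˡ q))) Int-0
Int-gcdUpTo N (suc m)     int = Int-gcd (N m) _ (int m ℕₚ.≤-refl) (Int-gcdUpTo N m λ s s<m → int s (ℕₚ.m≤n⇒m≤1+n s<m))

naturals : ∀ {b : ℕ → ℚ} n → (∀ i → i < n → 0ℚ ℚ.< b i × IsInt (b i)) →
           ∃ λ (f : ℕ → ℕ) → (∀ i → 0 < f i) × (∀ i → i < n → b i ≡ ι (+ f i))
naturals {b} n int = (λ i → proj₁ (go i)) , (λ i → proj₁ (proj₂ (go i))) , (λ i → proj₂ (proj₂ (go i)))
  where
  go : ∀ i → ∃ λ k → 0 < k × (i < n → b i ≡ ι (+ k))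
  go i with suc i ≤? n
  -- The default 1 keeps the sequence positive outside the window.
  ... | no  i≮n = 1 , s≤s z≤n , λ i<n → contradiction i<n i≮n
  ... | yes i<n with 0<b , ib ← int i i<n with k , eq ← Int⇒ℕ 0<b ib = suc k , s≤s z≤n , λ _ → eq

-- As `a k` belongs to the vertex k + 1, the odd indices below p are the even vertices 2, ..., p.
-- Divisibility at vertex 0 follows from these by `forced`. For odd p, where λ is not free, the
-- condition is vacuous.
Primitive : ℕ → (ℕ → ℕ) → Set
Primitive p a = ∀ m → p ≡ dbl m → ∀ d → (∀ s → s < m → d ∣ a (suc (dbl s))) → d ≡ 1

record IntegerLift {w} (R : Rows w) : Set where
  field
    a         : ℕ → ℕ
    a-pos     : ∀ i → 0 < a i
    a-prod    : ∀ i → i < suc w → + (a i * a (suc i)) ≡ 1ℤ ℤ.+ Rows.h R i 1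
    coprime   : Primitive (suc w) a

module _ {w} (R : Rows w) where
  open Rows R

  private
    x : ℕ → ℚ
    x i = ι (1ℤ ℤ.+ h i 1)

    0<x : ∀ i → 0ℚ ℚ.< x i
    0<x i = ι-pos (0<1+h i 1 (s≤s z≤n))

    positives : ℕ → ∃ λ q → 0ℚ ℚ.< q
    -- The value at 0 is arbitrary: it is the free scaling factor, adjusted in `IntegerLifting`.
    positives zero = 1ℚ , 0<1ℚ
    positives (suc i) with q , 0<q ← positives i = x i ℚ.* proj₁ (reciprocal q 0<q) ,
      *-pos (0<x i) (proj₁ (proj₂ (reciprocal q 0<q)))

  rational-lift : ∃ λ a → (∀ i → 0ℚ ℚ.< a i) × (∀ i → a i ℚ.* a (suc i) ≡ ι (1ℤ ℤ.+ h i 1))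
  rational-lift = (λ i → proj₁ (positives i)) , (λ i → proj₂ (positives i)) , λ i →
    let q , 0<q = positives i ; r , _ , qr≡1 = reciprocal q 0<q in
    trans (swap q (x i) r) (trans (cong (x i ℚ.*_) qr≡1) (ℚₚ.*-identityʳ (x i)))
    where
    swap : ∀ p q r → p ℚ.* (q ℚ.* r) ≡ q ℚ.* (p ℚ.* r)
    swap = RingSolver.solve-∀ ℚ-ring

module IntegerLifting {w} (R : Rows w) (a : ℕ → ℚ) (a-pos : ∀ i → 0ℚ ℚ.< a i)
                      (a-prod : ∀ i → a i ℚ.* a (suc i) ≡ ι (1ℤ ℤ.+ Rows.h R i 1)) where
  open Rows R
  open Continuant a
  open Integrality R a a-pos a-prod

  private
    p = suc w

    x : ℕ → ℚ
    x i = ι (1ℤ ℤ.+ h i 1)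

    lift : (b : ℕ → ℚ) → (∀ i → i < suc p → 0ℚ ℚ.< b i × IsInt (b i)) → (∀ i → i < p → b i ℚ.* b (suc i) ≡ x i) →
           (∀ f → (∀ i → i < suc p → b i ≡ ι (+ f i)) → Primitive p f) → IntegerLift R
    lift b int prod prim with f , f-pos , b≡f ← naturals (suc p) int = record
      { a = f ; a-pos = f-pos ; coprime = prim f b≡f
      ; a-prod = λ i i<p → ι-injective (trans (cong ι (ℤₚ.pos-* (f i) (f (suc i)))) (trans (ι-* (+ f i) (+ f (suc i)))
          (trans (sym (cong₂ ℚ._*_ (b≡f i (ℕₚ.m≤n⇒m≤1+n i<p)) (b≡f (suc i) (s≤s i<p)))) (prod i i<p)))) }

  -- For odd p the polygon has an odd number of vertices and a i is determined by R:
  -- up to the factor D (i+1) (p+1), which is inverted by i ↦ i+1, it is the integer D (i+2) p.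
  module _ (m : ℕ) (p≡ : p ≡ suc (dbl m)) where
    private
      m≤ : dbl m ≤ suc w
      m≤ = subst (dbl m ≤_) (sym p≡) (ℕₚ.n≤1+n (dbl m))

      D-0 : ∀ i → D i (suc (suc p)) ≡ 0ℚ
      D-0 i = *-cancelʳ (D-pos w (suc i) (ℕₚ.n≤1+n w)) (trans (sym (h≡DD p i ℕₚ.≤-refl))
        (trans (cong ι (bottom i)) (trans ι-0 (sym (ℚₚ.*-zeroˡ (D (suc i) p))))))

      b : ℕ → ℚ
      b i = D (suc (suc i)) p

      b≡ : ∀ i → b i ≡ a i ℚ.* D (suc i) (suc p)
      b≡ i = trans (eq (a i ℚ.* D (suc i) (suc p)) (b i)) (trans (cong (λ e → a i ℚ.* D (suc i) (suc p) ℚ.- e) (trans (sym (D-left i p)) (D-0 i))) (ℚₚ.+-identityʳ _))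
        where
        eq : ∀ x b → b ≡ x ℚ.- (x ℚ.- b)
        eq = RingSolver.solve-∀ ℚ-ring

      b-prod : ∀ i → b i ℚ.* b (suc i) ≡ x i
      b-prod i = trans (cong₂ ℚ._*_ (b≡ i) (b≡ (suc i))) (trans (interchange (a i) (D (suc i) (suc p)) (a (suc i)) (D (suc (suc i)) (suc p)))
        (trans (cong₂ ℚ._*_ (a-prod i) (trans (sym (1+h≡DD p (suc i) ℕₚ.≤-refl)) (trans (cong (λ z → ι (1ℤ ℤ.+ z)) (bottom (suc i))) ι-1)))
          (ℚₚ.*-identityʳ (x i))))
        where
        interchange : ∀ p q r s → (p ℚ.* q) ℚ.* (r ℚ.* s) ≡ (p ℚ.* r) ℚ.* (q ℚ.* s)
        interchange = RingSolver.solve-∀ ℚ-ring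

    odd-lift : IntegerLift R
    odd-lift = lift b
      (λ i _ → D-pos w (suc (suc i)) (ℕₚ.n≤1+n w) , subst (λ k → IsInt (D (suc (suc i)) k)) (sym p≡) (proj₁ (integral m m≤) m ℕₚ.≤-refl (suc (suc i))))
      (λ i _ → b-prod i)
      (λ _ _ m′ p≡dbl → ⊥-elim (dbl≢1+dbl m′ m (trans (sym p≡dbl) p≡)))

  -- The integers N s = a 0 · a (2s+1) have gcd g. The factor a 0 / g turns the odd terms into the
  -- coprime integers N s / g. The even terms get the factor g / a 0 and become integral by
  -- `Int-gcdUpTo`, since N s · (a (2j) / a 0) = a (2j) · a (2s+1) is an integer for every s.
  module _ (m : ℕ) (p≡ : p ≡ dbl m) where
    private
      ip : ∀ l → l < m → IntegralP l
      ip = proj₂ (integral m (ℕₚ.≤-reflexive (sym p≡)))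

      opposite : ∀ s s′ → s < m → s′ ≤ m → IsInt (a (dbl s′) ℚ.* a (suc (dbl s)))
      opposite s s′ s<m s′≤m with ℕₚ.≤-<-connex s′ s
      ... | inj₁ s′≤s = subst (λ j → IsInt (a (dbl s′) ℚ.* a (suc j)))
        (trans (sym (dbl-+ s′ (s ∸ s′))) (cong dbl (ℕₚ.m+[n∸m]≡n s′≤s))) (ip (s ∸ s′) (ℕₚ.≤-<-trans (ℕₚ.m∸n≤m s s′) s<m) (dbl s′))
      ... | inj₂ s<s′ = subst IsInt (ℚₚ.*-comm (a (suc (dbl s))) (a (dbl s′))) (subst (λ j → IsInt (a (suc (dbl s)) ℚ.* a j))
        (trans (sym (dbl-+ (suc s) (s′ ∸ suc s))) (cong dbl (ℕₚ.m+[n∸m]≡n s<s′)))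
        (ip (s′ ∸ suc s) (ℕₚ.<-≤-trans (ℕₚ.∸-monoʳ-< {s′} {suc s} {0} (s≤s z≤n) s<s′) s′≤m) (suc (dbl s))))

      0<m : 0 < m
      0<m = ℕₚ.n≢0⇒n>0 λ m≡0 → ℕₚ.0≢1+n (trans (sym (cong dbl m≡0)) (sym p≡))

      nats = naturals {λ s → a 0 ℚ.* a (suc (dbl s))} m λ s s<m →
        *-pos (a-pos 0) (a-pos (suc (dbl s))) , opposite s 0 s<m z≤n

      N : ℕ → ℕ
      N = proj₁ nats

      N≡ : ∀ s → s < m → a 0 ℚ.* a (suc (dbl s)) ≡ ι (+ N s)
      N≡ = proj₂ (proj₂ nats)

      g : ℕ
      g = gcdUpTo N m

      0<g : 0 < g
      0<g = ℕₚ.n≢0⇒n>0 λ g≡0 → ℕₚ.<⇒≢ (proj₁ (proj₂ nats) 0) (sym (∣ₚ.0∣⇒≡0 (subst (_∣ N 0) g≡0 (gcdUpTo-∣ N m 0<m))))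

      ιg r₀ r t t⁻¹ : ℚ
      ιg = ι (+ g)
      0<ιg : 0ℚ ℚ.< ιg
      0<ιg = ι-pos (+<+ 0<g)
      r₀ = proj₁ (reciprocal (a 0) (a-pos 0))
      r = proj₁ (reciprocal ιg 0<ιg)
      a₀r₀ : a 0 ℚ.* r₀ ≡ 1ℚ
      a₀r₀ = proj₂ (proj₂ (reciprocal (a 0) (a-pos 0)))
      gr : ιg ℚ.* r ≡ 1ℚ
      gr = proj₂ (proj₂ (reciprocal ιg 0<ιg))
      t = a 0 ℚ.* r
      t⁻¹ = ιg ℚ.* r₀
      0<t : 0ℚ ℚ.< t
      0<t = *-pos (a-pos 0) (proj₁ (proj₂ (reciprocal ιg 0<ιg)))
      0<t⁻¹ : 0ℚ ℚ.< t⁻¹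
      0<t⁻¹ = *-pos 0<ιg (proj₁ (proj₂ (reciprocal (a 0) (a-pos 0))))
      t⁻¹t : t⁻¹ ℚ.* t ≡ 1ℚ
      t⁻¹t = trans (interchange ιg r₀ (a 0) r) (trans (cong₂ ℚ._*_ gr a₀r₀) (ℚₚ.*-identityˡ 1ℚ))
        where
        interchange : ∀ g r₀ a r → (g ℚ.* r₀) ℚ.* (a ℚ.* r) ≡ (g ℚ.* r) ℚ.* (a ℚ.* r₀)
        interchange = RingSolver.solve-∀ ℚ-ring

      alternate : ℚ → ℚ → ℕ → ℚ
      alternate u v zero    = u
      alternate u v (suc i) = alternate v u i

      alternate-pos : ∀ {u v} → 0ℚ ℚ.< u → 0ℚ ℚ.< v → ∀ i → 0ℚ ℚ.< alternate u v i
      alternate-pos 0<u 0<v zero    = 0<u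
      alternate-pos 0<u 0<v (suc i) = alternate-pos 0<v 0<u i

      alternate-prod : ∀ {u v} → u ℚ.* v ≡ 1ℚ → ∀ i → alternate u v i ℚ.* alternate u v (suc i) ≡ 1ℚ
      alternate-prod         uv zero    = uv
      alternate-prod {u} {v} uv (suc i) = alternate-prod (trans (ℚₚ.*-comm v u) uv) i

      alternate-even : ∀ {u v} s → alternate u v (dbl s) ≡ u
      alternate-even zero    = refl
      alternate-even (suc s) = alternate-even s

      b : ℕ → ℚ
      b i = a i ℚ.* alternate t⁻¹ t i

      b-prod : ∀ i → b i ℚ.* b (suc i) ≡ x i
      b-prod i = trans (interchange (a i) _ (a (suc i)) _) (trans (cong₂ ℚ._*_ (a-prod i) (alternate-prod t⁻¹t i)) (ℚₚ.*-identityʳ (x i)))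
        where
        interchange : ∀ p q r s → (p ℚ.* q) ℚ.* (r ℚ.* s) ≡ (p ℚ.* r) ℚ.* (q ℚ.* s)
        interchange = RingSolver.solve-∀ ℚ-ring

      b-odd : ∀ s → s < m → (n : ℕ) → N s ≡ n * g → b (suc (dbl s)) ≡ ι (+ n)
      b-odd s s<m n eq = trans (cong (a (suc (dbl s)) ℚ.*_) (alternate-even s)) (trans (swap (a (suc (dbl s))) (a 0) r)
        (trans (cong (ℚ._* r) (trans (N≡ s s<m) (trans (cong ι (trans (cong +_ eq) (ℤₚ.pos-* n g))) (ι-* (+ n) (+ g)))))
          (trans (ℚₚ.*-assoc (ι (+ n)) ιg r) (trans (cong (ι (+ n) ℚ.*_) gr) (ℚₚ.*-identityʳ (ι (+ n)))))))
        where
        swap : ∀ p q r → p ℚ.* (q ℚ.* r) ≡ (q ℚ.* p) ℚ.* r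
        swap = RingSolver.solve-∀ ℚ-ring

      b-even : ∀ s → s ≤ m → IsInt (b (dbl s))
      b-even s s≤m = subst IsInt (trans (swap ιg (a (dbl s)) r₀) (cong (a (dbl s) ℚ.*_) (sym (alternate-even s))))
        (Int-gcdUpTo N m λ s′ s′<m → subst IsInt (sym (begin
          ι (+ N s′) ℚ.* (a (dbl s) ℚ.* r₀)                    ≡⟨ cong (ℚ._* (a (dbl s) ℚ.* r₀)) (N≡ s′ s′<m) ⟨
          (a 0 ℚ.* a (suc (dbl s′))) ℚ.* (a (dbl s) ℚ.* r₀)    ≡⟨ regroup (a 0) (a (suc (dbl s′))) (a (dbl s)) r₀ ⟩
          (a 0 ℚ.* r₀) ℚ.* (a (dbl s) ℚ.* a (suc (dbl s′)))    ≡⟨ cong (ℚ._* (a (dbl s) ℚ.* a (suc (dbl s′)))) a₀r₀ ⟩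
          1ℚ ℚ.* (a (dbl s) ℚ.* a (suc (dbl s′)))              ≡⟨ ℚₚ.*-identityˡ _ ⟩
          a (dbl s) ℚ.* a (suc (dbl s′))                       ∎)) (opposite s′ s s′<m s≤m))
        where
        open ≡-Reasoning
        swap : ∀ g a r → g ℚ.* (a ℚ.* r) ≡ a ℚ.* (g ℚ.* r)
        swap = RingSolver.solve-∀ ℚ-ring
        regroup : ∀ p q a r → (p ℚ.* q) ℚ.* (a ℚ.* r) ≡ (p ℚ.* r) ℚ.* (a ℚ.* q)
        regroup = RingSolver.solve-∀ ℚ-ring

      quotient≡ : ∀ s (s<m : s < m) → N s ≡ quotient (gcdUpTo-∣ N m s<m) * g
      quotient≡ s s<m = _∣_.equality (gcdUpTo-∣ N m s<m)

      b-int : ∀ i → i < suc p → IsInt (b i)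
      b-int i i≤p with parity i
      ... | s , inj₁ refl = b-even s (dbl-cancel-≤ s m (subst (dbl s ≤_) p≡ (ℕₚ.≤-pred i≤p)))
      ... | s , inj₂ refl = _ , b-odd s s<m (quotient (gcdUpTo-∣ N m s<m)) (quotient≡ s s<m)
        where
        s<m : s < m
        s<m with ℕₚ.≤-<-connex m s
        ... | inj₂ s<m = s<m
        ... | inj₁ m≤s = contradiction (ℕₚ.≤-trans (ℕₚ.≤-pred i≤p) (subst (_≤ dbl s) (sym p≡) (dbl-mono-≤ m≤s))) (ℕₚ.<-irrefl refl)

      b-primitive : ∀ f → (∀ i → i < suc p → b i ≡ ι (+ f i)) → Primitive p f
      b-primitive f b≡f m′ p≡′ d d∣f with refl ← dbl-injective m′ m (trans (sym p≡′) p≡) =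
        ∣1⇒≡1 (∣ₚ.*-cancelʳ-∣ g {{>-nonZero 0<g}} (subst (d * g ∣_) (sym (ℕₚ.*-identityˡ g)) (gcdUpTo-greatest N m dg∣N)))
        where
        dg∣N : ∀ s → s < m → d * g ∣ N s
        dg∣N s s<m = subst (d * g ∣_) (sym (quotient≡ s s<m)) (∣ₚ.*-monoˡ-∣ g (subst (d ∣_)
          (ℤₚ.+-injective (ι-injective (trans (sym (b≡f (suc (dbl s)) 1+dbl<)) (b-odd s s<m (quotient (gcdUpTo-∣ N m s<m)) (quotient≡ s s<m))))) (d∣f s s<m)))
          where
          1+dbl< : suc (dbl s) < suc p
          1+dbl< = s≤s (subst (suc (dbl s) ≤_) (sym p≡) (ℕₚ.≤-trans (ℕₚ.n≤1+n _) (dbl-mono-≤ s<m)))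

    even-lift : IntegerLift R
    even-lift = lift b (λ i i≤p → *-pos (a-pos i) (alternate-pos 0<t⁻¹ 0<t i) , b-int i i≤p) (λ i _ → b-prod i) b-primitive

integer-lift : ∀ {w} (R : Rows w) → IntegerLift R
integer-lift {w} R = by-parity (rational-lift R) (parity (suc w))
  where
  by-parity : (∃ λ a → (∀ i → 0ℚ ℚ.< a i) × (∀ i → a i ℚ.* a (suc i) ≡ ι (1ℤ ℤ.+ Rows.h R i 1))) →
              (∃ λ m → suc w ≡ dbl m ⊎ suc w ≡ suc (dbl m)) → IntegerLift R
  by-parity (a , a-pos , a-prod) (m , inj₁ p≡) = IntegerLifting.even-lift R a a-pos a-prod m p≡
  by-parity (a , a-pos , a-prod) (m , inj₂ p≡) = IntegerLifting.odd-lift R a a-pos a-prod m p≡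

-- From triangulations to Y-frieze patterns

-- Moving the first vector to the end with the opposite sign rotates the polygon by one vertex. The
-- result is again a chain because det x (⊖ y) = det y x, which is positive for y before x.
module Turning (N : ℕ) (0<N : 0 < N) where

  turn : (ℕ → V) → ℕ → V
  turn g k with k <? N
  ... | yes _ = g (suc k)
  ... | no  _ = ⊖ g 0

  turn⁻¹ : (ℕ → V) → ℕ → V
  turn⁻¹ g zero    = ⊖ g N
  turn⁻¹ g (suc k) = g k

  turn-< : ∀ g {k} → k < N → turn g k ≡ g (suc k)
  turn-< g {k} k<N with k <? N
  ... | yes _  = refl
  ... | no k≮N = contradiction k<N k≮N

  turn-N : ∀ g → turn g N ≡ ⊖ g 0
  turn-N g with N <? N
  ... | yes N<N = contradiction N<N (ℕₚ.<-irrefl refl)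
  ... | no  _   = refl

  private
    det-⊖-swap : ∀ x y → det x (⊖ y) ≡ det y x
    det-⊖-swap x y = trans (det-⊖ʳ x y) (sym (det-swap x y))

    det-⊖-swapˡ : ∀ x y → det (⊖ x) y ≡ det y x
    det-⊖-swapˡ x y = trans (det-⊖ˡ x y) (sym (det-swap x y))

  turn-chain : ∀ {g} → Chain N g → Chain N (turn g)
  turn-chain {g} ch = record { unimodular = uni ; positive = pos ; closed = clo }
    where
    open Chain ch
    uni : ∀ i → i < N → det (turn g i) (turn g (suc i)) ≡ 1ℤ
    uni i i<N with ℕₚ.m≤n⇒m<n∨m≡n i<N
    ... | inj₁ 1+i<N = trans (cong₂ det (turn-< g i<N) (turn-< g 1+i<N)) (unimodular (suc i) 1+i<N)
    ... | inj₂ 1+i≡N = trans (cong₂ det (turn-< g i<N) (trans (cong (turn g) 1+i≡N) (turn-N g)))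
      (trans (det-⊖-swap (g (suc i)) (g 0)) (trans (cong (λ j → det (g 0) (g j)) 1+i≡N) closed))
    pos : ∀ i j → i < j → j ≤ N → 0ℤ ℤ.< det (turn g i) (turn g j)
    pos i j i<j j≤N with ℕₚ.m≤n⇒m<n∨m≡n j≤N
    ... | inj₁ j<N  = subst (0ℤ ℤ.<_) (sym (cong₂ det (turn-< g (ℕₚ.<-trans i<j j<N)) (turn-< g j<N))) (positive (suc i) (suc j) (s≤s i<j) j<N)
    ... | inj₂ refl = subst (0ℤ ℤ.<_) (sym (trans (cong₂ det (turn-< g i<j) (turn-N g)) (det-⊖-swap (g (suc i)) (g 0))))
      (positive 0 (suc i) (s≤s z≤n) i<j)
    clo : det (turn g 0) (turn g N) ≡ 1ℤ
    clo = trans (cong₂ det (turn-< g 0<N) (turn-N g)) (trans (det-⊖-swap (g 1) (g 0)) (unimodular 0 0<N))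

  turn⁻¹-chain : ∀ {g} → Chain N g → Chain N (turn⁻¹ g)
  turn⁻¹-chain {g} ch = record { unimodular = uni ; positive = pos ; closed = clo N 0<N refl }
    where
    open Chain ch
    uni : ∀ i → i < N → det (turn⁻¹ g i) (turn⁻¹ g (suc i)) ≡ 1ℤ
    uni zero    _     = trans (det-⊖-swapˡ (g N) (g 0)) closed
    uni (suc i) 1+i<N = unimodular i (ℕₚ.<⇒≤ 1+i<N)
    pos : ∀ i j → i < j → j ≤ N → 0ℤ ℤ.< det (turn⁻¹ g i) (turn⁻¹ g j)
    pos zero    (suc j) _         j<N = subst (0ℤ ℤ.<_) (sym (det-⊖-swapˡ (g N) (g j))) (positive j N j<N ℕₚ.≤-refl)
    pos (suc i) (suc j) (s≤s i<j) j<N = positive i j i<j (ℕₚ.<⇒≤ j<N)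
    clo : ∀ M → 0 < M → M ≡ N → det (⊖ g N) (turn⁻¹ g M) ≡ 1ℤ
    clo (suc M) _ refl = trans (det-⊖-swapˡ (g (suc M)) (g M)) (unimodular M ℕₚ.≤-refl)

  module Rotate {f : ℕ → V} (ch : Chain N f) where

    window : ℤ → ℕ → V
    window (+ zero)      = f
    window (+ suc n)     = turn (window (+ n))
    window -[1+ zero ]   = turn⁻¹ f
    window -[1+ suc n ]  = turn⁻¹ (window -[1+ n ])

    window-chain : ∀ i → Chain N (window i)
    window-chain (+ zero)     = ch
    window-chain (+ suc n)    = turn-chain (window-chain (+ n))
    window-chain -[1+ zero ]  = turn⁻¹-chain ch
    window-chain -[1+ suc n ] = turn⁻¹-chain (window-chain -[1+ n ])

    private
      unturn : ∀ (g : ℕ → V) k → k ≤ N → turn (turn⁻¹ g) k ≡ g k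
      unturn g k k≤N with k <? N
      ... | yes _  = refl
      ... | no k≮N with refl ← ℕₚ.≤-antisym k≤N (ℕₚ.≮⇒≥ k≮N) = ⊖-involutive (g k)

      window-turn : ∀ i k → k ≤ N → window (ℤ.suc i) k ≡ turn (window i) k
      window-turn (+ n)        k k≤N = refl
      window-turn -[1+ zero ]  k k≤N = sym (unturn f k k≤N)
      window-turn -[1+ suc n ] k k≤N = sym (unturn (window -[1+ n ]) k k≤N)

    -- the vertices on the universal cover of the polygon
    V∞ : ℤ → V
    V∞ i = window i 0

    V∞-window : ∀ i k → k ≤ N → V∞ (i ℤ.+ + k) ≡ window i k
    V∞-window i zero    _   = cong V∞ (ℤₚ.+-identityʳ i)
    V∞-window i (suc k) k<N = trans (cong V∞ (sym (shift i (+ k)))) (trans (V∞-window (ℤ.suc i) k (ℕₚ.<⇒≤ k<N))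
      (trans (window-turn i k (ℕₚ.<⇒≤ k<N)) (turn-< (window i) k<N)))
      where
      shift : ∀ i k → 1ℤ ℤ.+ i ℤ.+ k ≡ i ℤ.+ (1ℤ ℤ.+ k)
      shift = ℤ-Ring.solve-∀

    V∞-period : ∀ i → V∞ (i ℤ.+ + suc N) ≡ ⊖ V∞ i
    V∞-period i = trans (cong V∞ (sym (shift i (+ N)))) (trans (V∞-window (ℤ.suc i) N ℕₚ.≤-refl)
      (trans (window-turn i N ℕₚ.≤-refl) (turn-N (window i))))
      where
      shift : ∀ i k → 1ℤ ℤ.+ i ℤ.+ k ≡ i ℤ.+ (1ℤ ℤ.+ k)
      shift = ℤ-Ring.solve-∀

    V∞-unimodular : ∀ i → det (V∞ i) (V∞ (i ℤ.+ 1ℤ)) ≡ 1ℤ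
    V∞-unimodular i = trans (cong (det (V∞ i)) (V∞-window i 1 0<N)) (Chain.unimodular (window-chain i) 0 0<N)

    V∞-positive : ∀ i k → 0 < k → k ≤ N → 0ℤ ℤ.< det (V∞ i) (V∞ (i ℤ.+ + k))
    V∞-positive i k 0<k k≤N = subst (λ x → 0ℤ ℤ.< det (V∞ i) x) (sym (V∞-window i k k≤N)) (Chain.positive (window-chain i) 0 k 0<k k≤N)

0≤⇒+ : ∀ {z} → 0ℤ ℤ.≤ z → ∃ λ k → z ≡ + k
0≤⇒+ {+ k} _ = k , refl

i+[j-i]≡j : ∀ i j → i ℤ.+ (j ℤ.- i) ≡ j
i+[j-i]≡j = ℤ-Ring.solve-∀

module ChainFrieze (w : ℕ) {f : ℕ → V} (ch : Chain (suc (suc w)) f) where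
  open Turning (suc (suc w)) (s≤s z≤n) public
  open Rotate ch public

  pattern-entry : ℤ → ℤ → ℤ
  pattern-entry i j = det (V∞ i) (V∞ (j ℤ.+ + 3)) ℤ.* det (V∞ (i ℤ.+ 1ℤ)) (V∞ (j ℤ.+ + 2))

  private
    b = pattern-entry

    at : ∀ {i j x y} → V∞ (j ℤ.+ + 3) ≡ x → V∞ (j ℤ.+ + 2) ≡ y → b i j ≡ det (V∞ i) x ℤ.* det (V∞ (i ℤ.+ 1ℤ)) y
    at {i} eq₁ eq₂ = cong₂ (λ x y → det (V∞ i) x ℤ.* det (V∞ (i ℤ.+ 1ℤ)) y) eq₁ eq₂

    zeroˡ : ∀ {x} y → x ≡ 0ℤ → x ℤ.* y ≡ 0ℤ
    zeroˡ y eq = trans (cong (ℤ._* y) eq) (ℤₚ.*-zeroˡ y)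

    zeroʳ : ∀ x {y} → y ≡ 0ℤ → x ℤ.* y ≡ 0ℤ
    zeroʳ x eq = trans (cong (x ℤ.*_) eq) (ℤₚ.*-zeroʳ x)

    V-at : ∀ {i j} → i ≡ j → V∞ i ≡ V∞ j
    V-at = cong V∞

    turned : ∀ {i} j → i ≡ j ℤ.+ + suc (suc (suc w)) → V∞ i ≡ ⊖ V∞ j
    turned j eq = trans (cong V∞ eq) (V∞-period j)

    det-⊖-self : ∀ x → det x (⊖ x) ≡ 0ℤ
    det-⊖-self x = trans (det-⊖ʳ x x) (cong ℤ.-_ (det-self x))

    b[i,i-3] : ∀ i → b i (i - + 3) ≡ 0ℤ
    b[i,i-3] i = trans (at {i} {j = i - + 3} (V-at (e i)) refl) (zeroˡ (det (V∞ (i ℤ.+ 1ℤ)) (V∞ (i - + 3 ℤ.+ + 2))) (det-self (V∞ i)))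
      where
      e : ∀ i → i - + 3 ℤ.+ + 3 ≡ i
      e = ℤ-Ring.solve-∀

    b[i,i-2] : ∀ i → b i (i - + 2) ≡ -1ℤ
    b[i,i-2] i = trans (at {i} {j = i - + 2} (V-at (e₁ i)) (V-at (e₂ i)))
      (cong₂ ℤ._*_ (V∞-unimodular i) (trans (det-swap (V∞ i) (V∞ (i ℤ.+ 1ℤ))) (cong ℤ.-_ (V∞-unimodular i))))
      where
      e₁ : ∀ i → i - + 2 ℤ.+ + 3 ≡ i ℤ.+ 1ℤ
      e₁ = ℤ-Ring.solve-∀
      e₂ : ∀ i → i - + 2 ℤ.+ + 2 ≡ i
      e₂ = ℤ-Ring.solve-∀

    b[i,i-1] : ∀ i → b i (i - + 1) ≡ 0ℤ
    b[i,i-1] i = trans (at {i} {j = i - + 1} refl (V-at (e i)))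
      (zeroʳ (det (V∞ i) (V∞ (i - + 1 ℤ.+ + 3))) (det-self (V∞ (i ℤ.+ 1ℤ))))
      where
      e : ∀ i → i - + 1 ℤ.+ + 2 ≡ i ℤ.+ 1ℤ
      e = ℤ-Ring.solve-∀

    b[i,i+w] : ∀ i → b i (i ℤ.+ + w) ≡ 0ℤ
    b[i,i+w] i = trans (at {i} {j = i ℤ.+ + w} (turned i (e i (+ w))) refl)
      (zeroˡ (det (V∞ (i ℤ.+ 1ℤ)) (V∞ (i ℤ.+ + w ℤ.+ + 2))) (det-⊖-self (V∞ i)))
      where
      e : ∀ i w → i ℤ.+ w ℤ.+ + 3 ≡ i ℤ.+ (+ 3 ℤ.+ w)
      e = ℤ-Ring.solve-∀

    b[i,i+w+1] : ∀ i → b i (i ℤ.+ + w ℤ.+ + 1) ≡ -1ℤ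
    b[i,i+w+1] i = trans (at {i} {j = i ℤ.+ + w ℤ.+ + 1} (turned (i ℤ.+ 1ℤ) (e₁ i (+ w))) (turned i (e₂ i (+ w)))) (cong₂ ℤ._*_
      (trans (det-⊖ʳ (V∞ i) (V∞ (i ℤ.+ 1ℤ))) (cong ℤ.-_ (V∞-unimodular i)))
      (trans (det-⊖ʳ (V∞ (i ℤ.+ 1ℤ)) (V∞ i)) (trans (sym (det-swap (V∞ (i ℤ.+ 1ℤ)) (V∞ i))) (V∞-unimodular i))))
      where
      e₁ : ∀ i w → i ℤ.+ w ℤ.+ + 1 ℤ.+ + 3 ≡ i ℤ.+ 1ℤ ℤ.+ (+ 3 ℤ.+ w)
      e₁ = ℤ-Ring.solve-∀
      e₂ : ∀ i w → i ℤ.+ w ℤ.+ + 1 ℤ.+ + 2 ≡ i ℤ.+ (+ 3 ℤ.+ w)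
      e₂ = ℤ-Ring.solve-∀

    b[i,i+w+2] : ∀ i → b i (i ℤ.+ + w ℤ.+ + 2) ≡ 0ℤ
    b[i,i+w+2] i = trans (at {i} {j = i ℤ.+ + w ℤ.+ + 2} refl (turned (i ℤ.+ 1ℤ) (e i (+ w))))
      (zeroʳ (det (V∞ i) (V∞ (i ℤ.+ + w ℤ.+ + 2 ℤ.+ + 3))) (det-⊖-self (V∞ (i ℤ.+ 1ℤ))))
      where
      e : ∀ i w → i ℤ.+ w ℤ.+ + 2 ℤ.+ + 2 ≡ i ℤ.+ 1ℤ ℤ.+ (+ 3 ℤ.+ w)
      e = ℤ-Ring.solve-∀

    positive : ∀ i j → 0ℤ ℤ.≤ j - i → j - i ℤ.≤ + w - + 1 → 0ℤ ℤ.< b i j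
    positive i j 0≤ ≤w with 0≤⇒+ 0≤
    ... | k , eq = subst (0ℤ ℤ.<_) (sym (at {i} {j} (V-at (e₃ i (+ k) j j≡)) (V-at (e₂ i (+ k) j j≡))))
      (0<* (V∞-positive i (3 + k) (s≤s z≤n) (s≤s (s≤s k<w))) (V∞-positive (i ℤ.+ 1ℤ) (suc k) (s≤s z≤n) (s≤s (ℕₚ.≤-trans (ℕₚ.n≤1+n k) (ℕₚ.≤-trans k<w (ℕₚ.n≤1+n w))))))
      where
      j≡ : j ≡ i ℤ.+ + k
      j≡ = trans (sym (i+[j-i]≡j i j)) (cong (λ z → i ℤ.+ z) eq)
      k<w : k < w
      k<w = ℤₚ.drop‿+≤+ (subst (1ℤ ℤ.+ + k ℤ.≤_) (cancel (+ w)) (ℤₚ.+-monoʳ-≤ 1ℤ (subst (ℤ._≤ + w - + 1) eq ≤w)))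
        where
        cancel : ∀ w → 1ℤ ℤ.+ (w - + 1) ≡ w
        cancel = ℤ-Ring.solve-∀
      e₃ : ∀ i k j → j ≡ i ℤ.+ k → j ℤ.+ + 3 ≡ i ℤ.+ (+ 3 ℤ.+ k)
      e₃ i k _ refl = r i k
        where
        r : ∀ i k → i ℤ.+ k ℤ.+ + 3 ≡ i ℤ.+ (+ 3 ℤ.+ k)
        r = ℤ-Ring.solve-∀
      e₂ : ∀ i k j → j ≡ i ℤ.+ k → j ℤ.+ + 2 ≡ i ℤ.+ 1ℤ ℤ.+ (1ℤ ℤ.+ k)
      e₂ i k _ refl = r i k
        where
        r : ∀ i k → i ℤ.+ k ℤ.+ + 2 ≡ i ℤ.+ 1ℤ ℤ.+ (1ℤ ℤ.+ k)
        r = ℤ-Ring.solve-∀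

  -- Plücker's relation, for the two pairs of consecutive vertices i, i+1 and j+2, j+3
  1+b : ∀ i j → 1ℤ ℤ.+ b i j ≡ det (V∞ i) (V∞ (j ℤ.+ + 2)) ℤ.* det (V∞ (i ℤ.+ 1ℤ)) (V∞ (j ℤ.+ + 3))
  1+b i j = sym (trans (plücker (V∞ i) (V∞ (i ℤ.+ 1ℤ)) (V∞ (j ℤ.+ + 2)) (V∞ (j ℤ.+ + 3)))
    (cong (ℤ._+ b i j) (trans (cong₂ ℤ._*_ (V∞-unimodular i) (trans (cong (det (V∞ (j ℤ.+ + 2))) (V-at (e j))) (V∞-unimodular (j ℤ.+ + 2)))) refl)))
    where
    e : ∀ j → j ℤ.+ + 3 ≡ j ℤ.+ + 2 ℤ.+ 1ℤ
    e = ℤ-Ring.solve-∀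

  frieze : YFriezePattern (+ w)
  frieze = record
    { b            = b
    ; b[i,i-3]     = b[i,i-3]
    ; b[i,i-2]     = b[i,i-2]
    ; b[i,i-1]     = b[i,i-1]
    ; b[i,i+w]     = b[i,i+w]
    ; b[i,i+w+1]   = b[i,i+w+1]
    ; b[i,i+w+2]   = b[i,i+w+2]
    ; positive     = positive
    -- By `1+b` the right-hand side is a product of the same four determinants as the left-hand
    -- side.
    ; diamond-rule = λ i j _ _ → trans
        (swap (det (V∞ i) (V∞ (j ℤ.+ + 3))) (det (V∞ (i ℤ.+ 1ℤ)) (V∞ (j ℤ.+ + 2))) _ _)
        (sym (cong₂ ℤ._*_
          (trans (1+b i (j ℤ.+ 1ℤ)) (cong (λ k → det (V∞ i) (V∞ k) ℤ.* det (V∞ (i ℤ.+ 1ℤ)) (V∞ (j ℤ.+ 1ℤ ℤ.+ + 3))) (e₃ j)))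
          (trans (1+b (i ℤ.+ 1ℤ) j) (cong (λ k → det (V∞ (i ℤ.+ 1ℤ)) (V∞ (j ℤ.+ + 2)) ℤ.* det (V∞ (i ℤ.+ 1ℤ ℤ.+ 1ℤ)) (V∞ k)) (sym (e₃ j))))))
    }
    where
    e₃ : ∀ j → j ℤ.+ 1ℤ ℤ.+ + 2 ≡ j ℤ.+ + 3
    e₃ = ℤ-Ring.solve-∀
    swap : ∀ p q r s → (p ℤ.* q) ℤ.* (r ℤ.* s) ≡ (p ℤ.* r) ℤ.* (q ℤ.* s)
    swap = ℤ-Ring.solve-∀

-- From Y-frieze patterns to triangulations

row : ∀ {w} → YFriezePattern w → ℤ → ℕ → ℤ
row B i k = YFriezePattern.b B i (i ℤ.+ + k - 1ℤ)

module _ {w : ℕ} (B : YFriezePattern (+ w)) where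
  open YFriezePattern B

  private
    u : ℤ → ℕ → ℤ
    u = row B

  row-top : ∀ i → u i 0 ≡ 0ℤ
  row-top i = trans (cong (b i) (e i)) (b[i,i-1] i)
    where
    e : ∀ i → i ℤ.+ 0ℤ - 1ℤ ≡ i - 1ℤ
    e = ℤ-Ring.solve-∀

  row-bottom : ∀ i → u i (suc w) ≡ 0ℤ
  row-bottom i = trans (cong (b i) (e i (+ w))) (b[i,i+w] i)
    where
    e : ∀ i w → i ℤ.+ (1ℤ ℤ.+ w) - 1ℤ ≡ i ℤ.+ w
    e = ℤ-Ring.solve-∀

  row-inside : ∀ i k → k < w → 0ℤ ℤ.< u i (suc k)
  row-inside i k k<w = positive i _ (subst (0ℤ ℤ.≤_) (sym (e i (+ k))) (+≤+ z≤n))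
    (subst₂ ℤ._≤_ (sym (e i (+ k))) (ℤₚ.+-comm -1ℤ (+ w)) (subst (ℤ._≤ -1ℤ ℤ.+ + w) (e′ (+ k)) (ℤₚ.+-monoʳ-≤ -1ℤ (+≤+ k<w))))
    where
    e : ∀ i k → i ℤ.+ (1ℤ ℤ.+ k) - 1ℤ - i ≡ k
    e = ℤ-Ring.solve-∀
    e′ : ∀ k → -1ℤ ℤ.+ (1ℤ ℤ.+ k) ≡ k
    e′ = ℤ-Ring.solve-∀

  row-diamond : ∀ i k → k < w → u i (suc k) ℤ.* u (i ℤ.+ 1ℤ) (suc k) ≡ (1ℤ ℤ.+ u i (suc (suc k))) ℤ.* (1ℤ ℤ.+ u (i ℤ.+ 1ℤ) k)
  row-diamond i k k<w = trans (cong₂ (λ j j′ → b i j ℤ.* b (i ℤ.+ 1ℤ) j′) (e₁ i (+ k)) (e₂ i (+ k)))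
    (trans (diamond-rule i (i ℤ.+ + k) (subst (ℤ.- + 2 ℤ.≤_) (sym (e₀ i (+ k))) ℤ.-≤+)
              (subst₂ ℤ._≤_ (sym (e₀ i (+ k))) refl (+≤+ (ℕₚ.≤-trans (ℕₚ.<⇒≤ k<w) (ℕₚ.m≤m+n w 1)))))
      (sym (cong₂ (λ j j′ → (1ℤ ℤ.+ b i j) ℤ.* (1ℤ ℤ.+ b (i ℤ.+ 1ℤ) j′)) (e₃ i (+ k)) (e₄ i (+ k)))))
    where
    e₀ : ∀ i k → i ℤ.+ k - i ≡ k
    e₀ = ℤ-Ring.solve-∀
    e₁ : ∀ i k → i ℤ.+ (1ℤ ℤ.+ k) - 1ℤ ≡ i ℤ.+ k
    e₁ = ℤ-Ring.solve-∀
    e₂ : ∀ i k → i ℤ.+ 1ℤ ℤ.+ (1ℤ ℤ.+ k) - 1ℤ ≡ i ℤ.+ k ℤ.+ 1ℤ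
    e₂ = ℤ-Ring.solve-∀
    e₃ : ∀ i k → i ℤ.+ (+ 2 ℤ.+ k) - 1ℤ ≡ i ℤ.+ k ℤ.+ 1ℤ
    e₃ = ℤ-Ring.solve-∀
    e₄ : ∀ i k → i ℤ.+ 1ℤ ℤ.+ k - 1ℤ ≡ i ℤ.+ k
    e₄ = ℤ-Ring.solve-∀

  rows : Rows w
  rows = record
    { h       = λ i → u (+ i)
    ; top     = λ i → row-top (+ i)
    ; bottom  = λ i → row-bottom (+ i)
    ; inside  = λ i → row-inside (+ i)
    ; diamond = λ i k k<w → subst (λ i′ → u (+ i) (suc k) ℤ.* u i′ (suc k) ≡ (1ℤ ℤ.+ u (+ i) (suc (suc k))) ℤ.* (1ℤ ℤ.+ u i′ k))
        (ℤₚ.+-comm (+ i) 1ℤ) (row-diamond (+ i) k k<w)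
    }

-- A pattern is determined by a single row

module _ {w : ℕ} (B B′ : YFriezePattern (+ w)) where
  open YFriezePattern

  Agree : ℤ → Set
  Agree i = ∀ k → k ≤ suc w → row B i k ≡ row B′ i k

  private
    cancel : ∀ {x x′ y y′ : ℤ} → 0ℤ ℤ.< x → x ≡ x′ → x ℤ.* y ≡ x′ ℤ.* y′ → y ≡ y′
    cancel {x} {y = y} {y′} 0<x refl eq = ℤₚ.*-cancelˡ-≡ x y y′ {{ℤ.>-nonZero 0<x}} eq

  agree-down : ∀ i → Agree i → Agree (i ℤ.+ 1ℤ)
  agree-down i ag zero    _ = trans (row-top B (i ℤ.+ 1ℤ)) (sym (row-top B′ (i ℤ.+ 1ℤ)))
  agree-down i ag (suc k) (s≤s k≤w) with ℕₚ.m≤n⇒m<n∨m≡n k≤w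
  ... | inj₂ refl = trans (row-bottom B (i ℤ.+ 1ℤ)) (sym (row-bottom B′ (i ℤ.+ 1ℤ)))
  ... | inj₁ k<w  = cancel (row-inside B i k k<w) (ag (suc k) (s≤s k≤w)) (trans (row-diamond B i k k<w)
    (trans (cong₂ (λ x y → (1ℤ ℤ.+ x) ℤ.* (1ℤ ℤ.+ y)) (ag (suc (suc k)) (s≤s k<w)) (agree-down i ag k (ℕₚ.m≤n⇒m≤1+n k≤w)))
      (sym (row-diamond B′ i k k<w))))

  -- Solved for row i at k + 1, the diamond rule involves row i at k + 2, so the recursion runs
  -- downwards from the border k = w + 1.
  agree-up : ∀ i → Agree (i ℤ.+ 1ℤ) → Agree i
  agree-up i ag k k≤1+w = go (suc w ∸ k) k (ℕₚ.m+[n∸m]≡n k≤1+w)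
    where
    go : ∀ d k → k + d ≡ suc w → row B i k ≡ row B′ i k
    go d       zero    _ = trans (row-top B i) (sym (row-top B′ i))
    go zero    (suc k) eq with refl ← trans (sym (ℕₚ.+-identityʳ k)) (ℕₚ.suc-injective eq) = trans (row-bottom B i) (sym (row-bottom B′ i))
    go (suc d) (suc k) eq = cancel (row-inside B (i ℤ.+ 1ℤ) k k<w) (ag (suc k) (ℕₚ.m≤n⇒m≤1+n k<w))
      (trans (ℤₚ.*-comm (row B (i ℤ.+ 1ℤ) (suc k)) (row B i (suc k))) (trans (row-diamond B i k k<w)
        (trans (cong₂ (λ x y → (1ℤ ℤ.+ x) ℤ.* (1ℤ ℤ.+ y)) (go d (suc (suc k)) (trans (sym (ℕₚ.+-suc (suc k) d)) eq)) (ag k (ℕₚ.≤-trans (ℕₚ.n≤1+n k) (ℕₚ.m≤n⇒m≤1+n k<w))))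
          (trans (sym (row-diamond B′ i k k<w)) (ℤₚ.*-comm (row B′ i (suc k)) (row B′ (i ℤ.+ 1ℤ) (suc k)))))))
      where
      k<w : k < w
      k<w = subst (suc k ≤_) (trans (sym (ℕₚ.+-suc k d)) (ℕₚ.suc-injective eq)) (s≤s (ℕₚ.m≤m+n k d))

  agree : Agree 0ℤ → ∀ i → Agree i
  agree ag (+ zero)  = ag
  agree ag (+ suc n) = subst Agree (ℤₚ.+-comm (+ n) 1ℤ) (agree-down (+ n) (agree ag (+ n)))
  agree ag -[1+ zero ]  = agree-up -[1+ 0 ] ag
  agree ag -[1+ suc n ] = agree-up -[1+ suc n ] (agree ag -[1+ n ])

  private
    both : ∀ {i j j′ z} → j ≡ j′ → b B i j′ ≡ z → b B′ i j′ ≡ z → b B i j ≡ b B′ i j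
    both refl p q = trans p (sym q)

  -- The offset m = j - i + 3 runs from 0 to w + 5; its two smallest and two largest values are
  -- prescribed borders, and `Agree` covers those in between.
  agree⇒≈ : Agree 0ℤ → B ≈ B′
  agree⇒≈ ag i j -3≤ ≤w+2 with strip
    where
    strip : ∃ λ m → j ≡ i ℤ.+ + m - + 3 × m ≤ 5 + w
    strip with ℤₚ.+-monoʳ-≤ (+ 3) -3≤
    ... | 0≤ with + 3 ℤ.+ (j - i) in eq
    ... | + m = m , trans (e₁ i j) (cong (λ z → i ℤ.+ z - + 3) eq) ,
      ℤₚ.drop‿+≤+ (subst₂ ℤ._≤_ eq (e₂ (+ w)) (ℤₚ.+-monoʳ-≤ (+ 3) ≤w+2))
      where
      e₁ : ∀ i j → j ≡ i ℤ.+ (+ 3 ℤ.+ (j - i)) - + 3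
      e₁ = ℤ-Ring.solve-∀
      e₂ : ∀ w → + 3 ℤ.+ (w ℤ.+ + 2) ≡ + 5 ℤ.+ w
      e₂ = ℤ-Ring.solve-∀
  ... | 0 , refl , _ = both (e i) (b[i,i-3] B i) (b[i,i-3] B′ i)
    where
    e : ∀ i → i ℤ.+ + 0 - + 3 ≡ i - + 3
    e = ℤ-Ring.solve-∀
  ... | 1 , refl , _ = both (e i) (b[i,i-2] B i) (b[i,i-2] B′ i)
    where
    e : ∀ i → i ℤ.+ + 1 - + 3 ≡ i - + 2
    e = ℤ-Ring.solve-∀
  ... | suc (suc k) , refl , s≤s (s≤s k≤) with ℕₚ.m≤n⇒m<n∨m≡n k≤
  ... | inj₂ refl = both (e i (+ w)) (b[i,i+w+2] B i) (b[i,i+w+2] B′ i)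
    where
    e : ∀ i w → i ℤ.+ (+ 5 ℤ.+ w) - + 3 ≡ i ℤ.+ w ℤ.+ + 2
    e = ℤ-Ring.solve-∀
  ... | inj₁ (s≤s k≤′) with ℕₚ.m≤n⇒m<n∨m≡n k≤′
  ... | inj₂ refl = both (e i (+ w)) (b[i,i+w+1] B i) (b[i,i+w+1] B′ i)
    where
    e : ∀ i w → i ℤ.+ (+ 4 ℤ.+ w) - + 3 ≡ i ℤ.+ w ℤ.+ + 1
    e = ℤ-Ring.solve-∀
  ... | inj₁ (s≤s k≤1+w) = both (e i (+ k)) (agree ag i k k≤1+w) refl
    where
    e : ∀ i k → i ℤ.+ (+ 2 ℤ.+ k) - + 3 ≡ i ℤ.+ k - 1ℤ
    e = ℤ-Ring.solve-∀

-- Triangulations up to SL(2, ℤ) and their recovery from a pattern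

e₁ e₂ : V
e₁ = 1ℤ , 0ℤ
e₂ = 0ℤ , 1ℤ

Reps⇒vertex : ∀ t {f} → Reps t f → ∀ i → i ≤ edges t → f i ≡ vertex t (f 0) (f (edges t)) i
Reps⇒vertex leaf       _ zero    _         = refl
Reps⇒vertex leaf       _ (suc zero) _      = refl
Reps⇒vertex leaf       _ (suc (suc i)) (s≤s ())
Reps⇒vertex (fork s t) {f} (mid , rs , rt) i i≤ with ℕₚ.≤-total i (edges s)
... | inj₁ i≤m = trans (Reps⇒vertex s rs i i≤m) (trans (cong (λ x → vertex s (f 0) x i) mid)
  (sym (vertex-left s t (f 0) (f (edges s + edges t)) i≤m)))
... | inj₂ m≤i with k , refl ← split-at (edges s) i m≤i = trans (Reps⇒vertex t rt k (ℕₚ.+-cancelˡ-≤ (edges s) k (edges t) i≤))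
  (trans (cong (λ x → vertex t x (f (edges s + edges t)) k) (trans (cong f (ℕₚ.+-identityʳ (edges s))) mid))
    (sym (vertex-right s t (f 0) (f (edges s + edges t)) k)))

combine-vertex : ∀ t u v x y i → combine u v (vertex t x y i) ≡ vertex t (combine u v x) (combine u v y) i
combine-vertex leaf       u v x y zero    = refl
combine-vertex leaf       u v x y (suc i) = refl
combine-vertex (fork s t) u v x y i with ℕₚ.≤-total i (edges s)
... | inj₁ i≤m = trans (cong (combine u v) (vertex-left s t x y i≤m)) (trans (combine-vertex s u v x (x ⊕ y) i)
  (trans (cong (λ z → vertex s (combine u v x) z i) (combine-⊕ u v x y))
    (sym (vertex-left s t (combine u v x) (combine u v y) i≤m))))
... | inj₂ m≤i with k , refl ← split-at (edges s) i m≤i = trans (cong (combine u v) (vertex-right s t x y k)) (trans (combine-vertex t u v (x ⊕ y) y k)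
  (trans (cong (λ z → vertex t z (combine u v y) k) (combine-⊕ u v x y))
    (sym (vertex-right s t (combine u v x) (combine u v y) k))))

standard : Tree 2 → ℕ → V
standard t = vertex t e₁ e₂

standard-closed : ∀ t → det (standard t 0) (standard t (edges t)) ≡ 1ℤ
standard-closed t = trans (cong₂ det (vertex-0 t e₁ e₂) (vertex-edges t e₁ e₂)) det-basis

-- The linear map from the standard basis to the ends of the root edge respects the sums at the
-- apexes, so it carries `standard t` to `f`; its determinant is 1 by the closing condition.
Reps-det : ∀ t {f} → Reps t f → det (f 0) (f (edges t)) ≡ 1ℤ → ∀ i j → i ≤ edges t → j ≤ edges t →
           det (f i) (f j) ≡ det (standard t i) (standard t j)
Reps-det t {f} r c i j i≤ j≤ = trans (cong₂ det (combined i i≤) (combined j j≤))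
  (trans (det-combine u v (standard t i) (standard t j)) (trans (cong (det (standard t i) (standard t j) ℤ.*_) c) (ℤₚ.*-identityʳ _)))
  where
  u = f 0
  v = f (edges t)
  combined : ∀ i → i ≤ edges t → f i ≡ combine u v (standard t i)
  combined i i≤ = trans (Reps⇒vertex t r i i≤) (sym (trans (combine-vertex t u v e₁ e₂ i)
    (cong₂ (λ x y → vertex t x y i) (combine-e₁ u v) (combine-e₂ u v))))

tree-chain : ∀ {w} t → size t ≡ suc w → Chain (suc (suc w)) (standard t)
tree-chain t eq = subst (λ n → Chain n (standard t)) (trans (edges≡1+size t) (cong suc eq))
  (Reps⇒Chain t (Reps-vertex t e₁ e₂) (standard-closed t))

tree-frieze : ∀ {w} t → size t ≡ suc w → YFriezePattern (+ w)
tree-frieze {w} t eq = ChainFrieze.frieze w (tree-chain t eq)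

det-recurrence : ∀ u k x y → det u (k ⊛ y ⊕ ⊖ x) ≡ k ℤ.* det u y - det u x
det-recurrence u k x y = trans (det-⊕ʳ u (k ⊛ y) (⊖ x)) (cong₂ ℤ._+_ (det-⊛ʳ k u y) (det-⊖ʳ u x))

-- The recurrence for `f` inverts the passage from vectors to labels: consecutive determinants stay
-- 1 and those at distance two are `a`. By `ι-det` all determinants in question are continuants,
-- whose positivity is known from `Quiddity`.
module FromLift {w} {R : Rows w} (L : IntegerLift R) where
  open Rows R
  open IntegerLift L

  f : ℕ → V
  f zero          = e₁
  f (suc zero)    = e₂
  f (suc (suc i)) = + a i ⊛ f (suc i) ⊕ ⊖ f i

  private
    aℚ : ℕ → ℚ
    aℚ i = ι (+ a i)

    module Q = Quiddity R aℚ (λ i → ι-pos (+<+ (a-pos i))) (suc w)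
      (λ i i<p → trans (sym (trans (cong ι (ℤₚ.pos-* (a i) (a (suc i)))) (ι-* (+ a i) (+ a (suc i))))) (cong ι (a-prod i i<p)))
    open Continuant aℚ

    unimodular : ∀ i → det (f i) (f (suc i)) ≡ 1ℤ
    unimodular zero    = det-basis
    unimodular (suc i) = trans (det-recurrence (f (suc i)) (+ a i) (f i) (f (suc i)))
      (trans (cong (λ z → + a i ℤ.* z - det (f (suc i)) (f i)) (det-self (f (suc i))))
        (trans (eq (+ a i) (det (f (suc i)) (f i))) (trans (sym (det-swap (f (suc i)) (f i))) (unimodular i))))
      where
      eq : ∀ a d → a ℤ.* 0ℤ - d ≡ ℤ.- d
      eq = ℤ-Ring.solve-∀

    ι-det : ∀ i k → ι (det (f i) (f (i + k))) ≡ D i k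
    ι-det i zero          = trans (cong (λ j → ι (det (f i) (f j))) (ℕₚ.+-identityʳ i)) (trans (cong ι (det-self (f i))) ι-0)
    ι-det i (suc zero)    = trans (cong (λ j → ι (det (f i) (f j))) (ℕₚ.+-comm i 1)) (trans (cong ι (unimodular i)) ι-1)
    ι-det i (suc (suc k)) = begin
      ι (det (f i) (f (i + suc (suc k))))
        ≡⟨ cong (λ j → ι (det (f i) (f j))) (trans (ℕₚ.+-suc i (suc k)) (cong suc (ℕₚ.+-suc i k))) ⟩
      ι (det (f i) (f (suc (suc (i + k)))))
        ≡⟨ cong ι (det-recurrence (f i) (+ a (i + k)) (f (i + k)) (f (suc (i + k)))) ⟩
      ι (+ a (i + k) ℤ.* det (f i) (f (suc (i + k))) - det (f i) (f (i + k)))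
        ≡⟨ ι-- _ _ ⟩
      ι (+ a (i + k) ℤ.* det (f i) (f (suc (i + k)))) ℚ.- ι (det (f i) (f (i + k)))
        ≡⟨ cong₂ ℚ._-_ (trans (ι-* _ _) (cong (aℚ (i + k) ℚ.*_) (trans (cong (λ j → ι (det (f i) (f j))) (sym (ℕₚ.+-suc i k))) (ι-det i (suc k))))) (ι-det i k) ⟩
      D i (suc (suc k)) ∎
      where open ≡-Reasoning

    det-positive : ∀ i k → i + k ≤ suc w → 0ℤ ℤ.< det (f i) (f (i + suc k))
    det-positive i k i+k≤ = ι-pos⁻¹ (subst (0ℚ ℚ.<_) (sym (ι-det i (suc k)))
      (Q.D-pos k i (ℕₚ.≤-trans (ℕₚ.m≤n+m k i) i+k≤) (ℕₚ.m≤n⇒m≤1+n i+k≤)))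

    -- det (f 0) (f (p+1)) is a positive integer with an integral inverse
    closed : det (f 0) (f (suc (suc w))) ≡ 1ℤ
    closed = unit (det-positive 0 (suc w) ℕₚ.≤-refl) (ι-injective (trans (ι-* _ _)
      (trans (cong₂ ℚ._*_ (ι-det 0 (suc (suc w))) (ι-det 1 (suc (suc w))))
        (trans (sym (Q.1+h≡DD (suc w) 0 ℕₚ.≤-refl ℕₚ.≤-refl)) (cong (λ z → ι (1ℤ ℤ.+ z)) (bottom 0))))))
      where
      unit : ∀ {x y} → 0ℤ ℤ.< x → x ℤ.* y ≡ 1ℤ → x ≡ 1ℤ
      unit {+ m} {y} _ eq = cong +_ (ℕₚ.m*n≡1⇒m≡1 m ∣ y ∣ (trans (sym (ℤₚ.abs-* (+ m) y)) (cong ∣_∣ eq)))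

  f-chain : Chain (suc (suc w)) f
  f-chain = record
    { unimodular = λ i _ → unimodular i
    ; positive   = λ i j i<j j≤ → positive′ i j i<j j≤
    ; closed     = closed }
    where
    positive′ : ∀ i j → i < j → j ≤ suc (suc w) → 0ℤ ℤ.< det (f i) (f j)
    positive′ i j i<j j≤ with k , refl ← split-at (suc i) j i<j =
      subst (λ j → 0ℤ ℤ.< det (f i) (f j)) (ℕₚ.+-suc i k) (det-positive i k (ℕₚ.≤-pred j≤))

  f-label : ∀ k → label f k ≡ a k
  f-label k = cong ∣_∣ (trans (det-recurrence (f k) (+ a k) (f k) (f (suc k)))
    (trans (cong₂ (λ x y → + a k ℤ.* x - y) (unimodular k) (det-self (f k))) (eq (+ a k))))
    where
    eq : ∀ a → a ℤ.* 1ℤ - 0ℤ ≡ a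
    eq = ℤ-Ring.solve-∀

  h-det : ∀ k → k ≤ suc w → h 0 k ≡ det (f 0) (f (suc (suc k))) ℤ.* det (f 1) (f (suc k))
  h-det k k≤ = ι-injective (trans (Q.h≡DD k 0 k≤ k≤) (sym (trans (ι-* _ _) (cong₂ ℚ._*_ (ι-det 0 (suc (suc k))) (ι-det 1 k)))))

  f-tree : ∃ λ t → edges t ≡ suc (suc w) × Reps t f
  f-tree = Chain⇒Reps (s≤s z≤n) f-chain

-- The counterpart of `Primitive` for trees; `m` expresses that p is even, so for odd p every tree
-- qualifies.
NonDivisible : ℕ → Tree 2 → Set
NonDivisible p t = ∀ d m → p ≡ dbl m → Div d true t → d ≡ 1

module FromFrieze {w} (B : YFriezePattern (+ w)) where
  private
    L = integer-lift (rows B)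
    module F = FromLift L

  tree : Tree 2
  tree = proj₁ F.f-tree

  tree-size : size tree ≡ suc w
  tree-size = ℕₚ.suc-injective (trans (sym (edges≡1+size tree)) (proj₁ (proj₂ F.f-tree)))

  private
    edges≡ : edges tree ≡ suc (suc w)
    edges≡ = proj₁ (proj₂ F.f-tree)

    reps : Reps tree F.f
    reps = proj₂ (proj₂ F.f-tree)

    ends : det (F.f 0) (F.f (edges tree)) ≡ 1ℤ
    ends = trans (cong (λ n → det (F.f 0) (F.f n)) edges≡) (Chain.closed F.f-chain)

    dets : ∀ i j → i ≤ suc (suc w) → j ≤ suc (suc w) → det (F.f i) (F.f j) ≡ det (standard tree i) (standard tree j)
    dets i j i≤ j≤ = Reps-det tree reps ends i j (subst (i ≤_) (sym edges≡) i≤) (subst (j ≤_) (sym edges≡) j≤)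

  open ChainFrieze w (tree-chain tree tree-size)

  frieze-≈ : tree-frieze tree tree-size ≈ B
  frieze-≈ = agree⇒≈ (tree-frieze tree tree-size) B λ
    { zero    _ → trans (row-top frieze 0ℤ) (sym (row-top B 0ℤ))
    ; (suc k) (s≤s k≤w) → case k k≤w (ℕₚ.m≤n⇒m<n∨m≡n k≤w) }
    where
    case : ∀ k → k ≤ w → k < w ⊎ k ≡ w → row frieze 0ℤ (suc k) ≡ row B 0ℤ (suc k)
    case k _   (inj₂ refl) = trans (row-bottom frieze 0ℤ) (sym (row-bottom B 0ℤ))
    case k k≤w (inj₁ k<w)  = trans (cong₂ ℤ._*_
      (cong (det (V∞ 0ℤ)) (trans (cong V∞ (e (+ k))) (V∞-window 0ℤ (3 + k) 3+k≤)))
      (cong₂ det (V∞-window 0ℤ 1 (s≤s z≤n)) (trans (cong V∞ (e′ (+ k))) (V∞-window 0ℤ (2 + k) (ℕₚ.<⇒≤ 3+k≤)))))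
      (trans (sym (cong₂ ℤ._*_ (dets 0 (3 + k) z≤n 3+k≤) (dets 1 (2 + k) (s≤s z≤n) (ℕₚ.<⇒≤ 3+k≤))))
        (sym (F.h-det (suc k) (s≤s k≤w))))
      where
      3+k≤ : 3 + k ≤ suc (suc w)
      3+k≤ = s≤s (s≤s k<w)
      e : ∀ k → 0ℤ ℤ.+ (1ℤ ℤ.+ k) - 1ℤ ℤ.+ + 3 ≡ 0ℤ ℤ.+ (+ 3 ℤ.+ k)
      e = ℤ-Ring.solve-∀
      e′ : ∀ k → 0ℤ ℤ.+ (1ℤ ℤ.+ k) - 1ℤ ℤ.+ + 2 ≡ 0ℤ ℤ.+ (+ 2 ℤ.+ k)
      e′ = ℤ-Ring.solve-∀

  tree-nonDivisible : NonDivisible (suc w) tree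
  tree-nonDivisible d m eq div = IntegerLift.coprime L m eq d λ s s<m →
    subst (d ∣_) (F.f-label (suc (dbl s))) (Div⇒LabelDiv true tree reps ends div (suc (dbl s))
      (subst (suc (suc (dbl s)) <_) (sym (trans edges≡ (cong suc eq))) (s≤s (dbl-mono-≤ s<m))) (colour-even s))
    where
    colour-even : ∀ s → T (colour true (suc (suc (dbl s))))
    colour-even zero    = _
    colour-even (suc s) = colour-even s

record TreeOf {w} (B : YFriezePattern (+ w)) : Set where
  field
    tree         : Tree 2
    tree-size    : size tree ≡ suc w
    nonDivisible : NonDivisible (suc w) tree
    frieze-≈     : tree-frieze tree tree-size ≈ B

opaque
  tree-of : ∀ {w} (B : YFriezePattern (+ w)) → TreeOf B
  tree-of B = record { FromFrieze B renaming (tree-nonDivisible to nonDivisible) }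

-- Injectivity

private
  *-cancel-pos : ∀ {x y z} → 0 < z → x * z ≡ y * z → x ≡ y
  *-cancel-pos {x} {y} {z} 0<z eq = ℕₚ.*-cancelʳ-≡ x y z {{>-nonZero 0<z}} eq

  square-injective : ∀ m n → m * m ≡ n * n → m ≡ n
  square-injective m n eq with ℕₚ.<-cmp m n
  ... | tri< m<n _ _ = contradiction eq (ℕₚ.<⇒≢ (ℕₚ.*-mono-< m<n m<n))
  ... | tri≈ _ m≡n _ = m≡n
  ... | tri> _ _ n<m = contradiction (sym eq) (ℕₚ.<⇒≢ (ℕₚ.*-mono-< n<m n<m))

-- Two positive sequences with the same products of neighbours are rescalings of
-- each other, by λ at the even and by λ⁻¹ at the odd indices.
module Rescaled {A A′ : ℕ → ℕ} (A-pos : ∀ i → 0 < A i) (A′-pos : ∀ i → 0 < A′ i)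
                (neighbours : ∀ i → A i * A (suc i) ≡ A′ i * A′ (suc i)) where

  private
    0<AA′ : ∀ i → 0 < A i * A′ i
    0<AA′ i = ℕₚ.*-mono-< (A-pos i) (A′-pos i)

    cross-trans : ∀ {i j k} → A i * A′ j ≡ A′ i * A j → A j * A′ k ≡ A′ j * A k → A i * A′ k ≡ A′ i * A k
    cross-trans {i} {j} {k} ij jk = *-cancel-pos (0<AA′ j) (begin
      A i * A′ k * (A j * A′ j)   ≡⟨ regroup (A i) (A′ k) (A j) (A′ j) ⟩
      (A i * A′ j) * (A j * A′ k) ≡⟨ cong₂ _*_ ij jk ⟩
      (A′ i * A j) * (A′ j * A k) ≡⟨ regroup′ (A′ i) (A j) (A′ j) (A k) ⟩
      A′ i * A k * (A j * A′ j)   ∎)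
      where
      open ≡-Reasoning
      regroup : ∀ a b c d → a * b * (c * d) ≡ (a * d) * (c * b)
      regroup = ℕ-Ring.solve-∀
      regroup′ : ∀ a b c d → (a * b) * (c * d) ≡ a * d * (b * c)
      regroup′ = ℕ-Ring.solve-∀

    cross-two : ∀ j → A j * A′ (suc (suc j)) ≡ A′ j * A (suc (suc j))
    cross-two j = *-cancel-pos (0<AA′ (suc j)) (begin
      A j * A′ (2 + j) * (A (suc j) * A′ (suc j))    ≡⟨ regroup (A j) (A′ (2 + j)) (A (suc j)) (A′ (suc j)) ⟩
      (A j * A (suc j)) * (A′ (suc j) * A′ (2 + j))  ≡⟨ cong₂ _*_ (neighbours j) (sym (neighbours (suc j))) ⟩
      (A′ j * A′ (suc j)) * (A (suc j) * A (2 + j))  ≡⟨ regroup′ (A′ j) (A′ (suc j)) (A (suc j)) (A (2 + j)) ⟩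
      A′ j * A (2 + j) * (A (suc j) * A′ (suc j))    ∎)
      where
      open ≡-Reasoning
      regroup : ∀ a b c d → a * b * (c * d) ≡ (a * c) * (d * b)
      regroup = ℕ-Ring.solve-∀
      regroup′ : ∀ a b c d → (a * b) * (c * d) ≡ a * d * (c * b)
      regroup′ = ℕ-Ring.solve-∀

  cross : ∀ i k → A i * A′ (i + dbl k) ≡ A′ i * A (i + dbl k)
  cross i zero    rewrite ℕₚ.+-identityʳ i = ℕₚ.*-comm (A i) (A′ i)
  cross i (suc k) rewrite ℕₚ.+-suc i (suc (dbl k)) | ℕₚ.+-suc i (dbl k) = cross-trans {i} {i + dbl k} (cross i k) (cross-two (i + dbl k))

  opposite : ∀ i k → A i * A (suc i + dbl k) ≡ A′ i * A′ (suc i + dbl k)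
  opposite i k = *-cancel-pos (0<AA′ (suc i)) (begin
    A i * A j * (A (suc i) * A′ (suc i))      ≡⟨ regroup (A i) (A j) (A (suc i)) (A′ (suc i)) ⟩
    (A i * A (suc i)) * (A′ (suc i) * A j)    ≡⟨ cong₂ _*_ (neighbours i) (sym (cross (suc i) k)) ⟩
    (A′ i * A′ (suc i)) * (A (suc i) * A′ j)  ≡⟨ regroup′ (A′ i) (A′ (suc i)) (A (suc i)) (A′ j) ⟩
    A′ i * A′ j * (A (suc i) * A′ (suc i))    ∎)
    where
    open ≡-Reasoning
    j = suc i + dbl k
    regroup : ∀ a b c d → a * b * (c * d) ≡ (a * c) * (d * b)
    regroup = ℕ-Ring.solve-∀
    regroup′ : ∀ a b c d → (a * b) * (c * d) ≡ a * d * (c * b)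
    regroup′ = ℕ-Ring.solve-∀

  -- After one odd period the same value returns at an index of opposite parity, so `opposite`
  -- compares the squares of A i and A′ i.
  odd-period : ∀ k → (∀ i → A (i + suc (dbl k)) ≡ A i) → (∀ i → A′ (i + suc (dbl k)) ≡ A′ i) → ∀ i → A i ≡ A′ i
  odd-period k periodic periodic′ i = square-injective (A i) (A′ i)
    (subst₂ (λ x y → A i * x ≡ A′ i * y)
      (trans (cong A (sym (ℕₚ.+-suc i (dbl k)))) (periodic i))
      (trans (cong A′ (sym (ℕₚ.+-suc i (dbl k)))) (periodic′ i)) (opposite i k))

  -- A 1 = d · gcd (A 1) (A′ 1), and d divides every A (2s+1).
  primitive-∣ : ∀ m → Primitive (dbl m) A → A 1 ∣ A′ 1
  primitive-∣ m prim with gcd[m,n]∣m (A 1) (A′ 1)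
  ... | divides d eq = subst (_∣ A′ 1) (sym A₁≡g) (gcd[m,n]∣n (A 1) (A′ 1))
    where
    g = gcd (A 1) (A′ 1)
    0<g : 0 < g
    0<g = ℕₚ.n≢0⇒n>0 λ g≡0 → ℕₚ.<⇒≢ (A-pos 1) (sym (trans eq (trans (cong (d *_) g≡0) (ℕₚ.*-zeroʳ d))))
    d∣A : ∀ s → s < m → d ∣ A (suc (dbl s))
    d∣A s _ = ∣ₚ.*-cancelʳ-∣ g {{>-nonZero 0<g}} (subst₂ _∣_ eq
      (sym (c*gcd[m,n]≡gcd[cm,cn] (A (suc (dbl s))) (A 1) (A′ 1)))
      (gcd-greatest (∣ₚ.n∣m*n (A (suc (dbl s))))
        (subst (A 1 ∣_) (trans (cross 1 s) (ℕₚ.*-comm (A′ 1) (A (suc (dbl s))))) (∣ₚ.m∣m*n (A′ (suc (dbl s)))))))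
    A₁≡g : A 1 ≡ g
    A₁≡g = trans eq (trans (cong (_* g) (prim m refl d d∣A)) (ℕₚ.*-identityˡ g))

module _ {A A′ : ℕ → ℕ} (A-pos : ∀ i → 0 < A i) (A′-pos : ∀ i → 0 < A′ i)
         (neighbours : ∀ i → A i * A (suc i) ≡ A′ i * A′ (suc i)) where
  private
    module R = Rescaled A-pos A′-pos neighbours
    module R′ = Rescaled A′-pos A-pos (λ i → sym (neighbours i))

  primitive-unique : ∀ m → Primitive (dbl m) A → Primitive (dbl m) A′ → ∀ i → A i ≡ A′ i
  primitive-unique m prim prim′ i = by-parity (parity i)
    where
    A₁≡ : A 1 ≡ A′ 1
    A₁≡ = ∣ₚ.∣-antisym (R.primitive-∣ m prim) (R′.primitive-∣ m prim′)
    odd : ∀ s → A (suc (dbl s)) ≡ A′ (suc (dbl s))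
    odd s = sym (ℕₚ.*-cancelˡ-≡ _ _ (A 1) {{>-nonZero (A-pos 1)}} (trans (R.cross 1 s) (cong (_* A (suc (dbl s))) (sym A₁≡))))
    by-parity : (∃ λ s → i ≡ dbl s ⊎ i ≡ suc (dbl s)) → A i ≡ A′ i
    by-parity (s , inj₁ refl) = *-cancel-pos (A-pos (suc (dbl s))) (trans (neighbours (dbl s)) (cong (A′ (dbl s) *_) (sym (odd s))))
    by-parity (s , inj₂ refl) = odd s

module Labels {w} {f : ℕ → V} (ch : Chain (suc (suc w)) f) where
  open ChainFrieze w ch

  A : ℕ → ℕ
  A i = ∣ det (V∞ (+ i)) (V∞ (+ i ℤ.+ + 2)) ∣

  private
    0<det : ∀ i → 0ℤ ℤ.< det (V∞ (+ i)) (V∞ (+ i ℤ.+ + 2))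
    0<det i = V∞-positive (+ i) 2 (s≤s z≤n) (s≤s (s≤s z≤n))

    +A : ∀ i → + A i ≡ det (V∞ (+ i)) (V∞ (+ i ℤ.+ + 2))
    +A i = ℤₚ.0≤i⇒+∣i∣≡i (ℤₚ.<⇒≤ (0<det i))

  A-pos : ∀ i → 0 < A i
  A-pos i = ℤₚ.drop‿+<+ (subst (0ℤ ℤ.<_) (sym (+A i)) (0<det i))

  A-neighbours : ∀ i → + (A i * A (suc i)) ≡ 1ℤ ℤ.+ YFriezePattern.b frieze (+ i) (+ i)
  A-neighbours i = trans (ℤₚ.pos-* (A i) (A (suc i))) (trans (cong₂ ℤ._*_ (+A i) (trans (+A (suc i))
    (cong₂ (λ x y → det (V∞ x) (V∞ y)) (ℤₚ.+-comm 1ℤ (+ i)) (e (+ i))))) (sym (1+b (+ i) (+ i))))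
    where
    e : ∀ i → 1ℤ ℤ.+ i ℤ.+ + 2 ≡ i ℤ.+ + 3
    e = ℤ-Ring.solve-∀

  A-period : ∀ i → A (i + suc (suc (suc w))) ≡ A i
  A-period i = cong ∣_∣ (trans (cong₂ det (V∞-period (+ i)) (trans (cong V∞ (e (+ i) (+ w))) (V∞-period (+ i ℤ.+ + 2))))
    (trans (det-⊖ˡ (V∞ (+ i)) _) (trans (cong ℤ.-_ (det-⊖ʳ (V∞ (+ i)) (V∞ (+ i ℤ.+ + 2)))) (ℤₚ.neg-involutive _))))
    where
    e : ∀ i w → i ℤ.+ (+ 3 ℤ.+ w) ℤ.+ + 2 ≡ i ℤ.+ + 2 ℤ.+ (+ 3 ℤ.+ w)
    e = ℤ-Ring.solve-∀

  A-label : ∀ k → k ≤ w → A k ≡ label f k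
  A-label k k≤w = cong₂ (λ x y → ∣ det x y ∣) (V∞-window 0ℤ k (ℕₚ.≤-trans k≤w (ℕₚ.≤-trans (ℕₚ.n≤1+n w) (ℕₚ.n≤1+n (suc w)))))
    (trans (cong (λ j → V∞ (+ j)) (ℕₚ.+-comm k 2)) (V∞-window 0ℤ (2 + k) (s≤s (s≤s k≤w))))

module _ {n f g} (chf : Chain n f) (chg : Chain n g) (labels : ∀ k → suc k < n → label f k ≡ label g k) where
  private
    step : ∀ {f} → Chain n f → ∀ u j → suc j < n → det u (f (suc (suc j))) ≡ + label f j ℤ.* det u (f (suc j)) - det u (f j)
    step {f} ch u j j+1<n = trans (eq (det u (f j)) (det u (f (suc (suc j))))) (cong (ℤ._- det u (f j)) (sym (begin
      + label f j ℤ.* det u (f (suc j))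
        ≡⟨ cong (ℤ._* det u (f (suc j))) (ℤₚ.0≤i⇒+∣i∣≡i (nonNegative j (suc (suc j)) (ℕₚ.≤-trans (ℕₚ.n≤1+n j) (ℕₚ.n≤1+n (suc j))) j+1<n)) ⟩
      det (f j) (f (suc (suc j))) ℤ.* det u (f (suc j))
        ≡⟨ ℤₚ.*-comm (det (f j) (f (suc (suc j)))) (det u (f (suc j))) ⟩
      det u (f (suc j)) ℤ.* det (f j) (f (suc (suc j)))
        ≡⟨ plücker u (f j) (f (suc j)) (f (suc (suc j))) ⟩
      det u (f j) ℤ.* det (f (suc j)) (f (suc (suc j))) ℤ.+ det u (f (suc (suc j))) ℤ.* det (f j) (f (suc j))
        ≡⟨ cong₂ (λ x y → det u (f j) ℤ.* x ℤ.+ det u (f (suc (suc j))) ℤ.* y) (unimodular (suc j) j+1<n) (unimodular j (ℕₚ.<⇒≤ j+1<n)) ⟩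
      det u (f j) ℤ.* 1ℤ ℤ.+ det u (f (suc (suc j))) ℤ.* 1ℤ ∎)))
      where
      open Chain ch
      open ≡-Reasoning
      eq : ∀ x z → z ≡ x ℤ.* 1ℤ ℤ.+ z ℤ.* 1ℤ - x
      eq = ℤ-Ring.solve-∀

  -- Plücker's relation gives the recurrence f (j+2) = label · f (j+1) - f j inside every
  -- determinant with a fixed `u`, and its coefficients agree for both chains.
  chain-dets : ∀ i k → i + k ≤ n → det (f i) (f (i + k)) ≡ det (g i) (g (i + k))
  chain-dets i zero    _ rewrite ℕₚ.+-identityʳ i = trans (det-self (f i)) (sym (det-self (g i)))
  chain-dets i (suc zero) i<n rewrite ℕₚ.+-comm i 1 = trans (Chain.unimodular chf i i<n) (sym (Chain.unimodular chg i i<n))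
  chain-dets i (suc (suc k)) i+k+2≤n = trans (cong (λ j → det (f i) (f j)) index) (trans (step chf (f i) (i + k) i+k+2≤n′)
    (trans (cong₂ (λ l (x , y) → + l ℤ.* x - y) (labels (i + k) i+k+2≤n′)
        (cong₂ _,_ (subst (λ j → det (f i) (f j) ≡ det (g i) (g j)) (ℕₚ.+-suc i k) (chain-dets i (suc k) (subst (_≤ n) (sym (ℕₚ.+-suc i k)) (ℕₚ.<⇒≤ i+k+2≤n′))))
                   (chain-dets i k (ℕₚ.<⇒≤ (ℕₚ.<⇒≤ i+k+2≤n′)))))
      (sym (trans (cong (λ j → det (g i) (g j)) index) (step chg (g i) (i + k) i+k+2≤n′)))))
    where
    index : i + suc (suc k) ≡ suc (suc (i + k))
    index = trans (ℕₚ.+-suc i (suc k)) (cong suc (ℕₚ.+-suc i k))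
    i+k+2≤n′ : suc (suc (i + k)) ≤ n
    i+k+2≤n′ = subst (_≤ n) index i+k+2≤n

  chain-unique : f 0 ≡ g 0 → f n ≡ g n → ∀ i → i ≤ n → f i ≡ g i
  chain-unique f₀ fₙ i i≤n = det-injective (Chain.closed chg)
    (trans (cong (det (f i)) (sym fₙ)) (subst (λ j → det (f i) (f j) ≡ det (g i) (g j)) (ℕₚ.m+[n∸m]≡n i≤n)
      (chain-dets i (n ∸ i) (ℕₚ.≤-reflexive (ℕₚ.m+[n∸m]≡n i≤n)))))
    (trans (cong (λ x → det x (f i)) (sym f₀)) (chain-dets 0 i i≤n))

private
  colour-odd : ∀ s → ¬ T (colour true (suc (dbl s)))
  colour-odd zero    ()
  colour-odd (suc s) = colour-odd s

NonDivisible⇒Primitive : ∀ {w} t → size t ≡ suc w → NonDivisible (suc w) t →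
                         ∀ {A} → (∀ k → k ≤ w → A k ≡ label (standard t) k) → Primitive (suc w) A
NonDivisible⇒Primitive {w} t size≡ nd {A} A≡ m p≡ d d∣A =
  nd d m p≡ (LabelDiv⇒Div true t (Reps-vertex t e₁ e₂) (standard-closed t) divs)
  where
  divs : LabelDiv d true (edges t) (standard t)
  divs k k<n Tk with parity k
  ... | s , inj₁ refl = contradiction Tk (colour-odd s)
  ... | s , inj₂ refl = subst (d ∣_) (A≡ (suc (dbl s)) (ℕₚ.≤-pred 2+k≤)) (d∣A s (dbl-cancel-≤ (suc s) m (subst (suc (suc (dbl s)) ≤_) p≡ 2+k≤)))
    where
    2+k≤ : suc (suc (dbl s)) ≤ suc w
    2+k≤ = ℕₚ.≤-pred (subst (suc (suc (dbl s)) <_) (trans (edges≡1+size t) (cong suc size≡)) k<n)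

-- The entries b i i give the products of neighbouring labels. These determine the labels, by the
-- period w + 3 if it is odd and by primitivity otherwise; the labels determine the chain and the
-- chain determines the tree.
tree-frieze-injective : ∀ {w} t s (t≡ : size t ≡ suc w) (s≡ : size s ≡ suc w) →
                        NonDivisible (suc w) t → NonDivisible (suc w) s → tree-frieze t t≡ ≈ tree-frieze s s≡ → t ≡ s
tree-frieze-injective {w} t s t≡ s≡ nt ns B≈ = Reps-unique t s (Reps-vertex t e₁ e₂)
  (Reps-cong s (λ i i≤ → sym (same i (subst (i ≤_) edges-s i≤))) (Reps-vertex s e₁ e₂))
  (trans edges-t (sym edges-s)) (subst (λ n → Chain n (standard t)) (sym edges-t) (tree-chain t t≡))
  where
  edges-t : edges t ≡ suc (suc w)
  edges-t = trans (edges≡1+size t) (cong suc t≡)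
  edges-s : edges s ≡ suc (suc w)
  edges-s = trans (edges≡1+size s) (cong suc s≡)
  module T = Labels (tree-chain t t≡)
  module S = Labels (tree-chain s s≡)
  neighbours : ∀ i → T.A i * T.A (suc i) ≡ S.A i * S.A (suc i)
  neighbours i = ℤₚ.+-injective (trans (T.A-neighbours i) (trans (cong (λ z → 1ℤ ℤ.+ z)
    (B≈ (+ i) (+ i) (subst (ℤ.- + 3 ℤ.≤_) (sym (ℤₚ.+-inverseʳ (+ i))) ℤ.-≤+) (subst (ℤ._≤ + w ℤ.+ + 2) (sym (ℤₚ.+-inverseʳ (+ i))) (+≤+ z≤n))))
    (sym (S.A-neighbours i))))
  A≡ : ∀ i → T.A i ≡ S.A i
  A≡ with parity (suc w)
  ... | m , inj₂ p≡ = Rescaled.odd-period T.A-pos S.A-pos neighbours (suc m)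
    (λ i → trans (cong (λ k → T.A (i + k)) (cong (λ k → suc (suc k)) (sym p≡))) (T.A-period i))
    (λ i → trans (cong (λ k → S.A (i + k)) (cong (λ k → suc (suc k)) (sym p≡))) (S.A-period i))
  ... | m , inj₁ p≡ = primitive-unique T.A-pos S.A-pos neighbours m
    (subst (λ p → Primitive p T.A) p≡ (NonDivisible⇒Primitive t t≡ nt T.A-label))
    (subst (λ p → Primitive p S.A) p≡ (NonDivisible⇒Primitive s s≡ ns S.A-label))
  same : ∀ i → i ≤ suc (suc w) → standard t i ≡ standard s i
  same = chain-unique (tree-chain t t≡) (tree-chain s s≡)
    (λ k k<n → trans (sym (T.A-label k (ℕₚ.≤-pred (ℕₚ.≤-pred k<n)))) (trans (A≡ k) (S.A-label k (ℕₚ.≤-pred (ℕₚ.≤-pred k<n)))))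
    (trans (vertex-0 t e₁ e₂) (sym (vertex-0 s e₁ e₂)))
    (trans (cong (standard t) (sym edges-t)) (trans (vertex-edges t e₁ e₂) (trans (sym (vertex-edges s e₁ e₂)) (cong (standard s) edges-s))))

-- Counting

lookup-injective : ∀ {a} {A : Set a} {xs : List A} → Unique xs → ∀ i j → lookup xs i ≡ lookup xs j → i ≡ j
lookup-injective (_   ∷ _)  Fin.zero    Fin.zero    _  = refl
lookup-injective (x∉ ∷ _)  Fin.zero    (Fin.suc j) eq = contradiction eq (All.lookup x∉ (∈ₚ.∈-lookup j))
lookup-injective (x∉ ∷ _)  (Fin.suc i) Fin.zero    eq = contradiction (sym eq) (All.lookup x∉ (∈ₚ.∈-lookup i))
lookup-injective (_   ∷ u) (Fin.suc i) (Fin.suc j) eq = cong Fin.suc (lookup-injective u i j eq)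

-- the values of f with p nodes, for maps f that multiply the number of nodes by c
images : ∀ {q} c → (Tree q → Tree 2) → ℕ → List (Tree 2)
images {q} c f p with c ∣? p
... | yes (divides k _) = map f (trees q k)
... | no  _             = []

module _ {q c} (f : Tree q → Tree 2) (f-size : ∀ s → size (f s) ≡ suc c * size s) (f-injective : ∀ {s t} → f s ≡ f t → s ≡ t) where
  ∈-images : ∀ s → f s ∈ images (suc c) f (size (f s))
  ∈-images s with suc c ∣? size (f s)
  ... | yes (divides k eq) = ∈ₚ.∈-map⁺ f (subst (λ k → s ∈ trees q k)
    (ℕₚ.*-cancelˡ-≡ (size s) k (suc c) (trans (sym (f-size s)) (trans eq (ℕₚ.*-comm k (suc c))))) (∈-trees s))
  ... | no c∤ = contradiction (divides (size s) (trans (f-size s) (ℕₚ.*-comm (suc c) (size s)))) c∤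

  images-sound : ∀ p {t} → t ∈ images (suc c) f p → size t ≡ p × ∃ λ s → f s ≡ t
  images-sound p t∈ with suc c ∣? p
  ... | yes (divides k refl) with s , s∈ , refl ← ∈ₚ.∈-map⁻ f t∈ =
    trans (f-size s) (trans (cong (suc c *_) (All.lookup (trees-size k) s∈)) (ℕₚ.*-comm (suc c) k)) , s , refl

  images-unique : ∀ p → Unique (images (suc c) f p)
  images-unique p with suc c ∣? p
  ... | yes (divides k _) = Uniqueₚ.map⁺ f-injective (trees-unique q k)
  ... | no  _             = []

length-images : ∀ {q} c f p → suc c ∣ p → length (images {suc q} (suc c) f p) ≡ fussCatalan (suc q) (p / suc c)
length-images {q} c f p c∣p with suc c ∣? p
... | yes (divides k refl) = trans (Listₚ.length-map f (trees (suc q) k))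
  (trans (trees-length q k) (cong (fussCatalan (suc q)) (sym (m*n/n≡m k (suc c)))))
... | no c∤p = contradiction c∣p c∤p

length-images-∤ : ∀ {q} c f p → ¬ suc c ∣ p → length (images {q} (suc c) f p) ≡ 0
length-images-∤ c f p c∤p with suc c ∣? p
... | yes c∣p = contradiction c∣p c∤p
... | no  _   = refl

divisible : ℕ → List (Tree 2)
divisible p = images 2 (quad true) p ++ images 4 (hex true) p

private
  quads-sound : ∀ p {t} → t ∈ images 2 (quad true) p → size t ≡ p × ∃ λ s → quad true s ≡ t
  quads-sound = images-sound (quad true) (quad-size true) (quad-injective true _ _)

  hexes-sound : ∀ p {t} → t ∈ images 4 (hex true) p → size t ≡ p × ∃ λ s → hex true s ≡ t
  hexes-sound = images-sound (hex true) (hex-size true) (hex-injective true _ _)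

-- Positive size matters: a single edge is both the empty quadrangulation and the empty
-- hexangulation.
divisible-unique : ∀ p → Unique (divisible (suc p))
divisible-unique p = Uniqueₚ.++⁺
  (images-unique (quad true) (quad-size true) (quad-injective true _ _) (suc p))
  (images-unique (hex true) (hex-size true) (hex-injective true _ _) (suc p))
  λ (t∈quads , t∈hexes) → disjoint (quads-sound (suc p) t∈quads) (hexes-sound (suc p) t∈hexes)
  where
  disjoint : ∀ {t} → size t ≡ suc p × (∃ λ s → quad true s ≡ t) → size t ≡ suc p × (∃ λ s → hex true s ≡ t) → ⊥
  disjoint (size≡ , s , refl) (_ , s′ , eq) = quad≢hex s s′ (subst (0 <_) (sym size≡) (s≤s z≤n)) (sym eq)

divisible⊆trees : ∀ p {t} → t ∈ divisible p → t ∈ trees 2 p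
divisible⊆trees p {t} t∈ with ∈ₚ.∈-++⁻ (images 2 (quad true) p) t∈
... | inj₁ t∈quads = subst (λ p → t ∈ trees 2 p) (proj₁ (quads-sound p t∈quads)) (∈-trees t)
... | inj₂ t∈hexes = subst (λ p → t ∈ trees 2 p) (proj₁ (hexes-sound p t∈hexes)) (∈-trees t)

∉-divisible⇒NonDivisible : ∀ {w} t → size t ≡ suc w → t ∉ divisible (suc w) → NonDivisible (suc w) t
∉-divisible⇒NonDivisible {w} t size≡ t∉ d m p≡ div = cases d div
  where
  -- An even number of triangles gives an odd number of edges besides the root edge, so the root
  -- edge joins the two colours and `Forced` yields a `Good` tree.
  end≡ : end true t ≡ false
  end≡ = trans (sym (colour-edges true t)) (trans (cong (colour true) (trans (edges≡1+size t) (cong suc (trans size≡ p≡)))) (even m))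
    where
    even : ∀ m → colour true (suc (dbl m)) ≡ false
    even zero    = refl
    even (suc m) = even m
  bad : ∀ {d} → ¬ Good d true t
  bad (inj₁ refl) = ℕₚ.0≢1+n size≡
  bad (inj₂ (inj₁ (_ , s , refl))) = t∉ (∈ₚ.∈-++⁺ˡ (subst (λ p → t ∈ images 2 (quad true) p) size≡
    (∈-images (quad true) (quad-size true) (quad-injective true _ _) s)))
  bad (inj₂ (inj₂ (_ , s , refl))) = t∉ (∈ₚ.∈-++⁺ʳ (images 2 (quad true) (suc w)) (subst (λ p → t ∈ images 4 (hex true) p) size≡
    (∈-images (hex true) (hex-size true) (hex-injective true _ _) s)))
  refute : ∀ {d} → 2 ≤ d → Div d true t → ⊥
  refute {d} 2≤d div = bad (proj₁ (subst (λ c → Forced d true c t) end≡ (forced 2≤d true t div)))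
  cases : ∀ d → Div d true t → d ≡ 1
  -- Divisibility by 0 implies divisibility by 2, so this case reduces to d = 2.
  cases 0             div = ⊥-elim (refute {2} ℕₚ.≤-refl (Div-0 true t div))
    where
    Div-0 : ∀ c t → Div 0 c t → Div 2 c t
    Div-0 c leaf       _              = _
    Div-0 c (fork t u) (dt , d∣ , du) = Div-0 c t dt , (λ x → ∣-trans (2 ∣ₚ.∣0) (d∣ x)) , Div-0 (end c t) u du
  cases 1             _   = refl
  cases (suc (suc d)) div = ⊥-elim (refute (s≤s (s≤s z≤n)) div)

NonDivisible⇒∉-divisible : ∀ {w} t → NonDivisible (suc w) t → t ∉ divisible (suc w)
NonDivisible⇒∉-divisible {w} t nd t∈ = by-shape (∈ₚ.∈-++⁻ (images 2 (quad true) (suc w)) t∈)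
  where
  halve : ∀ k → 2 * k ≡ dbl k
  halve zero    = refl
  halve (suc k) = cong suc (trans (ℕₚ.+-suc k (k + 0)) (cong suc (halve k)))
  by-shape : t ∈ images 2 (quad true) (suc w) ⊎ t ∈ images 4 (hex true) (suc w) → ⊥
  by-shape (inj₁ t∈) with size≡ , s , refl ← quads-sound (suc w) t∈ = contradiction
    (nd 2 (size s) (trans (sym size≡) (trans (quad-size true s) (halve (size s)))) (quad-Div true s)) λ ()
  by-shape (inj₂ t∈) with size≡ , s , refl ← hexes-sound (suc w) t∈ = contradiction
    (nd 3 (2 * size s) (trans (sym size≡) (trans (hex-size true s) (trans (ℕₚ.*-assoc 2 2 (size s)) (halve (2 * size s))))) (hex-Div true s)) λ ()

nonDivisibleTrees : ℕ → List (Tree 2)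
nonDivisibleTrees p = _∖_ _≟ᵗ_ (trees 2 p) (divisible p)

module Cardinality (w : ℕ) where
  private
    p = suc w
    ts = nonDivisibleTrees p

    sound : ∀ {t} → t ∈ ts → size t ≡ p × NonDivisible p t
    sound {t} t∈ with t∈trees , t∉ ← ∈-∖⁻ _≟ᵗ_ (trees 2 p) (divisible p) t∈ =
      size≡ , ∉-divisible⇒NonDivisible t size≡ t∉
      where
      size≡ = All.lookup (trees-size p) t∈trees

    tree∈ : (B : YFriezePattern (+ w)) → TreeOf.tree (tree-of B) ∈ ts
    tree∈ B = ∈-∖⁺ _≟ᵗ_ (subst (λ n → tree ∈ trees 2 n) tree-size (∈-trees tree)) (NonDivisible⇒∉-divisible tree nonDivisible)
      where open TreeOf (tree-of B)

    to : YFriezePattern (+ w) → Fin (length ts)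
    to B = Any.index (tree∈ B)

    lookup-size : ∀ i → size (lookup ts i) ≡ p
    lookup-size i = proj₁ (sound (∈ₚ.∈-lookup i))

    from : Fin (length ts) → YFriezePattern (+ w)
    from i = tree-frieze (lookup ts i) (lookup-size i)

    from-to : ∀ B → from (to B) ≈ B
    from-to B = subst (λ t → ∀ t≡ → tree-frieze t t≡ ≈ B) (lookup-index (tree∈ B))
      (λ t≡ → subst (λ t≡ → tree-frieze tree t≡ ≈ B) (ℕₚ.≡-irrelevant tree-size t≡) frieze-≈) (lookup-size (to B))
      where open TreeOf (tree-of B)

    from-injective : ∀ i j → from i ≈ from j → i ≡ j
    from-injective i j eq = lookup-injective (∖-unique _≟ᵗ_ (divisible p) (trees-unique 2 p)) i j
      (tree-frieze-injective (lookup ts i) (lookup ts j) (lookup-size i) (lookup-size j)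
        (proj₂ (sound (∈ₚ.∈-lookup i))) (proj₂ (sound (∈ₚ.∈-lookup j))) eq)

    ≈-sym : {B B′ : YFriezePattern (+ w)} → B ≈ B′ → B′ ≈ B
    ≈-sym eq i j l u = sym (eq i j l u)

    ≈-trans : {B B′ B″ : YFriezePattern (+ w)} → B ≈ B′ → B′ ≈ B″ → B ≈ B″
    ≈-trans eq eq′ i j l u = trans (eq i j l u) (eq′ i j l u)

    -- Since `from` is injective and `from (to B) ≈ B`, the index does not depend on the choices
    -- made in `tree-of`; congruence of `to` and one inverse law follow.
    to-unique : ∀ B i → from i ≈ B → to B ≡ i
    to-unique B i eq = from-injective (to B) i (≈-trans {from (to B)} {B} {from i} (from-to B) (≈-sym {from i} {B} eq))

  cardinality : HasCardinality (YFrieze (+ w)) (length (nonDivisibleTrees (suc w)))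
  cardinality = record
    { to        = to
    ; from      = from
    ; to-cong   = λ {B} {B′} eq → to-unique B (to B′) (≈-trans {from (to B′)} {B′} {B} (from-to B′) (≈-sym {B} {B′} eq))
    ; from-cong = λ { refl i j _ _ → refl }
    ; inverse   = (λ {i} {B} eq → to-unique B i (≈-sym {B} {from i} eq)) , λ { {B} refl → from-to B }
    }

open Cardinality using (cardinality)

nonDivisibleTrees-length : ∀ w → length (nonDivisibleTrees (suc w)) + (length (images 2 (quad true) (suc w)) + length (images 4 (hex true) (suc w))) ≡ fussCatalan 2 (suc w)
nonDivisibleTrees-length w = trans (cong (λ k → length (nonDivisibleTrees (suc w)) + k) (sym (Listₚ.length-++ (images 2 (quad true) (suc w)))))
  (trans (∖-length _≟ᵗ_ (trees-unique 2 (suc w)) (divisible-unique w) (divisible⊆trees (suc w))) (trees-length 1 (suc w)))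

private
  ∣-remainder : ∀ {d n} → d ∣ n → ∀ r q → n ≡ r + q * 4 → d ∣ 4 → d ∣ r
  ∣-remainder {d} d∣n r q refl d∣4 = ∣m+n∣m⇒∣n (subst (λ n → d ∣ n) (ℕₚ.+-comm r (q * 4)) d∣n) (∣-trans d∣4 (n∣m*n q))

  subtract : ∀ n a {b} → n + a ≡ b → + n ≡ + b - + a
  subtract n a refl = eq (+ n) (+ a)
    where
    eq : ∀ n a → n ≡ n ℤ.+ a - a
    eq = ℤ-Ring.solve-∀

  subtract₂ : ∀ n a b {c} → n + (a + b) ≡ c → + n ≡ + c - + a - + b
  subtract₂ n a b refl = eq (+ n) (+ a) (+ b)
    where
    eq : ∀ n a b → n ≡ n ℤ.+ (a ℤ.+ b) - a - b
    eq = ℤ-Ring.solve-∀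

theoremB : (w : ℕ) → ∃[ N ] (HasCardinality (YFrieze (+ w)) N ×
    (w % 2 ≡ 0 → + N ≡ + fussCatalan 2 (w + 1)) ×
    (w % 4 ≡ 1 → + N ≡ + fussCatalan 2 (w + 1) - + fussCatalan 3 ((w + 1) / 2)) ×
    (w % 4 ≡ 3 → + N ≡ + fussCatalan 2 (w + 1) - + fussCatalan 3 ((w + 1) / 2) - + fussCatalan 5 ((w + 1) / 4)))
theoremB w = N , cardinality w , subst Claims (ℕₚ.+-comm 1 w) (even , one-mod-4 , three-mod-4)
  where
  p = suc w
  N = length (nonDivisibleTrees p)
  Claims : ℕ → Set
  Claims p = (w % 2 ≡ 0 → + N ≡ + fussCatalan 2 p) ×
             (w % 4 ≡ 1 → + N ≡ + fussCatalan 2 p - + fussCatalan 3 (p / 2)) ×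
             (w % 4 ≡ 3 → + N ≡ + fussCatalan 2 p - + fussCatalan 3 (p / 2) - + fussCatalan 5 (p / 4))
  2∣4 : 2 ∣ 4
  2∣4 = divides 2 refl
  total : ∀ {a b} → length (images 2 (quad true) p) ≡ a → length (images 4 (hex true) p) ≡ b → N + (a + b) ≡ fussCatalan 2 p
  total eq₁ eq₂ = subst₂ (λ a b → N + (a + b) ≡ fussCatalan 2 p) eq₁ eq₂ (nonDivisibleTrees-length w)
  p≡ : ∀ {r} → w % 4 ≡ r → p ≡ suc r + (w / 4) * 4
  p≡ eq = cong suc (trans (m≡m%n+[m/n]*n w 4) (cong (λ r → r + (w / 4) * 4) eq))
  -- Here p is odd, so there are no dissections of either kind.
  even : w % 2 ≡ 0 → + N ≡ + fussCatalan 2 p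
  even eq = cong +_ (trans (sym (ℕₚ.+-identityʳ N)) (total (length-images-∤ 1 (quad true) p 2∤p) (length-images-∤ 3 (hex true) p (λ 4∣p → 2∤p (∣-trans 2∣4 4∣p)))))
    where
    2∤p : ¬ 2 ∣ p
    2∤p 2∣p = from-no (2 ∣? 1) (∣m+n∣m⇒∣n (subst (2 ∣_) (ℕₚ.+-comm 1 w) 2∣p)
      (divides (w / 2) (trans (m≡m%n+[m/n]*n w 2) (cong (λ r → r + (w / 2) * 2) eq))))
  one-mod-4 : w % 4 ≡ 1 → + N ≡ + fussCatalan 2 p - + fussCatalan 3 (p / 2)
  one-mod-4 eq = subtract N (fussCatalan 3 (p / 2)) (trans (cong (λ k → N + k) (sym (ℕₚ.+-identityʳ _)))
    (total (length-images 1 (quad true) p (subst (2 ∣_) (sym (p≡ eq)) (∣m∣n⇒∣m+n ∣-refl (∣-trans 2∣4 (n∣m*n (w / 4))))))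
      (length-images-∤ 3 (hex true) p (λ 4∣p → from-no (4 ∣? 2) (∣-remainder 4∣p 2 (w / 4) (p≡ eq) ∣-refl)))))
  three-mod-4 : w % 4 ≡ 3 → + N ≡ + fussCatalan 2 p - + fussCatalan 3 (p / 2) - + fussCatalan 5 (p / 4)
  three-mod-4 eq = subtract₂ N (fussCatalan 3 (p / 2)) (fussCatalan 5 (p / 4)) (total (length-images 1 (quad true) p (∣-trans 2∣4 4∣p)) (length-images 3 (hex true) p 4∣p))
    where
    4∣p : 4 ∣ p
    4∣p = subst (4 ∣_) (sym (p≡ eq)) (∣m∣n⇒∣m+n ∣-refl (n∣m*n (w / 4)))
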